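{- For every integer $p\ge 1$, $$\begin{aligned} &\frac32\sum_{n=1}^\infty \frac{L_n^2(1)}{n^{p+1}}(-1)^{n-1}-\left(1+(-1)^{p-1}\right)\sum_{n=1}^\infty\frac{H_n^2}{n^{p+1}}(-1)^{n-1}\\ &=\ln 2\left(\zeta^\star(\overline{p+1},\overline 1)-\zeta^\star(\overline{p+1},1)\right)+\frac12\zeta(2)\left\{\zeta(p+1)+\bar\zeta(p+1)\right\}\\ &\quad+\frac12\zeta^\star(\overline{p+1},2)-\sum_{j=2}^p\left(1-(-1)^{j-1}\right)\zeta^\star(\overline j,1)\,\zeta(p+2-j)\\ &\quad-\sum_{j=2}^{p+1}\zeta^\star(j,\overline 1)\,\bar\zeta(p+2-j)+\left(p+2+(-1)^{p-1}\right)\zeta^\star(\overline{p+2},1)-\zeta^\star(p+2,\overline 1)\\ &\quad-\sum_{i=1}^{p-1}(-1)^{i-1}\zeta(p+1-i)\,\bar\zeta(i+2)-(p+1)\zeta^\star(\overline{p+2},\overline 1)+\ln 2\,\zeta^\star(\overline{p+1},\overline 1). \end{aligned}$$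
   Context: For integers $n,k\ge1$: $H_n=\sum_{j=1}^n \frac1j$, $L_n(k)=\sum_{j=1}^n \frac{(-1)^{j-1}}{j^k}$. $\zeta$ is the Riemann zeta function and $\bar\zeta(s)=\sum_{n=1}^\infty \frac{(-1)^{n-1}}{n^s}$ for $\Re(s)\ge 1$ (so $\bar\zeta(1)=\ln 2$). Multiple zeta-star values: for positive integers $s_1,\dots,s_k$, each possibly carrying a bar, $\zeta^\star(s_1,\dots,s_k)=\sum_{n_1\ge n_2\ge\cdots\ge n_k\ge1}\prod_{j=1}^k \frac{\varepsilon_j^{n_j}}{n_j^{s_j}}$, where $\varepsilon_j=-1$ if $s_j$ is barred and $\varepsilon_j=1$ otherwise; the series is read as the sum over $n_1$ of the finite inner sums. For instance $\zeta^\star(\bar q,p)=\sum_{m\ge1}\frac{(-1)^m}{m^q}\sum_{n=1}^m\frac1{n^p}$. Empty sums are zero. -}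

module Defs where

open import Data.Integer.Base as ℤ using (+_; -[1+_]; +[1+_]; +0)
import Data.Integer.Properties as ℤ
open import Data.Nat.Base as ℕ using (ℕ; zero; suc; 2+; NonZero; NonTrivial; z≤n; s≤s)
import Data.Nat.Properties as ℕ
open import Data.Product.Base using (∃-syntax; _×_; _,_; proj₁; proj₂)
open import Data.Rational.Base
  using (ℚ; mkℚ; 0ℚ; 1ℚ; ½; _+_; _*_; _-_; -_; _/_; ∣_∣; _≤_; _<_; *<*; toℚᵘ;
    +-*-rawSemiring; nonNegative; positive; Positive)
open import Data.Rational.Properties as ℚ
  using (≤-refl; ≤-trans; ≤-reflexive; <-≤-trans; ≤-<-trans; +-mono-≤; +-mono-<)
open import Data.Rational.Solver using (module +-*-Solver)
import Data.Rational.Unnormalised.Base as ℚᵘ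
import Data.Rational.Unnormalised.Properties as ℚᵘ
open import Data.Sum.Base using (inj₁; inj₂)
open import Relation.Binary.PropositionalEquality
open import Relation.Nullary using (contradiction)

open import Algebra.Definitions.RawSemiring +-*-rawSemiring public
  using (_^_)

IsCauchy : (ℕ → ℚ) → Set
IsCauchy x = ∀ ε → 0ℚ < ε → ∃[ N ] (∀ m n → N ℕ.≤ m → N ℕ.≤ n → ∣ x m - x n ∣ < ε)

record ℝ : Set where
  constructor mkℝ
  field
    approx   : ℕ → ℚ
    isCauchy : IsCauchy approx

open ℝ public

-- Equality of reals is this relation (the difference tends to 0), not _≡_.
infix 4 _≃_

_≃_ : ℝ → ℝ → Set
x ≃ y = ∀ ε → 0ℚ < ε → ∃[ N ] (∀ n → N ℕ.≤ n → ∣ approx x n - approx y n ∣ < ε)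

diff⇒≤ : ∀ {p q} → 0ℚ ≤ q - p → p ≤ q
diff⇒≤ {p} {q} h = subst₂ _≤_ (ℚ.+-identityˡ p) lemma (ℚ.+-monoˡ-≤ p h)
  where
  open +-*-Solver
  lemma : q - p + p ≡ q
  lemma = solve 2 (λ p q → q :- p :+ p := q) refl p q

≤⇒diff : ∀ {p q} → p ≤ q → 0ℚ ≤ q - p
≤⇒diff {p} {q} h = subst (_≤ q - p) (ℚ.+-inverseʳ p) (ℚ.+-monoˡ-≤ (- p) h)

0≤+ : ∀ {p q} → 0ℚ ≤ p → 0ℚ ≤ q → 0ℚ ≤ p + q
0≤+ {p} {q} hp hq = subst (_≤ p + q) (ℚ.+-identityˡ 0ℚ) (+-mono-≤ hp hq)

0≤* : ∀ {p q} → 0ℚ ≤ p → 0ℚ ≤ q → 0ℚ ≤ p * q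
0≤* {p} {q} hp hq =
  subst (_≤ p * q) (ℚ.*-zeroʳ p) (ℚ.*-monoˡ-≤-nonNeg p {{nonNegative hp}} hq)

0<+ : ∀ {p q} → 0ℚ < p → 0ℚ < q → 0ℚ < p + q
0<+ {p} {q} hp hq = subst (_< p + q) (ℚ.+-identityˡ 0ℚ) (+-mono-< hp hq)

0<* : ∀ {p q} → 0ℚ < p → 0ℚ < q → 0ℚ < p * q
0<* {p} {q} hp hq =
  subst (_< p * q) (ℚ.*-zeroʳ p) (ℚ.*-monoʳ-<-pos p {{positive hp}} hq)

*-mono-≤ : ∀ {p q r s} → 0ℚ ≤ p → 0ℚ ≤ s → p ≤ q → r ≤ s → p * r ≤ q * s
*-mono-≤ {p} {q} {r} {s} hp hs pq rs = ≤-trans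
  (ℚ.*-monoˡ-≤-nonNeg p {{nonNegative hp}} rs)
  (ℚ.*-monoʳ-≤-nonNeg s {{nonNegative hs}} pq)

0≤1 : 0ℚ ≤ 1ℚ
0≤1 = ℚ.nonNegative⁻¹ 1ℚ

0<1 : 0ℚ < 1ℚ
0<1 = ℚ.positive⁻¹ 1ℚ

0<½ : 0ℚ < ½
0<½ = ℚ.positive⁻¹ ½

halves : ∀ ε → ½ * ε + ½ * ε ≡ ε
halves = solve 1 (λ e → con ½ :* e :+ con ½ :* e := e) refl
  where open +-*-Solver

∣-∣-comm : ∀ p q → ∣ p - q ∣ ≡ ∣ q - p ∣
∣-∣-comm p q = trans (sym (ℚ.∣-p∣≡∣p∣ (p - q)))
  (cong ∣_∣ (solve 2 (λ p q → :- (p :- q) := q :- p) refl p q))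
  where open +-*-Solver

∣-∣-triangle : ∀ p q r → ∣ p - r ∣ ≤ ∣ p - q ∣ + ∣ q - r ∣
∣-∣-triangle p q r = subst (λ x → ∣ x ∣ ≤ ∣ p - q ∣ + ∣ q - r ∣)
  (solve 3 (λ p q r → (p :- q) :+ (q :- r) := p :- r) refl p q r)
  (ℚ.∣p+q∣≤∣p∣+∣q∣ (p - q) (q - r))
  where open +-*-Solver

-- It suffices to control x (n + k) - x n.
tails⇒isCauchy : ∀ x →
  (∀ ε → 0ℚ < ε → ∃[ N ] (∀ n k → N ℕ.≤ n → ∣ x (n ℕ.+ k) - x n ∣ < ε)) → IsCauchy x
tails⇒isCauchy x h ε 0<ε with h ε 0<ε
... | N , H = N , λ m n N≤m N≤n → go m n N≤m N≤n (ℕ.≤-total m n)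
  where
  step : ∀ m n → N ℕ.≤ n → n ℕ.≤ m → ∣ x m - x n ∣ < ε
  step m n N≤n n≤m =
    subst (λ k → ∣ x k - x n ∣ < ε) (ℕ.m+[n∸m]≡n n≤m) (H n (m ℕ.∸ n) N≤n)
  go : ∀ m n → N ℕ.≤ m → N ℕ.≤ n → _ → ∣ x m - x n ∣ < ε
  go m n N≤m N≤n (inj₁ m≤n) = subst (_< ε) (∣-∣-comm (x n) (x m)) (step n m N≤m m≤n)
  go m n N≤m N≤n (inj₂ n≤m) = step m n N≤n n≤m

const-isCauchy : ∀ q → IsCauchy (λ _ → q)
const-isCauchy q ε 0<ε = 0 , λ _ _ _ _ → subst (λ d → ∣ d ∣ < ε) (sym (ℚ.+-inverseʳ q)) 0<ε

+-isCauchy : ∀ x y → IsCauchy x → IsCauchy y → IsCauchy (λ n → x n + y n)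
+-isCauchy x y cx cy ε 0<ε with cx (½ * ε) (0<* 0<½ 0<ε) | cy (½ * ε) (0<* 0<½ 0<ε)
... | M , hx | N , hy = M ℕ.⊔ N , λ m n hm hn → ≤-<-trans
  (subst (λ d → ∣ d ∣ ≤ ∣ x m - x n ∣ + ∣ y m - y n ∣)
    (solve 4 (λ a b c d → (a :- b) :+ (c :- d) := (a :+ c) :- (b :+ d)) refl (x m) (x n) (y m) (y n))
    (ℚ.∣p+q∣≤∣p∣+∣q∣ (x m - x n) (y m - y n)))
  (subst (_ <_) (halves ε) (+-mono-<
    (hx m n (ℕ.m⊔n≤o⇒m≤o M N hm) (ℕ.m⊔n≤o⇒m≤o M N hn))
    (hy m n (ℕ.m⊔n≤o⇒n≤o M N hm) (ℕ.m⊔n≤o⇒n≤o M N hn))))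
  where open +-*-Solver

neg-isCauchy : ∀ x → IsCauchy x → IsCauchy (λ n → - x n)
neg-isCauchy x cx ε 0<ε with cx ε 0<ε
... | N , h = N , λ m n hm hn → subst (_< ε)
  (trans (∣-∣-comm (x m) (x n))
    (cong ∣_∣ (solve 2 (λ a b → b :- a := :- a :- :- b) refl (x m) (x n))))
  (h m n hm hn)
  where open +-*-Solver

abstract
  eventually-bounded : ∀ x → IsCauchy x →
    ∃[ B ] 0ℚ < B × ∃[ N ] (∀ n → N ℕ.≤ n → ∣ x n ∣ ≤ B)
  eventually-bounded x cx with cx 1ℚ 0<1
  ... | N , h = 1ℚ + ∣ x N ∣ , <-≤-trans 0<1 one≤ , N , λ n N≤n → ≤-trans
    (subst (λ d → ∣ d ∣ ≤ ∣ x n - x N ∣ + ∣ x N ∣)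
      (solve 2 (λ a b → (a :- b) :+ b := a) refl (x n) (x N))
      (ℚ.∣p+q∣≤∣p∣+∣q∣ (x n - x N) (x N)))
    (ℚ.+-monoˡ-≤ ∣ x N ∣ (ℚ.<⇒≤ (h n N N≤n ℕ.≤-refl)))
    where
    open +-*-Solver
    one≤ : 1ℚ ≤ 1ℚ + ∣ x N ∣
    one≤ = subst (_≤ 1ℚ + ∣ x N ∣) (ℚ.+-identityʳ 1ℚ) (ℚ.+-monoʳ-≤ 1ℚ (ℚ.0≤∣p∣ (x N)))

  shrink : ∀ B → 0ℚ < B → ∀ ε → 0ℚ < ε → ∃[ δ ] 0ℚ < δ × B * δ ≡ ε
  shrink B 0<B ε 0<ε = b⁻¹ * ε , 0<* (ℚ.positive⁻¹ b⁻¹ {{ℚ.1/pos⇒pos B}}) 0<ε ,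
    trans (sym (ℚ.*-assoc B b⁻¹ ε)) (trans (cong (_* ε) (ℚ.*-inverseʳ B)) (ℚ.*-identityˡ ε))
    where
    open Data.Rational.Base using (1/_)
    instance
      B-pos : Positive B
      B-pos = positive 0<B
      B-nonZero : Data.Rational.Base.NonZero B
      B-nonZero = ℚ.pos⇒nonZero B
    b⁻¹ : ℚ
    b⁻¹ = 1/ B

*-isCauchy : ∀ x y → IsCauchy x → IsCauchy y → IsCauchy (λ n → x n * y n)
*-isCauchy x y cx cy ε 0<ε =
  (M₁ ℕ.⊔ M₂) ℕ.⊔ (N₁ ℕ.⊔ N₂) , bound
  where
  open +-*-Solver
  bounded-x = eventually-bounded x cx
  bounded-y = eventually-bounded y cy
  A   = proj₁ bounded-x
  0<A = proj₁ (proj₂ bounded-x)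
  M₁  = proj₁ (proj₂ (proj₂ bounded-x))
  bx  = proj₂ (proj₂ (proj₂ bounded-x))
  B   = proj₁ bounded-y
  0<B = proj₁ (proj₂ bounded-y)
  M₂  = proj₁ (proj₂ (proj₂ bounded-y))
  by  = proj₂ (proj₂ (proj₂ bounded-y))
  small-x = shrink B 0<B (½ * ε) (0<* 0<½ 0<ε)
  small-y = shrink A 0<A (½ * ε) (0<* 0<½ 0<ε)
  δ   = proj₁ small-x
  0<δ = proj₁ (proj₂ small-x)
  eδ  = proj₂ (proj₂ small-x)
  η   = proj₁ small-y
  0<η = proj₁ (proj₂ small-y)
  eη  = proj₂ (proj₂ small-y)
  N₁  = proj₁ (cx δ 0<δ)
  hx  = proj₂ (cx δ 0<δ)
  N₂  = proj₁ (cy η 0<η)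
  hy  = proj₂ (cy η 0<η)
  bound : ∀ m n → (M₁ ℕ.⊔ M₂) ℕ.⊔ (N₁ ℕ.⊔ N₂) ℕ.≤ m → (M₁ ℕ.⊔ M₂) ℕ.⊔ (N₁ ℕ.⊔ N₂) ℕ.≤ n →
    ∣ x m * y m - x n * y n ∣ < ε
  bound m n hm hn = ≤-<-trans
    (subst (λ d → ∣ d ∣ ≤ ∣ y m * (x m - x n) ∣ + ∣ x n * (y m - y n) ∣)
      (solve 4 (λ a b c d → c :* (a :- b) :+ b :* (c :- d) := a :* c :- b :* d) refl
        (x m) (x n) (y m) (y n))
      (ℚ.∣p+q∣≤∣p∣+∣q∣ (y m * (x m - x n)) (x n * (y m - y n))))
    (subst (_ <_) (trans (cong₂ _+_ eδ eη) (halves ε)) (+-mono-<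
      (piece (y m) (x m - x n) B δ 0<B (by m m≥M₂) (hx m n m≥N₁ n≥N₁))
      (piece (x n) (y m - y n) A η 0<A (bx n n≥M₁) (hy m n m≥N₂ n≥N₂))))
    where
    m≥M = ℕ.m⊔n≤o⇒m≤o (M₁ ℕ.⊔ M₂) (N₁ ℕ.⊔ N₂) hm
    m≥N = ℕ.m⊔n≤o⇒n≤o (M₁ ℕ.⊔ M₂) (N₁ ℕ.⊔ N₂) hm
    n≥M = ℕ.m⊔n≤o⇒m≤o (M₁ ℕ.⊔ M₂) (N₁ ℕ.⊔ N₂) hn
    n≥N = ℕ.m⊔n≤o⇒n≤o (M₁ ℕ.⊔ M₂) (N₁ ℕ.⊔ N₂) hn
    m≥M₂ = ℕ.m⊔n≤o⇒n≤o M₁ M₂ m≥M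
    n≥M₁ = ℕ.m⊔n≤o⇒m≤o M₁ M₂ n≥M
    m≥N₁ = ℕ.m⊔n≤o⇒m≤o N₁ N₂ m≥N
    m≥N₂ = ℕ.m⊔n≤o⇒n≤o N₁ N₂ m≥N
    n≥N₁ = ℕ.m⊔n≤o⇒m≤o N₁ N₂ n≥N
    n≥N₂ = ℕ.m⊔n≤o⇒n≤o N₁ N₂ n≥N
    piece : ∀ a d C γ → 0ℚ < C → ∣ a ∣ ≤ C → ∣ d ∣ < γ → ∣ a * d ∣ < C * γ
    piece a d C γ 0<C a≤C d<γ = subst (_< C * γ) (sym (ℚ.∣p*q∣≡∣p∣*∣q∣ a d)) (≤-<-trans
      (ℚ.*-monoʳ-≤-nonNeg ∣ d ∣ {{nonNegative (ℚ.0≤∣p∣ d)}} a≤C)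
      (ℚ.*-monoʳ-<-pos C {{positive 0<C}} d<γ))

infix  8 ⊖_
infixl 7 _⊗_
infixl 6 _⊕_ _⊝_

fromℚ : ℚ → ℝ
fromℚ q = mkℝ (λ _ → q) (const-isCauchy q)

_⊕_ : ℝ → ℝ → ℝ
x ⊕ y = mkℝ (λ n → approx x n + approx y n) (+-isCauchy (approx x) (approx y) (isCauchy x) (isCauchy y))

_⊗_ : ℝ → ℝ → ℝ
x ⊗ y = mkℝ (λ n → approx x n * approx y n) (*-isCauchy (approx x) (approx y) (isCauchy x) (isCauchy y))

⊖_ : ℝ → ℝ
⊖ x = mkℝ (λ n → - approx x n) (neg-isCauchy (approx x) (isCauchy x))

_⊝_ : ℝ → ℝ → ℝ
x ⊝ y = x ⊕ (⊖ y)

sumBelow : (m : ℕ) → ((i : ℕ) → .(i ℕ.< m) → ℝ) → ℝ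
sumBelow zero    f = fromℚ 0ℚ
sumBelow (suc m) f = sumBelow m (λ i i<m → f i (ℕ.m≤n⇒m≤1+n i<m)) ⊕ f m ℕ.≤-refl

index-bound : ∀ lo hi i → i ℕ.< suc hi ℕ.∸ lo → lo ℕ.+ i ℕ.≤ hi
index-bound zero     hi       i i< = ℕ.≤-pred i<
index-bound (suc lo) zero     i i< = contradiction (subst (i ℕ.<_) (ℕ.0∸n≡0 lo) i<) ℕ.n≮0
index-bound (suc lo) (suc hi) i i< = s≤s (index-bound lo hi i i<)

-- ∑ lo hi f = f lo ⊕ f (lo + 1) ⊕ ⋯ ⊕ f hi, which is 0 when hi < lo.
∑ : (lo hi : ℕ) → ((j : ℕ) → .(lo ℕ.≤ j) → .(j ℕ.≤ hi) → ℝ) → ℝ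
∑ lo hi f = sumBelow (suc hi ℕ.∸ lo)
  λ i i< → f (lo ℕ.+ i) (ℕ.m≤m+n lo i) (index-bound lo hi i i<)

Terms : Set
Terms = (n : ℕ) → .{{_ : NonZero n}} → ℚ

partialSum : Terms → ℕ → ℚ
partialSum a zero    = 0ℚ
partialSum a (suc n) = partialSum a n + a (suc n)

Convergent : Terms → Set
Convergent a = IsCauchy (partialSum a)

∑∞ : (a : Terms) → Convergent a → ℝ
∑∞ a conv = mkℝ (partialSum a) conv

fromℕ : ℕ → ℚ
fromℕ n = + n / 1

recip : Terms
recip n = + 1 / n

H : ℕ → ℚ
H = partialSum recip

L : ℕ → ℕ → ℚ
L k = partialSum λ j → (- 1ℚ) ^ (j ℕ.∸ 1) * recip j ^ k

-- plain s is an unbarred argument s of a zeta-star value (ε = 1); bar s is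
-- s with a bar (ε = -1).
data Argument : Set where
  plain bar : ℕ → Argument

exponent : Argument → ℕ
exponent (plain s) = s
exponent (bar   s) = s

sign : Argument → ℚ
sign (plain _) = 1ℚ
sign (bar   _) = - 1ℚ

factor : Argument → Terms
factor s n = sign s ^ n * recip n ^ exponent s

fromℕ-suc : ∀ n → fromℕ (suc n) ≡ fromℕ n + 1ℚ
fromℕ-suc n = ℚ.toℚᵘ-injective (ℚᵘ.≃-trans (ℚ.toℚᵘ-fromℚᵘ (ℚᵘ.mkℚᵘ (+ suc n) 0))
  (ℚᵘ.≃-trans (ℚᵘ.*≡* (trans (ℤ.*-identityʳ (+ suc n)) (sym (trans (ℤ.*-identityʳ _)
     (trans (cong (ℤ._+ + 1) (ℤ.*-identityʳ (+ n))) (cong +_ (ℕ.+-comm n 1)))))))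
  (ℚᵘ.≃-sym (ℚᵘ.≃-trans (ℚ.toℚᵘ-homo-+ (fromℕ n) 1ℚ)
    (ℚᵘ.+-congˡ (toℚᵘ 1ℚ) (ℚ.toℚᵘ-fromℚᵘ (ℚᵘ.mkℚᵘ (+ n) 0)))))))

fromℕ*recip : ∀ n .{{_ : NonZero n}} → fromℕ n * recip n ≡ 1ℚ
fromℕ*recip (suc n) = ℚ.toℚᵘ-injective (ℚᵘ.≃-trans (ℚ.toℚᵘ-homo-* (fromℕ (suc n)) (recip (suc n)))
  (ℚᵘ.≃-trans (ℚᵘ.*-cong (ℚ.toℚᵘ-fromℚᵘ (ℚᵘ.mkℚᵘ (+ suc n) 0)) (ℚ.toℚᵘ-fromℚᵘ (ℚᵘ.mkℚᵘ (+ 1) n)))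
  (ℚᵘ.*≡* (cong +_ (trans (ℕ.*-identityʳ _) (trans (ℕ.*-identityʳ _) (sym (trans (ℕ.*-identityˡ _) (ℕ.*-identityˡ _)))))))))

recip-nonNeg : ∀ n .{{_ : NonZero n}} → 0ℚ ≤ recip n
recip-nonNeg n = ℚ.<⇒≤ (ℚ.positive⁻¹ (recip n) {{ℚ.normalize-pos 1 n}})

fromℕ-nonNeg : ∀ n → 0ℚ ≤ fromℕ n
fromℕ-nonNeg n = ℚ.nonNegative⁻¹ (fromℕ n) {{ℚ.normalize-nonNeg n 1}}

abstract
  inverse-step : ∀ N r u → N * r ≡ 1ℚ → (N + 1ℚ) * u ≡ 1ℚ → r ≡ u + r * u
  inverse-step N r u Nr≡1 [N+1]u≡1 = begin
    r                    ≡⟨ ℚ.*-identityʳ r ⟨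
    r * 1ℚ               ≡⟨ cong (r *_) [N+1]u≡1 ⟨
    r * ((N + 1ℚ) * u)
      ≡⟨ solve 3 (λ r N u → r :* ((N :+ con 1ℚ) :* u) := N :* r :* u :+ r :* u) refl r N u ⟩
    N * r * u + r * u    ≡⟨ cong (λ x → x * u + r * u) Nr≡1 ⟩
    1ℚ * u + r * u       ≡⟨ cong (_+ r * u) (ℚ.*-identityˡ u) ⟩
    u + r * u            ∎
    where
    open ≡-Reasoning
    open +-*-Solver

  step⇒antitone : ∀ r u → 0ℚ ≤ r → 0ℚ ≤ u → r ≡ u + r * u → u ≤ r
  step⇒antitone r u 0≤r 0≤u eq = subst (u ≤_) (sym eq)
    (subst (_≤ u + r * u) (ℚ.+-identityʳ u) (ℚ.+-monoʳ-≤ u (0≤* 0≤r 0≤u)))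

recip-step : ∀ n .{{_ : NonZero n}} → recip n ≡ recip (suc n) + recip n * recip (suc n)
recip-step n = inverse-step (fromℕ n) (recip n) (recip (suc n)) (fromℕ*recip n)
  (trans (cong (_* recip (suc n)) (sym (fromℕ-suc n))) (fromℕ*recip (suc n)))

recip-antitone : ∀ n .{{_ : NonZero n}} → recip (suc n) ≤ recip n
recip-antitone n = step⇒antitone (recip n) (recip (suc n))
  (recip-nonNeg n) (recip-nonNeg (suc n)) (recip-step n)

recip≤1 : ∀ n → recip (suc n) ≤ 1ℚ
recip≤1 zero    = ≤-refl
recip≤1 (suc n) = ≤-trans (recip-antitone (suc n)) (recip≤1 n)

archimedean : ∀ c ε → 0ℚ < ε → ∃[ N ] fromℕ c < ε * fromℕ (suc N)
archimedean c ε@(mkℚ +[1+ a ] d _) 0<ε = c ℕ.+ d ℕ.* suc c , <-≤-trans c<1+c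
  (subst (_≤ ε * fromℕ (suc d ℕ.* suc c)) eq
    (ℚ.*-monoʳ-≤-nonNeg (fromℕ (suc d ℕ.* suc c)) {{nonNegative (fromℕ-nonNeg (suc d ℕ.* suc c))}} recip≤ε))
  where
  c<1+c : fromℕ c < fromℕ (suc c)
  c<1+c = subst₂ _<_ (ℚ.+-identityʳ (fromℕ c)) (sym (fromℕ-suc c)) (ℚ.+-monoʳ-< (fromℕ c) 0<1)
  recip≤ε : recip (suc d) ≤ ε
  recip≤ε = ℚ.toℚᵘ-cancel-≤ (ℚᵘ.≤-respˡ-≃ (ℚᵘ.≃-sym (ℚ.toℚᵘ-fromℚᵘ (ℚᵘ.mkℚᵘ (+ 1) d)))
    (ℚᵘ.*≤* (ℤ.*-monoʳ-≤-nonNeg (+ suc d) {+ 1} {+ suc a} (ℤ.+≤+ (s≤s z≤n)))))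
  fromℕ-* : ∀ m n → fromℕ (m ℕ.* n) ≡ fromℕ m * fromℕ n
  fromℕ-* m n = ℚ.toℚᵘ-injective (ℚᵘ.≃-trans (ℚ.toℚᵘ-fromℚᵘ (ℚᵘ.mkℚᵘ (+ (m ℕ.* n)) 0))
    (ℚᵘ.≃-trans (ℚᵘ.*≡* (cong (ℤ._* + 1) (ℤ.pos-* m n)))
    (ℚᵘ.≃-sym (ℚᵘ.≃-trans (ℚ.toℚᵘ-homo-* (fromℕ m) (fromℕ n))
      (ℚᵘ.*-cong (ℚ.toℚᵘ-fromℚᵘ (ℚᵘ.mkℚᵘ (+ m) 0)) (ℚ.toℚᵘ-fromℚᵘ (ℚᵘ.mkℚᵘ (+ n) 0)))))))
  eq : recip (suc d) * fromℕ (suc d ℕ.* suc c) ≡ fromℕ (suc c)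
  eq = begin
    recip (suc d) * fromℕ (suc d ℕ.* suc c)        ≡⟨ cong (recip (suc d) *_) (fromℕ-* (suc d) (suc c)) ⟩
    recip (suc d) * (fromℕ (suc d) * fromℕ (suc c)) ≡⟨ ℚ.*-assoc (recip (suc d)) (fromℕ (suc d)) (fromℕ (suc c)) ⟨
    recip (suc d) * fromℕ (suc d) * fromℕ (suc c)
      ≡⟨ cong (_* fromℕ (suc c)) (trans (ℚ.*-comm (recip (suc d)) (fromℕ (suc d))) (fromℕ*recip (suc d))) ⟩
    1ℚ * fromℕ (suc c)                             ≡⟨ ℚ.*-identityˡ _ ⟩
    fromℕ (suc c)                                  ∎
    where open ≡-Reasoning
archimedean c (mkℚ +0       _ _) (*<* (ℤ.+<+ ()))
archimedean c (mkℚ -[1+ _ ] _ _) (*<* ())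

recip-antitone* : ∀ m k → recip (suc (m ℕ.+ k)) ≤ recip (suc m)
recip-antitone* m zero    = ≤-reflexive (cong (λ i → recip (suc i)) (ℕ.+-identityʳ m))
recip-antitone* m (suc k) = ≤-trans
  (≤-reflexive (cong (λ i → recip (suc i)) (ℕ.+-suc m k)))
  (≤-trans (recip-antitone (suc (m ℕ.+ k))) (recip-antitone* m k))

recip-small : ∀ c ε → 0ℚ < ε → ∃[ N ] (∀ n → N ℕ.≤ n → fromℕ c * recip (suc n) < ε)
recip-small c ε 0<ε with archimedean c ε 0<ε
... | N , h = N , λ n N≤n → ≤-<-trans
  (ℚ.*-monoˡ-≤-nonNeg (fromℕ c) {{nonNegative (fromℕ-nonNeg c)}}
    (subst (λ i → recip (suc i) ≤ u) (ℕ.m+[n∸m]≡n N≤n) (recip-antitone* N (n ℕ.∸ N))))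
  (subst (fromℕ c * u <_) eq (ℚ.*-monoˡ-<-pos u {{ℚ.normalize-pos 1 (suc N)}} h))
  where
  u = recip (suc N)
  eq : ε * fromℕ (suc N) * u ≡ ε
  eq = trans (ℚ.*-assoc ε (fromℕ (suc N)) u) (trans (cong (ε *_) (fromℕ*recip (suc N))) (ℚ.*-identityʳ ε))

H-nonNeg : ∀ n → 0ℚ ≤ H n
H-nonNeg zero    = ≤-refl
H-nonNeg (suc n) = 0≤+ (H-nonNeg n) (recip-nonNeg (suc n))

-- H n ^ k grows at most linearly in n for 1 ≤ k ≤ 4.
module Growth where
  open +-*-Solver

  H≤ : ∀ n → H n ≤ fromℕ n
  H≤ zero    = ≤-refl
  H≤ (suc n) = subst (H (suc n) ≤_) (sym (fromℕ-suc n)) (+-mono-≤ (H≤ n) (recip≤1 n))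

  n*u≤1 : ∀ n → fromℕ n * recip (suc n) ≤ 1ℚ
  n*u≤1 n = diff⇒≤ (subst (0ℚ ≤_) eq (recip-nonNeg (suc n)))
    where
    u = recip (suc n)
    eq : u ≡ 1ℚ - fromℕ n * u
    eq = trans (solve 2 (λ N u → u := (N :+ con 1ℚ) :* u :- N :* u) refl (fromℕ n) u)
      (cong (_- fromℕ n * u) (trans (cong (_* u) (sym (fromℕ-suc n))) (fromℕ*recip (suc n))))

  times-u : ∀ n {X} c → 0ℚ ≤ c → X ≤ c * fromℕ n → X * recip (suc n) ≤ c
  times-u n {X} c 0≤c X≤ = ≤-trans
    (ℚ.*-monoʳ-≤-nonNeg u {{nonNegative (recip-nonNeg (suc n))}} X≤)
    (subst₂ _≤_ (sym (ℚ.*-assoc c (fromℕ n) u)) (ℚ.*-identityʳ c)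
      (ℚ.*-monoˡ-≤-nonNeg c {{nonNegative 0≤c}} (n*u≤1 n)))
    where u = recip (suc n)

  again-u : ∀ n {X} c → 0ℚ ≤ c → X ≤ c → X * recip (suc n) ≤ c
  again-u n {X} c 0≤c X≤ = ≤-trans
    (ℚ.*-monoʳ-≤-nonNeg (recip (suc n)) {{nonNegative (recip-nonNeg (suc n))}} X≤)
    (subst (c * recip (suc n) ≤_) (ℚ.*-identityʳ c)
      (ℚ.*-monoˡ-≤-nonNeg c {{nonNegative 0≤c}} (recip≤1 n)))

  lit : ∀ n → 0ℚ ≤ fromℕ n
  lit = fromℕ-nonNeg

  hu≤1 : ∀ n → H n * recip (suc n) ≤ 1ℚ
  hu≤1 n = times-u n 1ℚ 0≤1 (subst (H n ≤_) (sym (ℚ.*-identityˡ (fromℕ n))) (H≤ n))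

  uu≤1 : ∀ n → recip (suc n) * recip (suc n) ≤ 1ℚ
  uu≤1 n = again-u n 1ℚ 0≤1 (recip≤1 n)

  H²≤ : ∀ n → H n * H n ≤ fromℕ 3 * fromℕ n
  H²≤ zero    = ≤-refl
  H²≤ (suc n) = diff⇒≤ (subst (0ℚ ≤_) eq
    (0≤+ (0≤+ (≤⇒diff (H²≤ n)) (0≤* (lit 2) (≤⇒diff (hu≤1 n)))) (≤⇒diff (uu≤1 n))))
    where
    h = H n
    u = recip (suc n)
    eq : (fromℕ 3 * fromℕ n - h * h) + fromℕ 2 * (1ℚ - h * u) + (1ℚ - u * u)
       ≡ fromℕ 3 * fromℕ (suc n) - (h + u) * (h + u)
    eq = trans
      (solve 3 (λ N h u → (con (fromℕ 3) :* N :- h :* h) :+ con (fromℕ 2) :* (con 1ℚ :- h :* u) :+ (con 1ℚ :- u :* u)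
        := con (fromℕ 3) :* (N :+ con 1ℚ) :- (h :+ u) :* (h :+ u)) refl (fromℕ n) h u)
      (cong (λ N → fromℕ 3 * N - (h + u) * (h + u)) (sym (fromℕ-suc n)))

  H³≤ : ∀ n → H n * H n * H n ≤ fromℕ 13 * fromℕ n
  H³≤ zero    = ≤-refl
  H³≤ (suc n) = diff⇒≤ (subst (0ℚ ≤_) eq
    (0≤+ (0≤+ (0≤+ (≤⇒diff (H³≤ n))
      (0≤* (lit 3) (≤⇒diff (times-u n (fromℕ 3) (lit 3) (H²≤ n)))))
      (0≤* (lit 3) (≤⇒diff (again-u n 1ℚ 0≤1 (hu≤1 n)))))
      (≤⇒diff (again-u n 1ℚ 0≤1 (uu≤1 n)))))
    where
    h = H n
    u = recip (suc n)
    eq : (fromℕ 13 * fromℕ n - h * h * h) + fromℕ 3 * (fromℕ 3 - h * h * u)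
         + fromℕ 3 * (1ℚ - h * u * u) + (1ℚ - u * u * u)
       ≡ fromℕ 13 * fromℕ (suc n) - (h + u) * (h + u) * (h + u)
    eq = trans
      (solve 3 (λ N h u → (con (fromℕ 13) :* N :- h :* h :* h) :+ con (fromℕ 3) :* (con (fromℕ 3) :- h :* h :* u)
        :+ con (fromℕ 3) :* (con 1ℚ :- h :* u :* u) :+ (con 1ℚ :- u :* u :* u)
        := con (fromℕ 13) :* (N :+ con 1ℚ) :- (h :+ u) :* (h :+ u) :* (h :+ u)) refl (fromℕ n) h u)
      (cong (λ N → fromℕ 13 * N - (h + u) * (h + u) * (h + u)) (sym (fromℕ-suc n)))

  H⁴≤ : ∀ n → H n * H n * H n * H n ≤ fromℕ 75 * fromℕ n
  H⁴≤ zero    = ≤-refl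
  H⁴≤ (suc n) = diff⇒≤ (subst (0ℚ ≤_) eq
    (0≤+ (0≤+ (0≤+ (0≤+ (≤⇒diff (H⁴≤ n))
      (0≤* (lit 4) (≤⇒diff (times-u n (fromℕ 13) (lit 13) (H³≤ n)))))
      (0≤* (lit 6) (≤⇒diff (again-u n (fromℕ 3) (lit 3) (times-u n (fromℕ 3) (lit 3) (H²≤ n))))))
      (0≤* (lit 4) (≤⇒diff (again-u n 1ℚ 0≤1 (again-u n 1ℚ 0≤1 (hu≤1 n))))))
      (≤⇒diff (again-u n 1ℚ 0≤1 (again-u n 1ℚ 0≤1 (uu≤1 n))))))
    where
    h = H n
    u = recip (suc n)
    eq : (fromℕ 75 * fromℕ n - h * h * h * h) + fromℕ 4 * (fromℕ 13 - h * h * h * u)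
         + fromℕ 6 * (fromℕ 3 - h * h * u * u) + fromℕ 4 * (1ℚ - h * u * u * u) + (1ℚ - u * u * u * u)
       ≡ fromℕ 75 * fromℕ (suc n) - (h + u) * (h + u) * (h + u) * (h + u)
    eq = trans
      (solve 3 (λ N h u → (con (fromℕ 75) :* N :- h :* h :* h :* h)
        :+ con (fromℕ 4) :* (con (fromℕ 13) :- h :* h :* h :* u)
        :+ con (fromℕ 6) :* (con (fromℕ 3) :- h :* h :* u :* u)
        :+ con (fromℕ 4) :* (con 1ℚ :- h :* u :* u :* u) :+ (con 1ℚ :- u :* u :* u :* u)
        := con (fromℕ 75) :* (N :+ con 1ℚ) :- (h :+ u) :* (h :+ u) :* (h :+ u) :* (h :+ u)) refl (fromℕ n) h u)
      (cong (λ N → fromℕ 75 * N - (h + u) * (h + u) * (h + u) * (h + u)) (sym (fromℕ-suc n)))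

-- The comparison series ∑ H_n²/n². Its tail after n is at most
-- (H_n² + 4 H_n + 6)/n.
majorant : Terms
majorant n = H n * H n * (recip n * recip n)

module Majorant where
  open +-*-Solver

  P : ℚ → ℚ
  P h = h * h + fromℕ 4 * h + fromℕ 6

  tailBound : ℕ → ℚ
  tailBound n = P (H (suc n)) * recip (suc n)

  majorant-nonNeg : ∀ n .{{_ : NonZero n}} → 0ℚ ≤ majorant n
  majorant-nonNeg n = 0≤* (0≤* (H-nonNeg n) (H-nonNeg n)) (0≤* (recip-nonNeg n) (recip-nonNeg n))

  P-nonNeg : ∀ n → 0ℚ ≤ P (H n)
  P-nonNeg n = 0≤+ (0≤+ (0≤* (H-nonNeg n) (H-nonNeg n)) (0≤* (fromℕ-nonNeg 4) (H-nonNeg n))) (fromℕ-nonNeg 6)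

  tailBound-nonNeg : ∀ n → 0ℚ ≤ tailBound n
  tailBound-nonNeg n = 0≤* (P-nonNeg (suc n)) (recip-nonNeg (suc n))

  step : ∀ n → majorant (2+ n) + tailBound (suc n) ≤ tailBound n
  step n = diff⇒≤ (subst (0ℚ ≤_) eq (0≤+
      (0≤* (P-nonNeg (suc n)) (0≤* (0≤* r≥0 u≥0) u≥0))
      (0≤* (0≤* u≥0 u≥0) (0≤+ (0≤+ (0≤* (fromℕ-nonNeg 2) (0≤* (H-nonNeg (suc n)) 1-u≥0)) 1-u≥0)
        (0≤* 1-u≥0 (0≤+ 0≤1 u≥0))))))
    where
    h = H (suc n)
    r = recip (suc n)
    u = recip (2+ n)
    r≥0 = recip-nonNeg (suc n)
    u≥0 = recip-nonNeg (2+ n)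
    1-u≥0 = ≤⇒diff (recip≤1 (suc n))
    d = r * u
    d-eq : d ≡ u * u + d * u
    d-eq = trans (cong (_* u) (recip-step (suc n)))
      (solve 2 (λ u d → (u :+ d) :* u := u :* u :+ d :* u) refl u d)
    eq : P h * (d * u) + u * u * (fromℕ 2 * (h * (1ℚ - u)) + (1ℚ - u) + (1ℚ - u) * (1ℚ + u))
       ≡ P h * r - ((h + u) * (h + u) * (u * u) + P (h + u) * u)
    eq = trans
      (solve 3 (λ h u d →
        (h :* h :+ con (fromℕ 4) :* h :+ con (fromℕ 6)) :* (d :* u)
          :+ u :* u :* (con (fromℕ 2) :* (h :* (con 1ℚ :- u)) :+ (con 1ℚ :- u) :+ (con 1ℚ :- u) :* (con 1ℚ :+ u))
        := (h :* h :+ con (fromℕ 4) :* h :+ con (fromℕ 6)) :* (u :+ (u :* u :+ d :* u))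
          :- ((h :+ u) :* (h :+ u) :* (u :* u)
            :+ ((h :+ u) :* (h :+ u) :+ con (fromℕ 4) :* (h :+ u) :+ con (fromℕ 6)) :* u))
        refl h u d)
      (cong (λ x → P h * x - ((h + u) * (h + u) * (u * u) + P (h + u) * u))
        (trans (cong (λ x → u + x) (sym d-eq)) (sym (recip-step (suc n)))))

  decreasing : ∀ n k → partialSum majorant (suc (n ℕ.+ k)) + tailBound (n ℕ.+ k)
                     ≤ partialSum majorant (suc n) + tailBound n
  decreasing n zero    = ≤-reflexive (cong (λ i → partialSum majorant (suc i) + tailBound i) (ℕ.+-identityʳ n))
  decreasing n (suc k) = ≤-trans
    (≤-reflexive (trans (cong (λ i → partialSum majorant (suc i) + tailBound i) (ℕ.+-suc n k))
      (ℚ.+-assoc (partialSum majorant (suc (n ℕ.+ k))) (majorant (2+ (n ℕ.+ k))) (tailBound (suc (n ℕ.+ k))))))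
    (≤-trans (ℚ.+-monoʳ-≤ (partialSum majorant (suc (n ℕ.+ k))) (step (n ℕ.+ k))) (decreasing n k))

  1≤H : ∀ n → 1ℚ ≤ H (suc n)
  1≤H zero    = ≤-refl
  1≤H (suc n) = ≤-trans (1≤H n)
    (subst (_≤ H (2+ n)) (ℚ.+-identityʳ (H (suc n))) (ℚ.+-monoʳ-≤ (H (suc n)) (recip-nonNeg (2+ n))))

  -- Since h ≥ 1, P h ≤ 11 h², and (11 h²/n)² ≤ 121 · 75/n.
  tailBound²≤ : ∀ n → tailBound n * tailBound n ≤ fromℕ 9075 * recip (suc n)
  tailBound²≤ n = ≤-trans (*-mono-≤ (tailBound-nonNeg n) c≥0 tb≤ tb≤)
    (≤-trans (≤-reflexive (solve 2 (λ h u → (con (fromℕ 11) :* (h :* h) :* u) :* (con (fromℕ 11) :* (h :* h) :* u)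
        := con (fromℕ 121) :* (h :* h :* h :* h :* (u :* u))) refl h u))
    (≤-trans (ℚ.*-monoˡ-≤-nonNeg (fromℕ 121) (ℚ.*-monoʳ-≤-nonNeg (u * u) {{nonNegative (0≤* u≥0 u≥0)}} (Growth.H⁴≤ (suc n))))
    (≤-reflexive (trans
      (solve 2 (λ N u → con (fromℕ 121) :* (con (fromℕ 75) :* N :* (u :* u)) := con (fromℕ 9075) :* ((N :* u) :* u))
        refl (fromℕ (suc n)) u)
      (cong (fromℕ 9075 *_) (trans (cong (_* u) (fromℕ*recip (suc n))) (ℚ.*-identityˡ u)))))))
    where
    h = H (suc n)
    u = recip (suc n)
    u≥0 = recip-nonNeg (suc n)
    h≥0 = H-nonNeg (suc n)
    h-1≥0 = ≤⇒diff (1≤H n)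
    P≤ : P h ≤ fromℕ 11 * (h * h)
    P≤ = diff⇒≤ (subst (0ℚ ≤_)
      (solve 1 (λ h → con (fromℕ 4) :* (h :* (h :- con 1ℚ)) :+ con (fromℕ 6) :* ((h :- con 1ℚ) :* (h :+ con 1ℚ))
        := con (fromℕ 11) :* (h :* h) :- (h :* h :+ con (fromℕ 4) :* h :+ con (fromℕ 6))) refl h)
      (0≤+ (0≤* (fromℕ-nonNeg 4) (0≤* h≥0 h-1≥0))
        (0≤* (fromℕ-nonNeg 6) (0≤* h-1≥0 (0≤+ h≥0 0≤1)))))
    tb≤ : tailBound n ≤ fromℕ 11 * (h * h) * u
    tb≤ = ℚ.*-monoʳ-≤-nonNeg u {{nonNegative u≥0}} P≤
    c≥0 : 0ℚ ≤ fromℕ 11 * (h * h) * u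
    c≥0 = 0≤* (0≤* (fromℕ-nonNeg 11) (0≤* h≥0 h≥0)) u≥0

  tailBound-small : ∀ ε → 0ℚ < ε → ∃[ N ] (∀ n → N ℕ.≤ n → tailBound n < ε)
  tailBound-small ε 0<ε = proj₁ small , λ n N≤n → ℚ.≰⇒> λ ε≤t → ℚ.<-irrefl refl
    (≤-<-trans (≤-trans (*-mono-≤ (ℚ.<⇒≤ 0<ε) (tailBound-nonNeg n) ε≤t ε≤t) (tailBound²≤ n))
      (proj₂ small n N≤n))
    where
    small = recip-small 9075 (ε * ε) (0<* 0<ε 0<ε)

  tail≤ : ∀ n k → partialSum majorant (suc (n ℕ.+ k)) - partialSum majorant (suc n) ≤ tailBound n
  tail≤ n k = diff⇒≤ (subst (0ℚ ≤_)
    (solve 4 (λ a b c d → (a :+ b :- (c :+ d)) :+ d := b :- (c :- a)) refl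
      (partialSum majorant (suc n)) (tailBound n) (partialSum majorant (suc (n ℕ.+ k))) (tailBound (n ℕ.+ k)))
    (0≤+ (≤⇒diff (decreasing n k)) (tailBound-nonNeg (n ℕ.+ k))))

dominated⇒convergent : ∀ (a : Terms) → (∀ n .{{_ : NonZero n}} → ∣ a n ∣ ≤ majorant n) → Convergent a
dominated⇒convergent a a≤ = tails⇒isCauchy (partialSum a) λ ε 0<ε → go ε (Majorant.tailBound-small ε 0<ε)
  where
  open +-*-Solver
  diff≤ : ∀ n k → ∣ partialSum a (n ℕ.+ k) - partialSum a n ∣
                ≤ partialSum majorant (n ℕ.+ k) - partialSum majorant n
  diff≤ n zero rewrite ℕ.+-identityʳ n
    | ℚ.+-inverseʳ (partialSum a n) | ℚ.+-inverseʳ (partialSum majorant n) = ≤-refl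
  diff≤ n (suc k) rewrite ℕ.+-suc n k = ≤-trans
    (subst (λ d → ∣ d ∣ ≤ ∣ S a - partialSum a n ∣ + ∣ a m ∣)
      (solve 3 (λ s t x → (s :- t) :+ x := s :+ x :- t) refl (S a) (partialSum a n) (a m))
      (ℚ.∣p+q∣≤∣p∣+∣q∣ (S a - partialSum a n) (a m)))
    (subst (∣ S a - partialSum a n ∣ + ∣ a m ∣ ≤_)
      (solve 3 (λ s t x → (s :- t) :+ x := s :+ x :- t) refl (S majorant) (partialSum majorant n) (majorant m))
      (+-mono-≤ (diff≤ n k) (a≤ m)))
    where
    m = suc (n ℕ.+ k)
    S : Terms → ℚ
    S b = partialSum b (n ℕ.+ k)
  go : ∀ ε → _ → _
  go ε (N , h) = suc N , λ where
    (suc n) k (s≤s N≤n) → ≤-<-trans (≤-trans (diff≤ (suc n) k) (Majorant.tail≤ n k)) (h n N≤n)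

∣[-1]^n∣ : ∀ n → ∣ (- 1ℚ) ^ n ∣ ≡ 1ℚ
∣[-1]^n∣ zero    = refl
∣[-1]^n∣ (suc n) = trans (ℚ.∣p*q∣≡∣p∣*∣q∣ (- 1ℚ) ((- 1ℚ) ^ n)) (trans (ℚ.*-identityˡ _) (∣[-1]^n∣ n))

∣1^n∣ : ∀ n → ∣ 1ℚ ^ n ∣ ≡ 1ℚ
∣1^n∣ zero    = refl
∣1^n∣ (suc n) = trans (ℚ.∣p*q∣≡∣p∣*∣q∣ 1ℚ (1ℚ ^ n)) (trans (ℚ.*-identityˡ _) (∣1^n∣ n))

∣sign^n∣ : ∀ s n → ∣ sign s ^ n ∣ ≡ 1ℚ
∣sign^n∣ (plain _) = ∣1^n∣
∣sign^n∣ (bar   _) = ∣[-1]^n∣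

recip^-nonNeg : ∀ n .{{_ : NonZero n}} k → 0ℚ ≤ recip n ^ k
recip^-nonNeg n zero    = 0≤1
recip^-nonNeg n (suc k) = 0≤* (recip-nonNeg n) (recip^-nonNeg n k)

recip^≤1 : ∀ n k → recip (suc n) ^ k ≤ 1ℚ
recip^≤1 n zero    = ≤-refl
recip^≤1 n (suc k) = *-mono-≤ (recip-nonNeg (suc n)) 0≤1 (recip≤1 n) (recip^≤1 n k)

recip^≤recip : ∀ n k → .{{_ : NonZero k}} → recip (suc n) ^ k ≤ recip (suc n)
recip^≤recip n (suc k) = subst (recip (suc n) ^ suc k ≤_) (ℚ.*-identityʳ (recip (suc n)))
  (ℚ.*-monoˡ-≤-nonNeg (recip (suc n)) {{nonNegative (recip-nonNeg (suc n))}} (recip^≤1 n k))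

recip^≤recip² : ∀ n k → .{{_ : NonTrivial k}} → recip (suc n) ^ k ≤ recip (suc n) * recip (suc n)
recip^≤recip² n (2+ k) =
  ℚ.*-monoˡ-≤-nonNeg (recip (suc n)) {{nonNegative (recip-nonNeg (suc n))}} (recip^≤recip n (suc k))

∣signed-recip∣ : ∀ x n .{{_ : NonZero n}} k → ∣ x ∣ ≡ 1ℚ → ∣ x * recip n ^ k ∣ ≡ recip n ^ k
∣signed-recip∣ x n k ∣x∣≡1 = trans (ℚ.∣p*q∣≡∣p∣*∣q∣ x (recip n ^ k)) (trans
  (cong₂ _*_ ∣x∣≡1 (ℚ.0≤p⇒∣p∣≡p (recip^-nonNeg n k))) (ℚ.*-identityˡ _))

partialSum≤H : ∀ (a : Terms) → (∀ n → ∣ a (suc n) ∣ ≤ recip (suc n)) → ∀ n → ∣ partialSum a n ∣ ≤ H n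
partialSum≤H a h zero    = ≤-refl
partialSum≤H a h (suc n) = ≤-trans (ℚ.∣p+q∣≤∣p∣+∣q∣ (partialSum a n) (a (suc n)))
  (+-mono-≤ (partialSum≤H a h n) (h n))

∣L∣≤H : ∀ k .{{_ : NonZero k}} n → ∣ L k n ∣ ≤ H n
∣L∣≤H k = partialSum≤H _ λ n →
  subst (_≤ recip (suc n)) (sym (∣signed-recip∣ _ (suc n) k (∣[-1]^n∣ n))) (recip^≤recip n k)

∣factor-sum∣≤H : ∀ s .{{_ : NonZero (exponent s)}} n → ∣ partialSum (factor s) n ∣ ≤ H n
∣factor-sum∣≤H s = partialSum≤H _ λ n →
  subst (_≤ recip (suc n)) (sym (∣signed-recip∣ _ (suc n) (exponent s) (∣sign^n∣ s (suc n)))) (recip^≤recip n (exponent s))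

product-dominated : ∀ x y n k .{{_ : NonTrivial k}} → ∣ x ∣ ≡ 1ℚ → ∣ y ∣ ≤ H (suc n) * H (suc n) →
  ∣ x * recip (suc n) ^ k * y ∣ ≤ majorant (suc n)
product-dominated x y n k ∣x∣≡1 y≤ = subst (_≤ majorant (suc n))
  (sym (trans (ℚ.∣p*q∣≡∣p∣*∣q∣ (x * recip (suc n) ^ k) y)
    (trans (cong (_* ∣ y ∣) (∣signed-recip∣ x (suc n) k ∣x∣≡1)) (ℚ.*-comm (recip (suc n) ^ k) ∣ y ∣))))
  (*-mono-≤ (ℚ.0≤∣p∣ y) (0≤* (recip-nonNeg (suc n)) (recip-nonNeg (suc n))) y≤ (recip^≤recip² n k))

1≤H² : ∀ n → 1ℚ ≤ H (suc n) * H (suc n)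
1≤H² n = *-mono-≤ 0≤1 (H-nonNeg (suc n)) (Majorant.1≤H n) (Majorant.1≤H n)

H≤H² : ∀ n → H (suc n) ≤ H (suc n) * H (suc n)
H≤H² n = subst (_≤ H (suc n) * H (suc n)) (ℚ.*-identityˡ (H (suc n)))
  (*-mono-≤ 0≤1 (H-nonNeg (suc n)) (Majorant.1≤H n) ≤-refl)

square≤ : ∀ y n → ∣ y ∣ ≤ H n → ∣ y ^ 2 ∣ ≤ H n * H n
square≤ y n y≤ = subst (_≤ H n * H n)
  (sym (trans (cong ∣_∣ (cong (y *_) (ℚ.*-identityʳ y))) (ℚ.∣p*q∣≡∣p∣*∣q∣ y y)))
  (*-mono-≤ (ℚ.0≤∣p∣ y) (H-nonNeg n) y≤ y≤)

-- Leibniz' test, applied to ∑ (-1)ⁿ⁻¹/nˢ, which covers the conditionally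
-- convergent case s = 1.
module Alternating (c : ℕ → ℚ) (c-nonNeg : ∀ n → 0ℚ ≤ c n) (c-antitone : ∀ n → c (suc n) ≤ c n) where
  open +-*-Solver

  altTail : ℕ → ℕ → ℚ
  altTail n zero    = 0ℚ
  altTail n (suc k) = c n - altTail (suc n) k

  altTail-bounds : ∀ n k → 0ℚ ≤ altTail n k × altTail n k ≤ c n
  altTail-bounds n zero    = ≤-refl , c-nonNeg n
  altTail-bounds n (suc k) = ≤⇒diff (≤-trans (proj₂ rest) (c-antitone n)) ,
    diff⇒≤ (subst (0ℚ ≤_) (solve 2 (λ a t → t := a :- (a :- t)) refl (c n) t) (proj₁ rest))
    where
    t    = altTail (suc n) k
    rest = altTail-bounds (suc n) k

  abstract
    rearrange : ∀ s e a t → s + e * a + (- 1ℚ * e) * t ≡ s + e * (a - t)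
    rearrange = solve 4 (λ s e a t → s :+ e :* a :+ (con (- 1ℚ) :* e) :* t := s :+ e :* (a :- t)) refl

    cancel : ∀ s x → s + x - s ≡ x
    cancel = solve 2 (λ s x → s :+ x :- s := x) refl

  module _ (a : Terms) (a≡ : ∀ n → a (suc n) ≡ (- 1ℚ) ^ n * c n) where

    sum-split : ∀ n k → partialSum a (n ℕ.+ k) ≡ partialSum a n + (- 1ℚ) ^ n * altTail n k
    sum-split n zero    = trans (cong (partialSum a) (ℕ.+-identityʳ n))
      (sym (trans (cong (λ x → partialSum a n + x) (ℚ.*-zeroʳ ((- 1ℚ) ^ n))) (ℚ.+-identityʳ (partialSum a n))))
    sum-split n (suc k) = trans (cong (partialSum a) (ℕ.+-suc n k)) (trans (sum-split (suc n) k)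
      (trans (cong (λ x → partialSum a n + x + (- 1ℚ) ^ suc n * altTail (suc n) k) (a≡ n))
        (rearrange (partialSum a n) ((- 1ℚ) ^ n) (c n) (altTail (suc n) k))))

    tail≤ : ∀ n k → ∣ partialSum a (n ℕ.+ k) - partialSum a n ∣ ≤ c n
    tail≤ n k = subst (_≤ c n) (sym (begin
      ∣ partialSum a (n ℕ.+ k) - partialSum a n ∣
        ≡⟨ cong (λ x → ∣ x - partialSum a n ∣) (sum-split n k) ⟩
      ∣ partialSum a n + (- 1ℚ) ^ n * t - partialSum a n ∣
        ≡⟨ cong ∣_∣ (cancel (partialSum a n) ((- 1ℚ) ^ n * t)) ⟩
      ∣ (- 1ℚ) ^ n * t ∣          ≡⟨ ℚ.∣p*q∣≡∣p∣*∣q∣ ((- 1ℚ) ^ n) t ⟩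
      ∣ (- 1ℚ) ^ n ∣ * ∣ t ∣      ≡⟨ cong₂ _*_ (∣[-1]^n∣ n) (ℚ.0≤p⇒∣p∣≡p (proj₁ bounds)) ⟩
      1ℚ * t                      ≡⟨ ℚ.*-identityˡ t ⟩
      t                           ∎)) (proj₂ bounds)
      where
      open ≡-Reasoning
      t      = altTail n k
      bounds = altTail-bounds n k

    convergent : (∀ ε → 0ℚ < ε → ∃[ N ] (∀ n → N ℕ.≤ n → c n < ε)) → Convergent a
    convergent small = tails⇒isCauchy (partialSum a) λ ε 0<ε →
      proj₁ (small ε 0<ε) , λ n k N≤n → ≤-<-trans (tail≤ n k) (proj₂ (small ε 0<ε) n N≤n)

recip^-antitone : ∀ n k → recip (2+ n) ^ k ≤ recip (suc n) ^ k
recip^-antitone n zero    = ≤-refl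
recip^-antitone n (suc k) = *-mono-≤ (recip-nonNeg (2+ n)) (recip^-nonNeg (suc n) k)
  (recip-antitone (suc n)) (recip^-antitone n k)

ζ-convergent : ∀ s .{{_ : NonTrivial s}} → Convergent λ n → recip n ^ s
ζ-convergent s = dominated⇒convergent _ λ where
  (suc n) → subst (_≤ majorant (suc n))
    (sym (ℚ.0≤p⇒∣p∣≡p (recip^-nonNeg (suc n) s)))
    (subst (_≤ majorant (suc n)) (ℚ.*-identityˡ (recip (suc n) ^ s))
      (*-mono-≤ 0≤1 (0≤* (recip-nonNeg (suc n)) (recip-nonNeg (suc n))) (1≤H² n) (recip^≤recip² n s)))

ζ̄-convergent : ∀ s .{{_ : NonZero s}} → Convergent λ n → (- 1ℚ) ^ (n ℕ.∸ 1) * recip n ^ s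
ζ̄-convergent s = Alternating.convergent (λ n → recip (suc n) ^ s)
  (λ n → recip^-nonNeg (suc n) s) (λ n → recip^-antitone n s) _ (λ n → refl)
  λ ε 0<ε → proj₁ (small ε 0<ε) , λ n N≤n → ≤-<-trans (recip^≤recip n s)
    (subst (_< ε) (ℚ.*-identityˡ (recip (suc n))) (proj₂ (small ε 0<ε) n N≤n))
  where
  small = recip-small 1

ζ⋆-convergent : ∀ s₁ s₂ .{{_ : NonTrivial (exponent s₁)}} .{{_ : NonZero (exponent s₂)}} →
  Convergent λ n → factor s₁ n * partialSum (factor s₂) n
ζ⋆-convergent s₁ s₂ = dominated⇒convergent _ λ where
  (suc n) → product-dominated (sign s₁ ^ suc n) (partialSum (factor s₂) (suc n)) n (exponent s₁)
    (∣sign^n∣ s₁ (suc n)) (≤-trans (∣factor-sum∣≤H s₂ (suc n)) (H≤H² n))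

L²-convergent : ∀ k q .{{_ : NonZero k}} .{{_ : NonTrivial q}} →
  Convergent λ n → (- 1ℚ) ^ (n ℕ.∸ 1) * recip n ^ q * L k n ^ 2
L²-convergent k q = dominated⇒convergent _ λ where
  (suc n) → product-dominated ((- 1ℚ) ^ n) (L k (suc n) ^ 2) n q (∣[-1]^n∣ n)
    (square≤ (L k (suc n)) (suc n) (∣L∣≤H k (suc n)))

H²-convergent : ∀ q .{{_ : NonTrivial q}} →
  Convergent λ n → (- 1ℚ) ^ (n ℕ.∸ 1) * recip n ^ q * H n ^ 2
H²-convergent q = dominated⇒convergent _ λ where
  (suc n) → product-dominated ((- 1ℚ) ^ n) (H (suc n) ^ 2) n q (∣[-1]^n∣ n)
    (square≤ (H (suc n)) (suc n) (≤-reflexive (ℚ.0≤p⇒∣p∣≡p (H-nonNeg (suc n)))))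

ζ : (s : ℕ) .{{_ : NonTrivial s}} → ℝ
ζ s = ∑∞ (λ n → recip n ^ s) (ζ-convergent s)

ζ̄ : (s : ℕ) .{{_ : NonZero s}} → ℝ
ζ̄ s = ∑∞ (λ n → (- 1ℚ) ^ (n ℕ.∸ 1) * recip n ^ s) (ζ̄-convergent s)

-- Depth two. The first exponent is required to be at least 2, so that the
-- series converges absolutely whatever the bars.
ζ⋆ : (s₁ s₂ : Argument) .{{_ : NonTrivial (exponent s₁)}} .{{_ : NonZero (exponent s₂)}} → ℝ
ζ⋆ s₁ s₂ = ∑∞ (λ n → factor s₁ n * partialSum (factor s₂) n) (ζ⋆-convergent s₁ s₂)

n+k≢0 : ∀ n k .{{_ : NonZero k}} → NonZero (n ℕ.+ k)
n+k≢0 n (suc k) = subst NonZero (sym (ℕ.+-suc n k)) _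

-- The n-th right Riemann sum of ∫₁² dt/t over n equal subintervals, since
-- (1/n) · 1/(1 + k/n) = 1/(n + k).
riemannSum : ℕ → ℚ
riemannSum n = partialSum (λ k → recip (n ℕ.+ k) {{n+k≢0 n k}}) n

module RiemannSum where
  open +-*-Solver

  recip-cong : ∀ {m n} .(m≢0 : NonZero m) .(n≢0 : NonZero n) → m ≡ n → recip m {{m≢0}} ≡ recip n {{n≢0}}
  recip-cong _ _ refl = refl

  H-split : ∀ m n (m+k≢0 : ∀ k .{{_ : NonZero k}} → NonZero (m ℕ.+ k)) →
    H (m ℕ.+ n) ≡ H m + partialSum (λ k → recip (m ℕ.+ k) {{m+k≢0 k}}) n
  H-split m zero    ne = trans (cong H (ℕ.+-identityʳ m)) (sym (ℚ.+-identityʳ (H m)))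
  H-split m (suc n) ne = trans (cong H (ℕ.+-suc m n)) (trans
    (cong₂ _+_ (H-split m n ne) (recip-cong _ (ne (suc n)) (sym (ℕ.+-suc m n))))
    (ℚ.+-assoc (H m) _ _))

  fromℕ-+ : ∀ m n → fromℕ (m ℕ.+ n) ≡ fromℕ m + fromℕ n
  fromℕ-+ zero    n = sym (ℚ.+-identityˡ (fromℕ n))
  fromℕ-+ (suc m) n = trans (fromℕ-suc (m ℕ.+ n)) (trans (cong (_+ 1ℚ) (fromℕ-+ m n))
    (trans (swap (fromℕ m) (fromℕ n)) (cong (_+ fromℕ n) (sym (fromℕ-suc m)))))
    where
    swap : ∀ x y → x + y + 1ℚ ≡ x + 1ℚ + y
    swap = solve 2 (λ x y → x :+ y :+ con 1ℚ := x :+ con 1ℚ :+ y) refl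

  inverse-double : ∀ N r u → N * r ≡ 1ℚ → (N + N) * u ≡ 1ℚ → r ≡ u + u
  inverse-double N r u Nr≡1 2Nu≡1 = trans (sym (ℚ.*-identityʳ r)) (trans (cong (r *_) (sym 2Nu≡1))
    (trans (solve 3 (λ N r u → r :* ((N :+ N) :* u) := N :* r :* (u :+ u)) refl N r u)
      (trans (cong (_* (u + u)) Nr≡1) (ℚ.*-identityˡ (u + u)))))

  recip-double : ∀ n → recip (suc n) ≡ recip (2+ (n ℕ.+ n)) + recip (2+ (n ℕ.+ n))
  recip-double n = inverse-double (fromℕ (suc n)) (recip (suc n)) (recip (2+ (n ℕ.+ n))) (fromℕ*recip (suc n))
    (trans (cong (_* recip (2+ (n ℕ.+ n)))
      (trans (sym (fromℕ-+ (suc n) (suc n))) (cong fromℕ (cong suc (ℕ.+-suc n n)))))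
      (fromℕ*recip (2+ (n ℕ.+ n))))

  [-1]^even : ∀ n → (- 1ℚ) ^ (n ℕ.+ n) ≡ 1ℚ
  [-1]^even zero    = refl
  [-1]^even (suc n) = trans (cong (λ k → - 1ℚ * (- 1ℚ) ^ k) (ℕ.+-suc n n))
    (trans (negneg ((- 1ℚ) ^ (n ℕ.+ n))) ([-1]^even n))
    where
    negneg : ∀ x → - 1ℚ * (- 1ℚ * x) ≡ x
    negneg = solve 1 (λ x → con (- 1ℚ) :* (con (- 1ℚ) :* x) := x) refl

  step : ∀ l h h₂ e r₁ r₂ r → e ≡ 1ℚ → r ≡ r₂ + r₂ → l + h ≡ h₂ →
    l + e * (r₁ * 1ℚ) + (- 1ℚ * e) * (r₂ * 1ℚ) + (h + r) ≡ h₂ + r₁ + r₂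
  step l h _ _ r₁ r₂ _ refl refl refl = solve 4 (λ l h a b →
    l :+ con 1ℚ :* (a :* con 1ℚ) :+ (con (- 1ℚ) :* con 1ℚ) :* (b :* con 1ℚ) :+ (h :+ (b :+ b))
      := l :+ h :+ a :+ b) refl l h r₁ r₂

  L+H : ∀ n → L 1 (n ℕ.+ n) + H n ≡ H (n ℕ.+ n)
  L+H zero    = refl
  L+H (suc n) = subst (λ k → L 1 (suc k) + H (suc n) ≡ H (suc k)) (sym (ℕ.+-suc n n))
    (step (L 1 (n ℕ.+ n)) (H n) (H (n ℕ.+ n)) ((- 1ℚ) ^ (n ℕ.+ n))
      (recip (suc (n ℕ.+ n))) (recip (2+ (n ℕ.+ n))) (recip (suc n))
      ([-1]^even n) (recip-double n) (L+H n))

  cancelʳ : ∀ x y z → x + y ≡ y + z → x ≡ z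
  cancelʳ x y z eq = trans (solve 2 (λ x y → x := x :+ y :- y) refl x y)
    (trans (cong (_- y) eq) (solve 2 (λ y z → y :+ z :- y := z) refl y z))

  riemannSum≡L : ∀ n → L 1 (n ℕ.+ n) ≡ riemannSum n
  riemannSum≡L n = cancelʳ (L 1 (n ℕ.+ n)) (H n) (riemannSum n) (trans (L+H n) (H-split n n (n+k≢0 n)))

riemannSum-isCauchy : IsCauchy riemannSum
riemannSum-isCauchy ε 0<ε = proj₁ conv , λ m n N≤m N≤n →
  subst₂ (λ x y → ∣ x - y ∣ < ε) (RiemannSum.riemannSum≡L m) (RiemannSum.riemannSum≡L n)
    (proj₂ conv (m ℕ.+ m) (n ℕ.+ n) (ℕ.≤-trans N≤m (ℕ.m≤m+n m m)) (ℕ.≤-trans N≤n (ℕ.m≤m+n n n)))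
  where
  conv = ζ̄-convergent 1 ε 0<ε

ln2 : ℝ
ln2 = mkℝ riemannSum riemannSum-isCauchy

instance
  nonTrivial-suc : ∀ {n} .{{_ : NonZero n}} → NonTrivial (suc n)
  nonTrivial-suc {suc n} = _

nonTrivial-2+p∸j : ∀ {j p} → j ℕ.≤ p → NonTrivial (2 ℕ.+ p ℕ.∸ j)
nonTrivial-2+p∸j {j} {p} j≤p = ℕ.n>1⇒nonTrivial
  (subst (2 ℕ.≤_) (sym (ℕ.+-∸-assoc 2 j≤p)) (ℕ.m≤m+n 2 (p ℕ.∸ j)))

nonZero-2+p∸j : ∀ {j p} → j ℕ.≤ 1 ℕ.+ p → NonZero (2 ℕ.+ p ℕ.∸ j)
nonZero-2+p∸j j≤1+p = ℕ.>-nonZero (ℕ.m<n⇒0<n∸m (s≤s j≤1+p))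

nonTrivial-1+p∸i : ∀ {i p} .{{_ : NonZero p}} → i ℕ.≤ p ℕ.∸ 1 → NonTrivial (1 ℕ.+ p ℕ.∸ i)
nonTrivial-1+p∸i {p = suc p} i≤p = nonTrivial-2+p∸j i≤p

{-# OPTIONS --safe #-}
module Submission where

-- Truncate every series at N, so that each product of two series on the right
-- is a sum over the square 1 ≤ k, n ≤ N. Summing over j first gives a geometric
-- sum, which partial fractions turn into the kernels 1/(n - k) and 1/(n + k).
-- The remaining sum over k of 1, (-1)ᵏ, (-1)ᵏ Hₖ or Lₖ against such a kernel
-- satisfies a first-order recurrence in n, because shifting both indices fixes
-- n - k; solving it gives a closed form in harmonic sums with an error of at
-- most a constant times H_N n/(N + 1 - n). These errors carry the weight 1/n²
-- and add up to O(H_N²/N). What is left is a polynomial identity between the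
-- truncated sums, up to ζ̄(2) = ζ(2)/2 and ln 2 = ζ̄(1).
--
-- All sums are written with the sign (-1)ⁿ rather than (-1)ⁿ⁻¹, so that
-- altHarmonic n = - L 1 n.

-- The obstacle is that the kernel sums cannot be sent to the limit one by one. The sums of Lₖ/(n -
-- k), 1/(n - k) and 1/(n + k) over k diverge logarithmically, and one factor on the right is the
-- conditionally convergent ζ̄(1). At finite N the divergent parts are constant in n (H_N, or the
-- sum of Lₖ/k) and cancel exactly, so no infinite series is ever rearranged. The product sum with
-- coefficients 1 - (-1)ʲ⁻¹ uses both kernels. Its two kernel sums of (-1)ᵏ Hₖ agree at n = 0, so
-- only their difference is solved for, and the sum of (-1)ᵏ Hₖ/k is never evaluated. Coefficients
-- linear in p come from the diagonal k = n, where the geometric sum has equal terms. The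
-- coefficient 3/2 is 1 + 1/2: the 1 comes from the kernel sum of (-1)ᵏ, the 1/2 from summation by
-- parts in that of Lₖ. `gap` and `δ` recurse on both indices at once, so their invariance under the
-- shift holds by computation.

module Truncation where

  open import Defs
  open import Data.Integer.Base using (+_)
  open import Data.List.Base using (List; []; _∷_; foldr)
  open import Data.Nat.Base as ℕ using (ℕ; zero; suc; z≤n; s≤s)
  import Data.Nat.Properties as ℕ
  open import Data.Product.Base using (∃-syntax; _×_; _,_; proj₁; proj₂)
  open import Data.Rational.Base using (ℚ; 0ℚ; 1ℚ; ½; _+_; _*_; _-_; -_; _/_; ∣_∣; _≤_; _<_; nonNegative; positive)
  import Data.Rational.Properties as ℚ
  open import Data.Rational.Solver using (module +-*-Solver)
  open import Data.Sum.Base using (inj₁; inj₂)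
  open import Relation.Binary.PropositionalEquality hiding (J)
  open +-*-Solver

  -- Finite sums and partial fractions.

  ∑₁ : (ℕ → ℚ) → ℕ → ℚ
  ∑₁ f zero    = 0ℚ
  ∑₁ f (suc n) = ∑₁ f n + f (suc n)

  ∑₁-cong : ∀ {f g} N → (∀ n → n ℕ.< N → f (suc n) ≡ g (suc n)) → ∑₁ f N ≡ ∑₁ g N
  ∑₁-cong zero    h = refl
  ∑₁-cong (suc N) h = cong₂ _+_ (∑₁-cong N λ n n<N → h n (ℕ.m≤n⇒m≤1+n n<N)) (h N ℕ.≤-refl)

  interchange : ∀ a b c d → (a + b) + (c + d) ≡ (a + c) + (b + d)
  interchange = solve 4 (λ a b c d → (a :+ b) :+ (c :+ d) := (a :+ c) :+ (b :+ d)) refl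

  ∑₁-+ : ∀ f g N → ∑₁ (λ n → f n + g n) N ≡ ∑₁ f N + ∑₁ g N
  ∑₁-+ f g zero    = refl
  ∑₁-+ f g (suc N) = trans (cong (_+ (f (suc N) + g (suc N))) (∑₁-+ f g N))
    (interchange (∑₁ f N) (∑₁ g N) (f (suc N)) (g (suc N)))

  ∑₁-*ˡ : ∀ c f N → ∑₁ (λ n → c * f n) N ≡ c * ∑₁ f N
  ∑₁-*ˡ c f zero    = sym (ℚ.*-zeroʳ c)
  ∑₁-*ˡ c f (suc N) = trans (cong (_+ c * f (suc N)) (∑₁-*ˡ c f N))
    (sym (ℚ.*-distribˡ-+ c (∑₁ f N) (f (suc N))))

  neg-as-* : ∀ a → - a ≡ (- 1ℚ) * a
  neg-as-* = solve 1 (λ a → :- a := con (- 1ℚ) :* a) refl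

  ∑₁-neg : ∀ f N → ∑₁ (λ n → - f n) N ≡ - ∑₁ f N
  ∑₁-neg f N = trans (∑₁-cong N λ n _ → neg-as-* (f (suc n)))
    (trans (∑₁-*ˡ (- 1ℚ) f N) (sym (neg-as-* (∑₁ f N))))

  ∑₁-- : ∀ f g N → ∑₁ (λ n → f n - g n) N ≡ ∑₁ f N - ∑₁ g N
  ∑₁-- f g N = trans (∑₁-+ f (λ n → - g n) N) (cong (λ y → ∑₁ f N + y) (∑₁-neg g N))

  ∑₁-0 : ∀ N → ∑₁ (λ _ → 0ℚ) N ≡ 0ℚ
  ∑₁-0 zero    = refl
  ∑₁-0 (suc N) = trans (ℚ.+-identityʳ _) (∑₁-0 N)

  ∑₁-swap : ∀ (f : ℕ → ℕ → ℚ) M N → ∑₁ (λ k → ∑₁ (f k) N) M ≡ ∑₁ (λ n → ∑₁ (λ k → f k n) M) N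
  ∑₁-swap f zero    N = sym (∑₁-0 N)
  ∑₁-swap f (suc M) N = trans (cong (_+ ∑₁ (f (suc M)) N) (∑₁-swap f M N))
    (sym (∑₁-+ (λ n → ∑₁ (λ k → f k n) M) (f (suc M)) N))

  -- The source of every recurrence below: moving the index by one brings in the summand at 0, which
  -- belongs to the closed form, and drops the one at `N`, which becomes the error.
  ∑₁-shift : ∀ f N → ∑₁ (λ n → f (ℕ.pred n)) N ≡ f 0 + ∑₁ f N - f N
  ∑₁-shift f zero    = solve 1 (λ a → con 0ℚ := a :+ con 0ℚ :- a) refl (f 0)
  ∑₁-shift f (suc N) = trans (cong (_+ f N) (∑₁-shift f N))
    (solve 4 (λ a s b c → a :+ s :- b :+ b := a :+ (s :+ c) :- c) refl (f 0) (∑₁ f N) (f N) (f (suc N)))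

  ∑₁-*-∑₁ : ∀ f g M N → ∑₁ f M * ∑₁ g N ≡ ∑₁ (λ k → ∑₁ (λ n → f k * g n) N) M
  ∑₁-*-∑₁ f g M N = trans (ℚ.*-comm (∑₁ f M) (∑₁ g N)) (trans (sym (∑₁-*ˡ (∑₁ g N) f M))
    (∑₁-cong M λ k _ → trans (ℚ.*-comm (∑₁ g N) (f (suc k))) (sym (∑₁-*ˡ (f (suc k)) g N))))

  partialSum≡∑₁ : ∀ {a : Terms} {f} N → (∀ n → a (suc n) ≡ f (suc n)) → partialSum a N ≡ ∑₁ f N
  partialSum≡∑₁ zero    h = refl
  partialSum≡∑₁ (suc N) h = cong₂ _+_ (partialSum≡∑₁ N h) (h N)

  ∑₀ : (ℕ → ℚ) → ℕ → ℚ
  ∑₀ f zero    = 0ℚ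
  ∑₀ f (suc m) = ∑₀ f m + f m

  ∑₀-cong : ∀ {f g} m → (∀ i → i ℕ.< m → f i ≡ g i) → ∑₀ f m ≡ ∑₀ g m
  ∑₀-cong zero    h = refl
  ∑₀-cong (suc m) h = cong₂ _+_ (∑₀-cong m λ i i<m → h i (ℕ.m≤n⇒m≤1+n i<m)) (h m ℕ.≤-refl)

  ∑₀-*ˡ : ∀ c f m → ∑₀ (λ i → c * f i) m ≡ c * ∑₀ f m
  ∑₀-*ˡ c f zero    = sym (ℚ.*-zeroʳ c)
  ∑₀-*ˡ c f (suc m) = trans (cong (_+ c * f m) (∑₀-*ˡ c f m)) (sym (ℚ.*-distribˡ-+ c (∑₀ f m) (f m)))

  ∑₀-+ : ∀ f g m → ∑₀ (λ i → f i + g i) m ≡ ∑₀ f m + ∑₀ g m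
  ∑₀-+ f g zero    = refl
  ∑₀-+ f g (suc m) = trans (cong (_+ (f m + g m)) (∑₀-+ f g m)) (interchange (∑₀ f m) (∑₀ g m) (f m) (g m))

  ∑₀-neg : ∀ f m → ∑₀ (λ i → - f i) m ≡ - ∑₀ f m
  ∑₀-neg f m = trans (∑₀-cong m λ i _ → neg-as-* (f i))
    (trans (∑₀-*ˡ (- 1ℚ) f m) (sym (neg-as-* (∑₀ f m))))

  ∑₀-∑₁ : ∀ (f : ℕ → ℕ → ℚ) m N → ∑₀ (λ i → ∑₁ (f i) N) m ≡ ∑₁ (λ n → ∑₀ (λ i → f i n) m) N
  ∑₀-∑₁ f zero    N = sym (∑₁-0 N)
  ∑₀-∑₁ f (suc m) N = trans (cong (_+ ∑₁ (f m) N) (∑₀-∑₁ f m N))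
    (sym (∑₁-+ (λ n → ∑₀ (λ i → f i n) m) (f m) N))

  approx-sumBelow : ∀ m (f : (i : ℕ) → .(i ℕ.< m) → ℝ) (g : ℕ → ℚ) N →
    (∀ i (i<m : i ℕ.< m) → approx (f i i<m) N ≡ g i) → approx (sumBelow m f) N ≡ ∑₀ g m
  approx-sumBelow zero    f g N h = refl
  approx-sumBelow (suc m) f g N h = cong₂ _+_
    (approx-sumBelow m (λ i i<m → f i (ℕ.m≤n⇒m≤1+n i<m)) g N λ i i<m → h i (ℕ.m≤n⇒m≤1+n i<m))
    (h m ℕ.≤-refl)

  -- A record is injective in f, so f can be inferred from the type; unifying
  -- approx (∑ lo hi f) N instead would unfold the convergence proofs in f.
  record SumValue {lo hi} (f : (j : ℕ) → .(lo ℕ.≤ j) → .(j ℕ.≤ hi) → ℝ) (g : ℕ → ℚ) (N : ℕ) : Set where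
    constructor sumValue
    field
      value : approx (∑ lo hi f) N ≡ ∑₀ g (suc hi ℕ.∸ lo)

  ∑-value : ∀ {lo hi} {f : (j : ℕ) → .(lo ℕ.≤ j) → .(j ℕ.≤ hi) → ℝ} {g N} →
    (∀ i (i< : i ℕ.< suc hi ℕ.∸ lo) → approx (f (lo ℕ.+ i) (ℕ.m≤m+n lo i) (index-bound lo hi i i<)) N ≡ g i) →
    SumValue f g N
  ∑-value {lo} {hi} {f} {g} {N} h = sumValue (approx-sumBelow (suc hi ℕ.∸ lo)
    (λ i i< → f (lo ℕ.+ i) (ℕ.m≤m+n lo i) (index-bound lo hi i i<)) g N h)

  opaque
    -- The default value 0 at 0 makes `gap n n` vanish and lets the closed forms below start at
    -- `n = 0`. Opaque, so that rational division never unfolds.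
    rec : ℕ → ℚ
    rec zero    = 0ℚ
    rec (suc n) = recip (suc n)

    rec-zero : rec 0 ≡ 0ℚ
    rec-zero = refl

    rec-suc : ∀ n → rec (suc n) ≡ recip (suc n)
    rec-suc n = refl

  fromℕ*rec : ∀ n → fromℕ (suc n) * rec (suc n) ≡ 1ℚ
  fromℕ*rec n = trans (cong (fromℕ (suc n) *_) (rec-suc n)) (fromℕ*recip (suc n))

  sgn : ℕ → ℚ
  sgn n = (- 1ℚ) ^ n

  sgn-sq : ∀ n → sgn n * sgn n ≡ 1ℚ
  sgn-sq zero    = refl
  sgn-sq (suc n) = trans (solve 1 (λ s → (con (- 1ℚ) :* s) :* (con (- 1ℚ) :* s) := s :* s) refl (sgn n)) (sgn-sq n)

  δ : ℕ → ℕ → ℚ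
  δ zero    zero    = 1ℚ
  δ zero    (suc n) = 0ℚ
  δ (suc k) zero    = 0ℚ
  δ (suc k) (suc n) = δ k n

  δ-sym : ∀ k n → δ k n ≡ δ n k
  δ-sym zero    zero    = refl
  δ-sym zero    (suc n) = refl
  δ-sym (suc k) zero    = refl
  δ-sym (suc k) (suc n) = δ-sym k n

  δ-* : ∀ (f : ℕ → ℚ) k n → δ k n * f n ≡ δ k n * f k
  δ-* f zero    zero    = refl
  δ-* f zero    (suc n) = trans (ℚ.*-zeroˡ (f (suc n))) (sym (ℚ.*-zeroˡ (f 0)))
  δ-* f (suc k) zero    = trans (ℚ.*-zeroˡ (f 0)) (sym (ℚ.*-zeroˡ (f (suc k))))
  δ-* f (suc k) (suc n) = δ-* (λ i → f (suc i)) k n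

  δ-diag : ∀ k → δ k k ≡ 1ℚ
  δ-diag zero    = refl
  δ-diag (suc k) = δ-diag k

  δ-< : ∀ {k n} → k ℕ.< n → δ k n ≡ 0ℚ
  δ-< {zero}  {suc n} _         = refl
  δ-< {suc k} {suc n} (s≤s k<n) = δ-< k<n

  ∑₁-δ : ∀ (f : ℕ → ℚ) k N → k ℕ.< N → ∑₁ (λ n → δ (suc k) n * f n) N ≡ f (suc k)
  ∑₁-δ f k N k<N = trans
    (∑₁-cong N λ n _ → trans (δ-* f (suc k) (suc n)) (ℚ.*-comm (δ k n) (f (suc k))))
    (trans (∑₁-*ˡ (f (suc k)) (δ (suc k)) N)
      (trans (cong (f (suc k) *_) (total k N k<N)) (ℚ.*-identityʳ (f (suc k)))))
    where
    before : ∀ k N → N ℕ.≤ k → ∑₁ (δ (suc k)) N ≡ 0ℚ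
    before k zero    _   = refl
    before k (suc N) N<k = cong₂ _+_ (before k N (ℕ.<⇒≤ N<k)) (trans (δ-sym k N) (δ-< N<k))
    total : ∀ k N → k ℕ.< N → ∑₁ (δ (suc k)) N ≡ 1ℚ
    total k (suc N) (s≤s k≤N) with ℕ.m≤n⇒m<n∨m≡n k≤N
    ... | inj₁ k<N = cong₂ _+_ (total k N k<N) (δ-< k<N)
    ... | inj₂ refl = cong₂ _+_ (before k k ℕ.≤-refl) (δ-diag k)

  -- gap k n is 1/(n - k), with the junk value 0 when n = k.
  gap : ℕ → ℕ → ℚ
  gap zero    n       = rec n
  gap (suc k) zero    = - rec (suc k)
  gap (suc k) (suc n) = gap k n

  -- Justifies reading `gap` as 1/(n - k): off the diagonal it inverts n - k, on the diagonal both
  -- sides vanish.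
  gap-* : ∀ k n → gap k n * (fromℕ n - fromℕ k) ≡ 1ℚ - δ k n
  gap-* zero    zero    = trans (cong (_* 0ℚ) rec-zero) refl
  gap-* zero    (suc n) = trans (solve 2 (λ g n → g :* (n :- con 0ℚ) := n :* g) refl (rec (suc n)) (fromℕ (suc n)))
    (fromℕ*rec n)
  gap-* (suc k) zero    = trans (solve 2 (λ g n → :- g :* (con 0ℚ :- n) := n :* g) refl (rec (suc k)) (fromℕ (suc k)))
    (fromℕ*rec k)
  gap-* (suc k) (suc n) = trans (cong₂ (λ a b → gap k n * (a - b)) (fromℕ-suc n) (fromℕ-suc k))
    (trans (solve 3 (λ g n k → g :* ((n :+ con 1ℚ) :- (k :+ con 1ℚ)) := g :* (n :- k)) refl (gap k n) (fromℕ n) (fromℕ k))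
      (gap-* k n))

  gap-antisym : ∀ k n → gap k n ≡ - gap n k
  gap-antisym zero    zero    = trans rec-zero (cong -_ (sym rec-zero))
  gap-antisym zero    (suc n) = solve 1 (λ a → a := :- :- a) refl (rec (suc n))
  gap-antisym (suc k) zero    = refl
  gap-antisym (suc k) (suc n) = gap-antisym k n

  gap-zeroʳ : ∀ k → gap k 0 ≡ - rec k
  gap-zeroʳ zero    = trans rec-zero (cong -_ (sym rec-zero))
  gap-zeroʳ (suc k) = refl

  gap-fraction-helper : ∀ g N K a b d → K * a ≡ 1ℚ → N * b ≡ 1ℚ → g * (N - K) ≡ 1ℚ - d → d * b ≡ d * a →
    g * a ≡ g * b + a * b - d * (a * a)
  gap-fraction-helper g N K a b d Ka Nb gNK db = begin
    g * a                                  ≡⟨ ℚ.*-identityʳ (g * a) ⟨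
    g * a * 1ℚ                             ≡⟨ cong (g * a *_) Nb ⟨
    g * a * (N * b)
      ≡⟨ solve 5 (λ g N K a b → g :* a :* (N :* b) := g :* (K :* a) :* b :+ (g :* (N :- K)) :* (a :* b)) refl g N K a b ⟩
    g * (K * a) * b + g * (N - K) * (a * b)
      ≡⟨ cong₂ (λ u v → g * u * b + v * (a * b)) Ka gNK ⟩
    g * 1ℚ * b + (1ℚ - d) * (a * b)
      ≡⟨ solve 4 (λ g a b d → g :* con 1ℚ :* b :+ (con 1ℚ :- d) :* (a :* b) := g :* b :+ a :* b :- d :* b :* a) refl g a b d ⟩
    g * b + a * b - d * b * a              ≡⟨ cong (λ u → g * b + a * b - u * a) db ⟩
    g * b + a * b - d * a * a              ≡⟨ cong (λ u → g * b + a * b - u) (ℚ.*-assoc d a a) ⟩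
    g * b + a * b - d * (a * a)            ∎
    where open ≡-Reasoning

  -- Partial fractions 1/(k (n - k)) = 1/(n (n - k)) + 1/(k n). On the diagonal `gap` is 0 and the
  -- `δ` term cancels 1/(k n).
  gap-fraction : ∀ k n → gap (suc k) (suc n) * rec (suc k) ≡
    gap (suc k) (suc n) * rec (suc n) + rec (suc k) * rec (suc n) - δ (suc k) (suc n) * (rec (suc k) * rec (suc k))
  gap-fraction k n = gap-fraction-helper (gap k n) (fromℕ (suc n)) (fromℕ (suc k)) (rec (suc k)) (rec (suc n)) (δ k n)
    (fromℕ*rec k) (fromℕ*rec n) (gap-* (suc k) (suc n)) (δ-* rec (suc k) (suc n))

  sum-fraction-helper : ∀ M K N a b c → N ≡ M + K → M * a ≡ 1ℚ → K * b ≡ 1ℚ → N * c ≡ 1ℚ → a * b ≡ c * a + c * b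
  sum-fraction-helper M K N a b c refl Ma Kb Nc = begin
    a * b                                  ≡⟨ ℚ.*-identityʳ (a * b) ⟨
    a * b * 1ℚ                             ≡⟨ cong (a * b *_) Nc ⟨
    a * b * ((M + K) * c)
      ≡⟨ solve 5 (λ M K a b c → a :* b :* ((M :+ K) :* c) := c :* a :* (K :* b) :+ c :* b :* (M :* a)) refl M K a b c ⟩
    c * a * (K * b) + c * b * (M * a)      ≡⟨ cong₂ (λ u v → c * a * u + c * b * v) Kb Ma ⟩
    c * a * 1ℚ + c * b * 1ℚ                ≡⟨ cong₂ _+_ (ℚ.*-identityʳ (c * a)) (ℚ.*-identityʳ (c * b)) ⟩
    c * a + c * b                          ∎
    where open ≡-Reasoning

  sum-fraction : ∀ m k → rec (suc m) * rec (suc k) ≡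
    rec (suc m ℕ.+ suc k) * rec (suc m) + rec (suc m ℕ.+ suc k) * rec (suc k)
  sum-fraction m k = sum-fraction-helper (fromℕ (suc m)) (fromℕ (suc k)) (fromℕ (suc m ℕ.+ suc k)) _ _ _
    (RiemannSum.fromℕ-+ (suc m) (suc k)) (fromℕ*rec m) (fromℕ*rec k) (fromℕ*rec (m ℕ.+ suc k))

  ^-∸-suc : ∀ y {m i} → i ℕ.≤ m → y ^ (suc m ℕ.∸ i) ≡ y * y ^ (m ℕ.∸ i)
  ^-∸-suc y {m} {i} i≤m = cong (y ^_) (ℕ.+-∸-assoc 1 i≤m)

  -- The homogeneous polynomial xy (x^m - y^m) / (x - y).
  homogeneous : ℚ → ℚ → ℕ → ℚ
  homogeneous x y m = ∑₀ (λ i → x ^ suc i * y ^ (m ℕ.∸ i)) m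

  homogeneous-suc : ∀ x y m → homogeneous x y (suc m) ≡ y * homogeneous x y m + x ^ suc m * y
  homogeneous-suc x y m = cong₂ _+_
    (trans (∑₀-cong m λ i i<m → trans (cong (x ^ suc i *_) (^-∸-suc y (ℕ.<⇒≤ i<m)))
        (solve 3 (λ a b c → a :* (b :* c) := b :* (a :* c)) refl (x ^ suc i) y (y ^ (m ℕ.∸ i))))
      (∑₀-*ˡ y (λ i → x ^ suc i * y ^ (m ℕ.∸ i)) m))
    (cong (x ^ suc m *_) (trans (cong (y ^_) (ℕ.m+n∸n≡m 1 m)) (ℚ.*-identityʳ y)))

  -- The relation h is that of gap-fraction and sum-fraction, with g = 1/(n - k),
  -- x = 1/k, y = 1/n; negating x turns n - k into n + k.
  homogeneous-closed : ∀ g x y d → g * x ≡ g * y + x * y - d * (x * x) → d * y ≡ d * x → ∀ m →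
    homogeneous x y m ≡ g * (x ^ m - y ^ m) + d * (fromℕ m * x ^ suc m)
  homogeneous-closed g x y d h dy zero    =
    solve 3 (λ g d x → con 0ℚ := g :* (con 1ℚ :- con 1ℚ) :+ d :* (con 0ℚ :* (x :* con 1ℚ))) refl g d x
  homogeneous-closed g x y d h dy (suc m) = begin
    homogeneous x y (suc m)                    ≡⟨ homogeneous-suc x y m ⟩
    y * homogeneous x y m + x ^ suc m * y
      ≡⟨ cong (λ u → y * u + x ^ suc m * y) (homogeneous-closed g x y d h dy m) ⟩
    y * (g * (X - Y) + d * (M * (x * X))) + x * X * y
      -- The right side of `h` is collected with factor `X`, and `d * y` is isolated, because the
      -- solver knows neither relation; the next step rewrites with both.
      ≡⟨ solve 7 (λ g x y d X Y M →
           y :* (g :* (X :- Y) :+ d :* (M :* (x :* X))) :+ x :* X :* y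
             := X :* (g :* y :+ x :* y :- d :* (x :* x)) :+ d :* (x :* x) :* X :- g :* (y :* Y) :+ d :* y :* (M :* (x :* X)))
           refl g x y d X Y M ⟩
    X * (g * y + x * y - d * (x * x)) + d * (x * x) * X - g * (y * Y) + d * y * (M * (x * X))
      ≡⟨ cong₂ (λ u v → X * u + d * (x * x) * X - g * (y * Y) + v * (M * (x * X))) (sym h) dy ⟩
    X * (g * x) + d * (x * x) * X - g * (y * Y) + d * x * (M * (x * X))
      ≡⟨ solve 7 (λ g x y d X Y M →
           X :* (g :* x) :+ d :* (x :* x) :* X :- g :* (y :* Y) :+ d :* x :* (M :* (x :* X))
             := g :* (x :* X :- y :* Y) :+ d :* ((M :+ con 1ℚ) :* (x :* (x :* X))))
           refl g x y d X Y M ⟩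
    g * (x * X - y * Y) + d * ((M + 1ℚ) * (x * (x * X)))
      ≡⟨ cong (λ u → g * (x * X - y * Y) + d * (u * (x * (x * X)))) (fromℕ-suc m) ⟨
    g * (x * X - y * Y) + d * (fromℕ (suc m) * (x * (x * X))) ∎
    where
    open ≡-Reasoning
    X = x ^ m
    Y = y ^ m
    M = fromℕ m

  -- On the diagonal the geometric sum consists of `m` equal terms, which is the origin of the
  -- coefficients linear in the exponent.
  homogeneous-gap : ∀ k n m → homogeneous (rec (suc k)) (rec (suc n)) m ≡
    gap (suc k) (suc n) * (rec (suc k) ^ m - rec (suc n) ^ m) + δ (suc k) (suc n) * (fromℕ m * rec (suc k) ^ suc m)
  homogeneous-gap k n = homogeneous-closed (gap k n) (rec (suc k)) (rec (suc n)) (δ k n)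
    (gap-fraction k n) (δ-* rec (suc k) (suc n))

  ^-neg : ∀ x m → (- x) ^ m ≡ sgn m * x ^ m
  ^-neg x zero    = refl
  ^-neg x (suc m) = trans (cong (- x *_) (^-neg x m))
    (solve 3 (λ x s X → :- x :* (s :* X) := con (- 1ℚ) :* s :* (x :* X)) refl x (sgn m) (x ^ m))

  -- For x = -1/k and y = 1/n the quotient xy/(x - y) is 1/(k + n). It has no diagonal, so
  -- `homogeneous-closed` is applied with `d` equal to 0.
  homogeneous-sum : ∀ k n m → homogeneous (- rec (suc k)) (rec (suc n)) m ≡
    rec (suc k ℕ.+ suc n) * (sgn m * rec (suc k) ^ m - rec (suc n) ^ m)
  homogeneous-sum k n m = trans
    (homogeneous-closed g (- x) y 0ℚ
      (trans (solve 3 (λ g x y → g :* (:- x) := g :* y :- (g :* x :+ g :* y)) refl g x y)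
        (trans (cong (λ u → g * y - u) (sym (sum-fraction k n)))
          (solve 3 (λ g x y → g :* y :- x :* y := g :* y :+ (:- x) :* y :- con 0ℚ :* ((:- x) :* (:- x))) refl g x y)))
      (trans (ℚ.*-zeroˡ y) (sym (ℚ.*-zeroˡ (- x)))) m)
    (trans (cong (λ u → g * (u - y ^ m) + 0ℚ * (fromℕ m * (- x * u))) (^-neg x m))
      (solve 4 (λ g u v w → g :* (u :- v) :+ con 0ℚ :* w := g :* (u :- v)) refl
        g (sgn m * x ^ m) (y ^ m) (fromℕ m * (- x * (sgn m * x ^ m)))))
    where
    g = rec (suc k ℕ.+ suc n)
    x = rec (suc k)
    y = rec (suc n)

  -- Inner sums truncated at N.

  harmonic harmonic² altHarmonic altHarmonic² altH : ℕ → ℚ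
  harmonic     = ∑₁ rec
  harmonic²    = ∑₁ λ n → rec n * rec n
  altHarmonic  = ∑₁ λ n → sgn n * rec n
  altHarmonic² = ∑₁ λ n → sgn n * (rec n * rec n)
  altH n       = sgn n * harmonic n

  rec-+-suc : ∀ n j → rec (n ℕ.+ suc j) ≡ rec (suc n ℕ.+ j)
  rec-+-suc n j = cong rec (ℕ.+-suc n j)

  altH-suc : ∀ k → altH (suc k) ≡ - altH k + sgn (suc k) * rec (suc k)
  altH-suc k = solve 3 (λ s h x → con (- 1ℚ) :* s :* (h :+ x) := :- (s :* h) :+ con (- 1ℚ) :* s :* x) refl
    (sgn k) (harmonic k) (rec (suc k))

  module Truncated (N : ℕ) where

    -- Tends to - ln 2 as `N` grows.
    lam : ℚ
    lam = altHarmonic N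

    -- The fixed index is the first argument of `gap`, so the kernel here is 1/(k - n). As `N`
    -- grows, `Y`, `C` and `G` diverge, but by amounts whose growing part does not depend on `n`.
    U Y A B J K C G : ℕ → ℚ
    U n = ∑₁ (λ k → sgn k * gap n k) N
    Y n = ∑₁ (λ k → altHarmonic k * gap n k) N
    A n = ∑₁ (λ k → altH k * gap n k) N
    B n = ∑₁ (λ k → altH k * rec (n ℕ.+ k)) N
    J n = ∑₁ (λ k → sgn k * (rec k * rec (n ℕ.+ k))) N
    K n = ∑₁ (λ k → sgn k * rec (n ℕ.+ k)) N
    C n = ∑₁ (λ k → rec (n ℕ.+ k)) N
    G n = ∑₁ (gap n) N

    U-suc : ∀ n → U (suc n) ≡ - U n + sgn N * gap n N + rec n
    U-suc n = begin
      U (suc n)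
        ≡⟨ ∑₁-cong N (λ k _ → solve 2 (λ s g → con (- 1ℚ) :* s :* g := :- (s :* g)) refl (sgn k) (gap n k)) ⟩
      ∑₁ (λ k → f (ℕ.pred k)) N             ≡⟨ ∑₁-shift f N ⟩
      f 0 + ∑₁ f N - f N
        ≡⟨ cong₂ (λ a b → - (1ℚ * a) + b - f N) (gap-zeroʳ n) (∑₁-neg (λ k → sgn k * gap n k) N) ⟩
      - (1ℚ * - rec n) + - U n - - (sgn N * gap n N)
        ≡⟨ solve 3 (λ x u y → :- (con 1ℚ :* :- x) :+ :- u :- :- y := :- u :+ y :+ x) refl (rec n) (U n) (sgn N * gap n N) ⟩
      - U n + sgn N * gap n N + rec n ∎
      where
      open ≡-Reasoning
      f : ℕ → ℚ
      f k = - (sgn k * gap n k)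

    -- Up to sign the summands are 1/(N + 1 - i). They are not small for `i` near `N`, so the sum is
    -- controlled only after multiplication by 1/n.
    errU : ℕ → ℚ
    errU = ∑₁ λ i → sgn i * (sgn N * gap (ℕ.pred i) N)

    -- With j = k - n the left side sums (-1)^j/j over 1 - n ≤ j ≤ N - n, j ≠ 0. Negative `j` give
    -- minus the partial sum up to n - 1, that is `- altHarmonic n + sgn n * rec n`; `errU` accounts
    -- for positive `j` stopping at N - n and not at `N`.
    U-closed : ∀ n → sgn n * U n ≡ lam - altHarmonic n + sgn n * rec n + errU n
    U-closed zero    = trans (solve 1 (λ l → con 1ℚ :* l := l :- con 0ℚ :+ con 1ℚ :* con 0ℚ :+ con 0ℚ) refl lam)
      (cong (λ x → lam - 0ℚ + 1ℚ * x + 0ℚ) (sym rec-zero))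
    U-closed (suc n) = begin
      sgn (suc n) * U (suc n)                ≡⟨ cong (sgn (suc n) *_) (U-suc n) ⟩
      sgn (suc n) * (- U n + y + rec n)
        ≡⟨ solve 4 (λ s u y x → con (- 1ℚ) :* s :* (:- u :+ y :+ x) := s :* u :+ con (- 1ℚ) :* s :* y :- s :* x) refl
            (sgn n) (U n) y (rec n) ⟩
      sgn n * U n + sgn (suc n) * y - sgn n * rec n
        ≡⟨ cong (λ u → u + sgn (suc n) * y - sgn n * rec n) (U-closed n) ⟩
      lam - altHarmonic n + sgn n * rec n + errU n + sgn (suc n) * y - sgn n * rec n
        ≡⟨ solve 6 (λ l h a e d b → l :- h :+ a :+ e :+ d :- a := l :- (h :+ b) :+ b :+ (e :+ d)) refl
            lam (altHarmonic n) (sgn n * rec n) (errU n) (sgn (suc n) * y) (sgn (suc n) * rec (suc n)) ⟩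
      lam - altHarmonic (suc n) + sgn (suc n) * rec (suc n) + errU (suc n) ∎
      where
      open ≡-Reasoning
      y = sgn N * gap n N

    -- The inhomogeneous term shared by `Y-suc` and `A-suc`: passing from k - 1 to k adds (-1)^k/k
    -- to `altHarmonic`, and to `altH` after a change of sign.
    ∑-sgn-rec-gap : ∀ n → n ℕ.< N → ∑₁ (λ k → sgn k * (rec k * gap (suc n) k)) N ≡
      rec (suc n) * U (suc n) - rec (suc n) * lam + sgn (suc n) * (rec (suc n) * rec (suc n))
    ∑-sgn-rec-gap n n<N = begin
      ∑₁ (λ k → sgn k * (rec k * gap (suc n) k)) N
        ≡⟨ ∑₁-cong N (λ k _ → pointwise k) ⟩
      ∑₁ (λ k → (x * (sgn k * gap (suc n) k) - x * (sgn k * rec k)) + δ (suc n) k * (sgn k * (x * x))) N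
        ≡⟨ trans (∑₁-+ _ _ N) (cong₂ _+_ (trans (∑₁-- _ _ N) (cong₂ _-_ (∑₁-*ˡ x _ N) (∑₁-*ˡ x _ N)))
             (∑₁-δ (λ k → sgn k * (x * x)) n N n<N)) ⟩
      x * U (suc n) - x * lam + sgn (suc n) * (x * x) ∎
      where
      open ≡-Reasoning
      x = rec (suc n)
      pointwise : ∀ k → sgn (suc k) * (rec (suc k) * gap n k) ≡
        (x * (sgn (suc k) * gap n k) - x * (sgn (suc k) * rec (suc k))) + δ n k * (sgn (suc k) * (x * x))
      pointwise k = trans
        (solve 5 (λ s g x y d → s :* (y :* g) := s :* (g :* y :+ x :* y :- d :* (x :* x)) :- x :* (s :* y) :+ d :* (s :* (x :* x))) refl
          (sgn (suc k)) (gap n k) x (rec (suc k)) (δ n k))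
        (trans (cong (λ u → sgn (suc k) * u - x * (sgn (suc k) * rec (suc k)) + δ n k * (sgn (suc k) * (x * x)))
          (sym (gap-fraction n k)))
        (solve 5 (λ s g x y d → s :* (g :* x) :- x :* (s :* y) :+ d :* (s :* (x :* x)) := (x :* (s :* g) :- x :* (s :* y)) :+ d :* (s :* (x :* x))) refl
          (sgn (suc k)) (gap n k) x (rec (suc k)) (δ n k)))

    Y-suc : ∀ n → n ℕ.< N → Y (suc n) ≡ Y n - lam * gap n N +
      (rec (suc n) * U (suc n) - rec (suc n) * lam + sgn (suc n) * (rec (suc n) * rec (suc n)))
    Y-suc n n<N = begin
      Y (suc n)
        ≡⟨ ∑₁-cong N (λ k _ → solve 4 (λ h s x g → (h :+ s :* x) :* g := h :* g :+ s :* (x :* g)) refl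
             (altHarmonic k) (sgn (suc k)) (rec (suc k)) (gap n k)) ⟩
      ∑₁ (λ k → f (ℕ.pred k) + sgn k * (rec k * gap (suc n) k)) N
        ≡⟨ trans (∑₁-+ (λ k → f (ℕ.pred k)) _ N) (cong₂ _+_ (∑₁-shift f N) (∑-sgn-rec-gap n n<N)) ⟩
      f 0 + Y n - lam * gap n N + rest
        ≡⟨ solve 4 (λ g y l r → con 0ℚ :* g :+ y :- l :+ r := y :- l :+ r) refl (gap n 0) (Y n) (lam * gap n N) rest ⟩
      Y n - lam * gap n N + rest ∎
      where
      open ≡-Reasoning
      rest = rec (suc n) * U (suc n) - rec (suc n) * lam + sgn (suc n) * (rec (suc n) * rec (suc n))
      f : ℕ → ℚ
      f k = altHarmonic k * gap n k

    rec-U : ∀ n → rec n * U n ≡ sgn n * rec n * (lam - altHarmonic n + sgn n * rec n + errU n)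
    rec-U n = trans (trans (sym (ℚ.*-identityˡ _)) (cong (_* (rec n * U n)) (sym (sgn-sq n))))
      (trans (solve 3 (λ s x u → s :* s :* (x :* u) := s :* x :* (s :* u)) refl (sgn n) (rec n) (U n))
        (cong (sgn n * rec n *_) (U-closed n)))

    errY : ℕ → ℚ
    errY = ∑₁ λ i → sgn i * (rec i * errU i) - lam * gap (ℕ.pred i) N

    -- Summing (-1)^i/i times `altHarmonic i` gives half of the square plus half of `harmonic²`,
    -- because consecutive squares telescope. This is how the square of L_n arises. The first
    -- summand is the value `Y 0`, which diverges and cancels in `identity₁`.
    Y-closed : ∀ n → n ℕ.≤ N → Y n ≡ ∑₁ (λ k → rec k * altHarmonic k) N - lam * harmonic n + altHarmonic² n
      + lam * altHarmonic n - ½ * (altHarmonic n * altHarmonic n - harmonic² n) + errY n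
    Y-closed zero    _   = trans (∑₁-cong N λ k _ → ℚ.*-comm (altHarmonic (suc k)) (rec (suc k)))
      (solve 2 (λ s l → s := s :- l :* con 0ℚ :+ con 0ℚ :+ l :* con 0ℚ :- con ½ :* (con 0ℚ :* con 0ℚ :- con 0ℚ) :+ con 0ℚ) refl
        (∑₁ (λ k → rec k * altHarmonic k) N) lam)
    Y-closed (suc n) n<N = begin
      Y (suc n)                              ≡⟨ Y-suc n n<N ⟩
      Y n - g + (x * U (suc n) - x * lam + s * (x * x))
        ≡⟨ cong₂ (λ a b → a - g + (b - x * lam + s * (x * x))) (Y-closed n (ℕ.<⇒≤ n<N)) (rec-U (suc n)) ⟩
      Z - lam * h + h₂ + lam * l - ½ * (l * l - q) + ey - g
        + (s * x * (lam - (l + s * x) + s * x + eu) - x * lam + s * (x * x))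
        ≡⟨ rearrange Z lam h h₂ l q ey g s x eu ⟩
      Z - lam * (h + x) + (h₂ + s * (x * x)) + lam * (l + s * x)
        - ½ * ((l + s * x) * (l + s * x) - (q + s * s * (x * x))) + (ey + (s * (x * eu) - g))
        ≡⟨ cong (λ u → Z - lam * (h + x) + (h₂ + s * (x * x)) + lam * (l + s * x)
        - ½ * ((l + s * x) * (l + s * x) - (q + u)) + (ey + (s * (x * eu) - g)))
             (trans (cong (_* (x * x)) (sgn-sq (suc n))) (ℚ.*-identityˡ (x * x))) ⟩
      Z - lam * harmonic (suc n) + altHarmonic² (suc n)
        + lam * altHarmonic (suc n) - ½ * (altHarmonic (suc n) * altHarmonic (suc n) - harmonic² (suc n)) + errY (suc n) ∎
      where
      open ≡-Reasoning
      Z  = ∑₁ (λ k → rec k * altHarmonic k) N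
      g  = lam * gap n N
      x  = rec (suc n)
      s  = sgn (suc n)
      h  = harmonic n
      h₂ = altHarmonic² n
      l  = altHarmonic n
      q  = harmonic² n
      ey = errY n
      eu = errU (suc n)
      rearrange : ∀ Z lam h h₂ l q ey g s x eu →
        Z - lam * h + h₂ + lam * l - ½ * (l * l - q) + ey - g
          + (s * x * (lam - (l + s * x) + s * x + eu) - x * lam + s * (x * x)) ≡
        Z - lam * (h + x) + (h₂ + s * (x * x)) + lam * (l + s * x)
          - ½ * ((l + s * x) * (l + s * x) - (q + s * s * (x * x))) + (ey + (s * (x * eu) - g))
      rearrange = solve 11 (λ Z lam h h₂ l q ey g s x eu →
        Z :- lam :* h :+ h₂ :+ lam :* l :- con ½ :* (l :* l :- q) :+ ey :- g
          :+ (s :* x :* (lam :- (l :+ s :* x) :+ s :* x :+ eu) :- x :* lam :+ s :* (x :* x)) :=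
        Z :- lam :* (h :+ x) :+ (h₂ :+ s :* (x :* x)) :+ lam :* (l :+ s :* x)
          :- con ½ :* ((l :+ s :* x) :* (l :+ s :* x) :- (q :+ s :* s :* (x :* x))) :+ (ey :+ (s :* (x :* eu) :- g))) refl

    A-suc : ∀ n → n ℕ.< N → A (suc n) ≡ - A n + altH N * gap n N +
      (rec (suc n) * U (suc n) - rec (suc n) * lam + sgn (suc n) * (rec (suc n) * rec (suc n)))
    A-suc n n<N = begin
      A (suc n)
        ≡⟨ ∑₁-cong N (λ k _ → trans (cong (_* gap n k) (altH-suc k))
             (solve 4 (λ w s x g → (:- w :+ s :* x) :* g := :- (w :* g) :+ s :* (x :* g)) refl
               (altH k) (sgn (suc k)) (rec (suc k)) (gap n k))) ⟩
      ∑₁ (λ k → f (ℕ.pred k) + sgn k * (rec k * gap (suc n) k)) N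
        ≡⟨ trans (∑₁-+ (λ k → f (ℕ.pred k)) _ N) (cong₂ _+_ (trans (∑₁-shift f N)
             (cong (λ u → f 0 + u - f N) (∑₁-neg (λ k → altH k * gap n k) N))) (∑-sgn-rec-gap n n<N)) ⟩
      f 0 + - A n - f N + rest
        ≡⟨ solve 4 (λ g a y r → :- (con 1ℚ :* con 0ℚ :* g) :+ :- a :- :- y :+ r := :- a :+ y :+ r) refl
            (gap n 0) (A n) (altH N * gap n N) rest ⟩
      - A n + altH N * gap n N + rest ∎
      where
      open ≡-Reasoning
      rest = rec (suc n) * U (suc n) - rec (suc n) * lam + sgn (suc n) * (rec (suc n) * rec (suc n))
      f : ℕ → ℚ
      f k = - (altH k * gap n k)

    -- For the kernel 1/(n + k), lowering `k` by one raises `n`. The recurrence therefore comes out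
    -- backwards, `B n` in terms of `B (suc n)`, and is solved for the latter.
    B-suc : ∀ n → B (suc n) ≡ - B n + altH N * rec (suc n ℕ.+ N) + J n
    B-suc n = trans (solve 3 (λ b c d → b := :- (:- b :+ c :+ d) :+ c :+ d) refl (B (suc n)) (altH N * rec (suc n ℕ.+ N)) (J n))
      (cong (λ u → - u + altH N * rec (suc n ℕ.+ N) + J n) (sym backwards))
      where
      open ≡-Reasoning
      f : ℕ → ℚ
      f k = - (altH k * rec (suc n ℕ.+ k))
      backwards : B n ≡ - B (suc n) + altH N * rec (suc n ℕ.+ N) + J n
      backwards = begin
        B n
          ≡⟨ ∑₁-cong N (λ k _ → trans (cong (_* rec (n ℕ.+ suc k)) (altH-suc k))
               (trans (solve 4 (λ w s x g → (:- w :+ s :* x) :* g := :- (w :* g) :+ s :* (x :* g)) refl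
                 (altH k) (sgn (suc k)) (rec (suc k)) (rec (n ℕ.+ suc k)))
               (cong (λ u → - (altH k * u) + sgn (suc k) * (rec (suc k) * rec (n ℕ.+ suc k))) (rec-+-suc n k)))) ⟩
        ∑₁ (λ k → f (ℕ.pred k) + sgn k * (rec k * rec (n ℕ.+ k))) N
          ≡⟨ trans (∑₁-+ (λ k → f (ℕ.pred k)) _ N) (cong (_+ J n) (trans (∑₁-shift f N)
               (cong (λ u → f 0 + u - f N) (∑₁-neg (λ k → altH k * rec (suc n ℕ.+ k)) N)))) ⟩
        f 0 + - B (suc n) - f N + J n
          ≡⟨ solve 4 (λ g a y r → :- (con 1ℚ :* con 0ℚ :* g) :+ :- a :- :- y :+ r := :- a :+ y :+ r) refl
              (rec (suc n ℕ.+ 0)) (B (suc n)) (altH N * rec (suc n ℕ.+ N)) (J n) ⟩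
        - B (suc n) + altH N * rec (suc n ℕ.+ N) + J n ∎

    K-suc : ∀ n → K (suc n) ≡ - K n + sgn N * rec (suc n ℕ.+ N) - rec (suc n)
    K-suc n = trans (solve 3 (λ b c d → b := :- (:- d :+ :- b :+ c) :+ c :- d) refl (K (suc n)) (sgn N * rec (suc n ℕ.+ N)) (rec (suc n)))
      (cong (λ u → - u + sgn N * rec (suc n ℕ.+ N) - rec (suc n)) (sym backwards))
      where
      open ≡-Reasoning
      f : ℕ → ℚ
      f k = - (sgn k * rec (suc n ℕ.+ k))
      backwards : K n ≡ - rec (suc n) + - K (suc n) + sgn N * rec (suc n ℕ.+ N)
      backwards = begin
        K n
          ≡⟨ ∑₁-cong N (λ k _ → trans (cong (sgn (suc k) *_) (rec-+-suc n k))
               (solve 2 (λ s g → con (- 1ℚ) :* s :* g := :- (s :* g)) refl (sgn k) (rec (suc n ℕ.+ k)))) ⟩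
        ∑₁ (λ k → f (ℕ.pred k)) N
          ≡⟨ trans (∑₁-shift f N) (cong₂ (λ u v → - (1ℚ * rec (suc v)) + u - f N)
               (∑₁-neg (λ k → sgn k * rec (suc n ℕ.+ k)) N) (ℕ.+-identityʳ n)) ⟩
        - (1ℚ * rec (suc n)) + - K (suc n) - f N
          ≡⟨ solve 3 (λ x a y → :- (con 1ℚ :* x) :+ :- a :- :- y := :- x :+ :- a :+ y) refl
              (rec (suc n)) (K (suc n)) (sgn N * rec (suc n ℕ.+ N)) ⟩
        - rec (suc n) + - K (suc n) + sgn N * rec (suc n ℕ.+ N) ∎

    errK : ℕ → ℚ
    errK = ∑₁ λ i → sgn i * (sgn N * rec (i ℕ.+ N))

    -- With j = n + k the left side sums (-1)^j/j over n < j ≤ n + N; `errK` is the part beyond `N`.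
    K-closed : ∀ n → sgn n * K n ≡ lam - altHarmonic n + errK n
    K-closed zero    = solve 1 (λ l → con 1ℚ :* l := l :- con 0ℚ :+ con 0ℚ) refl lam
    K-closed (suc n) = begin
      sgn (suc n) * K (suc n)                ≡⟨ cong (sgn (suc n) *_) (K-suc n) ⟩
      sgn (suc n) * (- K n + y - x)
        ≡⟨ solve 4 (λ s u y x → con (- 1ℚ) :* s :* (:- u :+ y :- x) := s :* u :+ con (- 1ℚ) :* s :* y :- con (- 1ℚ) :* s :* x) refl
            (sgn n) (K n) y x ⟩
      sgn n * K n + sgn (suc n) * y - sgn (suc n) * x
        ≡⟨ cong (λ u → u + sgn (suc n) * y - sgn (suc n) * x) (K-closed n) ⟩
      lam - altHarmonic n + errK n + sgn (suc n) * y - sgn (suc n) * x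
        ≡⟨ solve 5 (λ l h e d b → l :- h :+ e :+ d :- b := l :- (h :+ b) :+ (e :+ d)) refl
            lam (altHarmonic n) (errK n) (sgn (suc n) * y) (sgn (suc n) * x) ⟩
      lam - altHarmonic (suc n) + errK (suc n) ∎
      where
      open ≡-Reasoning
      x = rec (suc n)
      y = sgn N * rec (suc n ℕ.+ N)

    -- Partial fractions with the coefficient `a` left free: it is (-1)^k for `J`, 1 for
    -- `∑-rec-sum`, and arbitrary in `∑-rec-sumʳ`.
    ∑-rec-rec : ∀ (a : ℕ → ℚ) m → ∑₁ (λ k → a k * (rec k * rec (suc m ℕ.+ k))) N ≡
      rec (suc m) * (∑₁ (λ k → a k * rec k) N - ∑₁ (λ k → a k * rec (suc m ℕ.+ k)) N)
    ∑-rec-rec a m = trans (∑₁-cong N λ k _ → pointwise k)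
      (trans (∑₁-*ˡ (rec (suc m)) _ N) (cong (rec (suc m) *_) (∑₁-- _ _ N)))
      where
      pointwise : ∀ k → a (suc k) * (rec (suc k) * rec (suc m ℕ.+ suc k)) ≡
        rec (suc m) * (a (suc k) * rec (suc k) - a (suc k) * rec (suc m ℕ.+ suc k))
      pointwise k = trans
        (solve 4 (λ a x y s → a :* (y :* s) := a :* (s :* x :+ s :* y) :- a :* (s :* x)) refl
          (a (suc k)) (rec (suc m)) (rec (suc k)) (rec (suc m ℕ.+ suc k)))
        (trans (cong (λ u → a (suc k) * u - a (suc k) * (rec (suc m ℕ.+ suc k) * rec (suc m))) (sym (sum-fraction m k)))
        (solve 4 (λ a x y s → a :* (x :* y) :- a :* (s :* x) := x :* (a :* y :- a :* s)) refl
          (a (suc k)) (rec (suc m)) (rec (suc k)) (rec (suc m ℕ.+ suc k))))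

    J-suc : ∀ n → J (suc n) ≡ rec (suc n) * (lam - K (suc n))
    J-suc = ∑-rec-rec sgn

    T : ℕ → ℚ
    T n = B n - A n

    T-suc : ∀ n → n ℕ.< N → T (suc n) ≡ - T n + J n + altH N * (rec (suc n ℕ.+ N) - gap n N) -
      (rec (suc n) * U (suc n) - rec (suc n) * lam + sgn (suc n) * (rec (suc n) * rec (suc n)))
    T-suc n n<N = trans (cong₂ _-_ (B-suc n) (A-suc n n<N))
      (solve 7 (λ a b w s g j r → :- b :+ w :* s :+ j :- (:- a :+ w :* g :+ r) := :- (b :- a) :+ j :+ w :* (s :- g) :- r) refl
        (A n) (B n) (altH N) (rec (suc n ℕ.+ N)) (gap n N) (J n)
        (rec (suc n) * U (suc n) - rec (suc n) * lam + sgn (suc n) * (rec (suc n) * rec (suc n))))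

    -- signedT 0 is chosen so that the recurrence below also holds at n = 0,
    -- although J 0 does not have the closed form of J (suc n).
    signedT : ℕ → ℚ
    signedT zero    = - altHarmonic² N
    signedT (suc n) = sgn (suc n) * T (suc n)

    T-zero : T 0 ≡ 0ℚ
    T-zero = ℚ.+-inverseʳ (B 0)

    signedT-suc : ∀ n → n ℕ.< N → signedT (suc n) ≡ signedT n - rec n * (sgn n * lam - sgn n * K n)
      + sgn (suc n) * (altH N * (rec (suc n ℕ.+ N) - gap n N))
      - (sgn (suc n) * (rec (suc n) * U (suc n)) - sgn (suc n) * (rec (suc n) * lam) + rec (suc n) * rec (suc n))
    signedT-suc zero 0<N = trans (cong (sgn 1 *_) (T-suc 0 0<N))
      (trans (cong₂ (λ t z → sgn 1 * (- t + altHarmonic² N + w - (xu - xl + sgn 1 * xx))) T-zero rec-zero)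
      (trans (solve 6 (λ j w a b c k → con (- 1ℚ) :* (:- con 0ℚ :+ j :+ w :- (a :- b :+ con (- 1ℚ) :* c))
          := :- j :- con 0ℚ :* k :+ con (- 1ℚ) :* w :- (con (- 1ℚ) :* a :- con (- 1ℚ) :* b :+ c)) refl
          (altHarmonic² N) w xu xl xx (1ℚ * lam - 1ℚ * K 0))
        (cong (λ z → - altHarmonic² N - z * (1ℚ * lam - 1ℚ * K 0) + sgn 1 * w - (sgn 1 * xu - sgn 1 * xl + xx)) (sym rec-zero))))
      where
      w  = altH N * (rec (1 ℕ.+ N) - gap 0 N)
      xu = rec 1 * U 1
      xl = rec 1 * lam
      xx = rec 1 * rec 1
    signedT-suc (suc n) n<N = trans (cong (sgn (suc (suc n)) *_) (T-suc (suc n) n<N))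
      (trans (cong (λ j → sgn (suc (suc n)) * (- T (suc n) + j + w - (xu - xl + sgn (suc (suc n)) * xx))) (J-suc n))
      (trans (solve 9 (λ s t x l k w a b c →
           con (- 1ℚ) :* s :* (:- t :+ x :* (l :- k) :+ w :- (a :- b :+ con (- 1ℚ) :* s :* c))
             := s :* t :- x :* (s :* l :- s :* k) :+ con (- 1ℚ) :* s :* w
                :- (con (- 1ℚ) :* s :* a :- con (- 1ℚ) :* s :* b :+ s :* s :* c)) refl
           (sgn (suc n)) (T (suc n)) (rec (suc n)) lam (K (suc n)) w xu xl xx)
        (cong (λ u → signedT (suc n) - rec (suc n) * (sgn (suc n) * lam - sgn (suc n) * K (suc n)) + sgn (suc (suc n)) * w
                - (sgn (suc (suc n)) * xu - sgn (suc (suc n)) * xl + u))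
          (trans (cong (_* xx) (sgn-sq (suc n))) (ℚ.*-identityˡ xx)))))
      where
      w  = altH N * (rec (suc (suc n) ℕ.+ N) - gap (suc n) N)
      xu = rec (suc (suc n)) * U (suc (suc n))
      xl = rec (suc (suc n)) * lam
      xx = rec (suc (suc n)) * rec (suc (suc n))

    -- `J` enters `T-suc` at the old index, hence `ℕ.pred` in the `errK` summand.
    errT : ℕ → ℚ
    errT = ∑₁ λ i → rec (ℕ.pred i) * errK (ℕ.pred i) + sgn i * (altH N * (rec (i ℕ.+ N) - gap (ℕ.pred i) N)) - rec i * errU i

    -- The contribution of `J` at each step cancels the terms in `lam` and `altHarmonic` that `U`
    -- left at the step before. Only those of the last step survive, while the squares 1/n²
    -- accumulate.
    signedT-closed : ∀ n → n ℕ.≤ N → signedT n ≡ - altHarmonic² N + lam * (sgn n * rec n - rec n) + rec n * altHarmonic n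
      - altHarmonic² n - harmonic² n + errT n
    signedT-closed zero    _   = trans
      (solve 2 (λ e l → :- e := :- e :+ l :* (con 1ℚ :* con 0ℚ :- con 0ℚ) :+ con 0ℚ :* con 0ℚ :- con 0ℚ :- con 0ℚ :+ con 0ℚ) refl
        (altHarmonic² N) lam)
      (cong (λ x → - altHarmonic² N + lam * (1ℚ * x - x) + x * 0ℚ - 0ℚ - 0ℚ + 0ℚ) (sym rec-zero))
    signedT-closed (suc n) n<N = begin
      signedT (suc n)                        ≡⟨ signedT-suc n n<N ⟩
      signedT n - x * (s * lam - s * K n) + w - (s′ * (x′ * U (suc n)) - s′ * (x′ * lam) + x′ * x′)
        ≡⟨ cong₂ (λ a b → signedT n - x * (s * lam - a) + w - (b - s′ * (x′ * lam) + x′ * x′)) (K-closed n)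
            (trans (solve 3 (λ s x u → s :* (x :* u) := x :* (s :* u)) refl s′ x′ (U (suc n))) (cong (x′ *_) (U-closed (suc n)))) ⟩
      signedT n - x * (s * lam - (lam - l + ek)) + w
        - (x′ * (lam - (l + s′ * x′) + s′ * x′ + eu) - s′ * (x′ * lam) + x′ * x′)
        ≡⟨ cong (λ t → t - x * (s * lam - (lam - l + ek)) + w
            - (x′ * (lam - (l + s′ * x′) + s′ * x′ + eu) - s′ * (x′ * lam) + x′ * x′)) (signedT-closed n (ℕ.<⇒≤ n<N)) ⟩
      - E + lam * (s * x - x) + x * l - l₂ - q + et - x * (s * lam - (lam - l + ek)) + w
        - (x′ * (lam - (l + s′ * x′) + s′ * x′ + eu) - s′ * (x′ * lam) + x′ * x′)
        ≡⟨ rearrange E lam s x l l₂ q et ek w x′ s′ eu ⟩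
      - E + lam * (s′ * x′ - x′) + x′ * (l + s′ * x′) - (l₂ + s′ * (x′ * x′)) - (q + x′ * x′) + (et + (x * ek + w - x′ * eu)) ∎
      where
      open ≡-Reasoning
      E  = altHarmonic² N
      s  = sgn n
      x  = rec n
      s′ = sgn (suc n)
      x′ = rec (suc n)
      l  = altHarmonic n
      l₂ = altHarmonic² n
      q  = harmonic² n
      et = errT n
      ek = errK n
      eu = errU (suc n)
      w  = sgn (suc n) * (altH N * (rec (suc n ℕ.+ N) - gap n N))
      rearrange : ∀ E lam s x l l₂ q et ek w x′ s′ eu →
        - E + lam * (s * x - x) + x * l - l₂ - q + et - x * (s * lam - (lam - l + ek)) + w
          - (x′ * (lam - (l + s′ * x′) + s′ * x′ + eu) - s′ * (x′ * lam) + x′ * x′) ≡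
        - E + lam * (s′ * x′ - x′) + x′ * (l + s′ * x′) - (l₂ + s′ * (x′ * x′)) - (q + x′ * x′) + (et + (x * ek + w - x′ * eu))
      rearrange = solve 13 (λ E lam s x l l₂ q et ek w x′ s′ eu →
        :- E :+ lam :* (s :* x :- x) :+ x :* l :- l₂ :- q :+ et :- x :* (s :* lam :- (lam :- l :+ ek)) :+ w
          :- (x′ :* (lam :- (l :+ s′ :* x′) :+ s′ :* x′ :+ eu) :- s′ :* (x′ :* lam) :+ x′ :* x′) :=
        :- E :+ lam :* (s′ :* x′ :- x′) :+ x′ :* (l :+ s′ :* x′) :- (l₂ :+ s′ :* (x′ :* x′)) :- (q :+ x′ :* x′)
          :+ (et :+ (x :* ek :+ w :- x′ :* eu))) refl

    errG : ℕ → ℚ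
    errG = ∑₁ λ i → gap (ℕ.pred i) N

    -- Again j = k - n: positive `j` give `harmonic N` without its top `n` terms `errG n`, and
    -- negative `j` subtract `harmonic n - rec n`.
    G-closed : ∀ n → G n ≡ harmonic N - harmonic n + rec n - errG n
    G-closed zero    = trans (solve 1 (λ h → h := h :- con 0ℚ :+ con 0ℚ :- con 0ℚ) refl (harmonic N))
      (cong (λ x → harmonic N - 0ℚ + x - 0ℚ) (sym rec-zero))
    G-closed (suc n) = begin
      G (suc n)
        ≡⟨ trans (∑₁-cong N λ k _ → refl) (∑₁-shift (gap n) N) ⟩
      gap n 0 + G n - gap n N
        ≡⟨ cong₂ (λ a b → a + b - gap n N) (gap-zeroʳ n) (G-closed n) ⟩
      - rec n + (harmonic N - harmonic n + rec n - errG n) - gap n N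
        ≡⟨ solve 6 (λ x h k e g y → :- x :+ (h :- k :+ x :- e) :- g := h :- (k :+ y) :+ y :- (e :+ g)) refl
            (rec n) (harmonic N) (harmonic n) (errG n) (gap n N) (rec (suc n)) ⟩
      harmonic N - harmonic (suc n) + rec (suc n) - errG (suc n) ∎
      where open ≡-Reasoning

    -- The divergent `harmonic N` cancels between the two partial fractions. One `rec (suc k)` in
    -- the bracket comes from `G-closed`, the other from the diagonal.
    ∑-rec-gap : ∀ k → k ℕ.< N → ∑₁ (λ n → rec n * gap (suc k) n) N ≡
      rec (suc k) * (rec (suc k) + rec (suc k) - harmonic (suc k) - errG (suc k))
    ∑-rec-gap k k<N = begin
      ∑₁ (λ n → rec n * gap (suc k) n) N
        ≡⟨ ∑₁-cong N (λ n _ → trans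
            (solve 4 (λ g x y d → y :* g := (g :* y :+ x :* y :- d :* (x :* x)) :- x :* y :+ d :* (x :* x)) refl
              (gap k n) x (rec (suc n)) (δ k n))
            (cong (λ u → u - x * rec (suc n) + δ k n * (x * x))
              (trans (sym (gap-fraction k n)) (ℚ.*-comm (gap k n) x)))) ⟩
      ∑₁ (λ n → (x * gap (suc k) n - x * rec n) + δ (suc k) n * (x * x)) N
        ≡⟨ trans (∑₁-+ _ _ N) (cong₂ _+_ (trans (∑₁-- _ _ N) (cong₂ _-_ (∑₁-*ˡ x _ N) (∑₁-*ˡ x _ N)))
             (∑₁-δ (λ _ → x * x) k N k<N)) ⟩
      x * G (suc k) - x * harmonic N + x * x
        ≡⟨ cong (λ g → x * g - x * harmonic N + x * x) (G-closed (suc k)) ⟩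
      x * (harmonic N - harmonic (suc k) + x - errG (suc k)) - x * harmonic N + x * x
        ≡⟨ solve 4 (λ x h k e → x :* (h :- k :+ x :- e) :- x :* h :+ x :* x := x :* (x :+ x :- k :- e)) refl
            x (harmonic N) (harmonic (suc k)) (errG (suc k)) ⟩
      x * (x + x - harmonic (suc k) - errG (suc k)) ∎
      where
      open ≡-Reasoning
      x = rec (suc k)

    errC : ℕ → ℚ
    errC = ∑₁ λ i → rec (i ℕ.+ N)

    C-closed : ∀ n → C n ≡ harmonic N - harmonic n + errC n
    C-closed zero    = solve 1 (λ h → h := h :- con 0ℚ :+ con 0ℚ) refl (harmonic N)
    C-closed (suc n) = begin
      C (suc n)
        ≡⟨ solve 3 (λ c x y → c := (x :+ c :- y) :- x :+ y) refl (C (suc n)) (rec (suc n)) (rec (suc n ℕ.+ N)) ⟩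
      rec (suc n) + C (suc n) - rec (suc n ℕ.+ N) - rec (suc n) + rec (suc n ℕ.+ N)
        ≡⟨ cong (λ u → u - rec (suc n) + rec (suc n ℕ.+ N)) (sym backwards) ⟩
      C n - rec (suc n) + rec (suc n ℕ.+ N)
        ≡⟨ cong (λ u → u - rec (suc n) + rec (suc n ℕ.+ N)) (C-closed n) ⟩
      harmonic N - harmonic n + errC n - rec (suc n) + rec (suc n ℕ.+ N)
        ≡⟨ solve 5 (λ h k e x y → h :- k :+ e :- x :+ y := h :- (k :+ x) :+ (e :+ y)) refl
            (harmonic N) (harmonic n) (errC n) (rec (suc n)) (rec (suc n ℕ.+ N)) ⟩
      harmonic N - harmonic (suc n) + errC (suc n) ∎
      where
      open ≡-Reasoning
      f : ℕ → ℚ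
      f k = rec (suc n ℕ.+ k)
      backwards : C n ≡ rec (suc n) + C (suc n) - rec (suc n ℕ.+ N)
      backwards = trans (∑₁-cong N λ k _ → rec-+-suc n k) (trans (∑₁-shift f N)
        (cong (λ m → rec (suc m) + C (suc n) - rec (suc n ℕ.+ N)) (ℕ.+-identityʳ n)))

    -- Truncated form of the classical evaluation of the sum of 1/(n (n + k)) as H_k/k; `harmonic N`
    -- cancels here too.
    ∑-rec-sum : ∀ k → ∑₁ (λ n → rec n * rec (suc k ℕ.+ n)) N ≡ rec (suc k) * (harmonic (suc k) - errC (suc k))
    ∑-rec-sum k = begin
      ∑₁ (λ n → rec n * rec (suc k ℕ.+ n)) N
        ≡⟨ ∑₁-cong N (λ n _ → sym (ℚ.*-identityˡ _)) ⟩
      ∑₁ (λ n → 1ℚ * (rec n * rec (suc k ℕ.+ n))) N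
        ≡⟨ ∑-rec-rec (λ _ → 1ℚ) k ⟩
      x * (∑₁ (λ n → 1ℚ * rec n) N - ∑₁ (λ n → 1ℚ * rec (suc k ℕ.+ n)) N)
        ≡⟨ cong₂ (λ a b → x * (a - b)) (∑₁-cong N λ n _ → ℚ.*-identityˡ _)
            (trans (∑₁-cong N λ n _ → ℚ.*-identityˡ _) (C-closed (suc k))) ⟩
      x * (harmonic N - (harmonic N - harmonic (suc k) + errC (suc k)))
        ≡⟨ solve 4 (λ x h k e → x :* (h :- (h :- k :+ e)) := x :* (k :- e)) refl x (harmonic N) (harmonic (suc k)) (errC (suc k)) ⟩
      x * (harmonic (suc k) - errC (suc k)) ∎
      where
      open ≡-Reasoning
      x = rec (suc k)

  -- Expansion of the products of truncated series.

  -- Listing coefficients with their summands makes linearity over many terms a single induction.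
  -- The nested sums ending in `0ℚ` below are the unfolded form of this fold.
  combination : List (ℚ × (ℕ → ℚ)) → ℕ → ℚ
  combination ts n = foldr (λ t s → proj₁ t * proj₂ t n + s) 0ℚ ts

  ∑₁-combination : ∀ N ts → ∑₁ (combination ts) N ≡ foldr (λ t s → proj₁ t * ∑₁ (proj₂ t) N + s) 0ℚ ts
  ∑₁-combination N []             = ∑₁-0 N
  ∑₁-combination N ((c , f) ∷ ts) = trans (∑₁-+ (λ n → c * f n) (combination ts) N)
    (cong₂ _+_ (∑₁-*ˡ c f N) (∑₁-combination N ts))

  -- The base `u` is free because it is taken to be 1/k as well as -1/k, the second absorbing an
  -- alternating sign in the exponent.
  ∑₀-homogeneous : ∀ N (u v a b : ℕ → ℚ) m →
    ∑₀ (λ i → ∑₁ (λ k → a k * u k ^ suc i) N * ∑₁ (λ n → b n * v n ^ (m ℕ.∸ i)) N) m ≡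
    ∑₁ (λ k → a k * ∑₁ (λ n → b n * homogeneous (u k) (v n) m) N) N
  ∑₀-homogeneous N u v a b m = begin
    ∑₀ (λ i → ∑₁ (λ k → a k * u k ^ suc i) N * ∑₁ (λ n → b n * v n ^ (m ℕ.∸ i)) N) m
      ≡⟨ ∑₀-cong m (λ i _ → ∑₁-*-∑₁ _ _ N N) ⟩
    ∑₀ (λ i → ∑₁ (λ k → ∑₁ (λ n → a k * u k ^ suc i * (b n * v n ^ (m ℕ.∸ i))) N) N) m
      ≡⟨ ∑₀-∑₁ _ m N ⟩
    ∑₁ (λ k → ∑₀ (λ i → ∑₁ (λ n → a k * u k ^ suc i * (b n * v n ^ (m ℕ.∸ i))) N) m) N
      ≡⟨ ∑₁-cong N (λ k _ → trans (∑₀-∑₁ _ m N) (trans (∑₁-cong N λ n _ → inner (suc k) (suc n))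
           (∑₁-*ˡ (a (suc k)) _ N))) ⟩
    ∑₁ (λ k → a k * ∑₁ (λ n → b n * homogeneous (u k) (v n) m) N) N ∎
    where
    open ≡-Reasoning
    inner : ∀ k n → ∑₀ (λ i → a k * u k ^ suc i * (b n * v n ^ (m ℕ.∸ i))) m ≡ a k * (b n * homogeneous (u k) (v n) m)
    inner k n = trans
      (∑₀-cong m λ i _ → solve 4 (λ a u b v → a :* u :* (b :* v) := a :* b :* (u :* v)) refl
        (a k) (u k ^ suc i) (b n) (v n ^ (m ℕ.∸ i)))
      (trans (∑₀-*ˡ (a k * b n) _ m) (ℚ.*-assoc (a k) (b n) _))

  -- The two powers in `homogeneous-gap` are separated, and the second part has its summations
  -- swapped, so that the power always sits on the outer index and the inner sum pairs one
  -- coefficient with the kernel. The last sum is the diagonal.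
  double-sum-gap : ∀ N (a b : ℕ → ℚ) m →
    ∑₁ (λ k → a k * ∑₁ (λ n → b n * homogeneous (rec k) (rec n) m) N) N ≡
    ∑₁ (λ k → a k * rec k ^ m * ∑₁ (λ n → b n * gap k n) N) N
      - ∑₁ (λ n → b n * rec n ^ m * ∑₁ (λ k → a k * gap k n) N) N
      + ∑₁ (λ k → fromℕ m * (a k * b k * rec k ^ suc m)) N
  double-sum-gap N a b m = begin
    ∑₁ (λ k → a k * ∑₁ (λ n → b n * homogeneous (rec k) (rec n) m) N) N
      ≡⟨ ∑₁-cong N (λ k k<N → row k k<N) ⟩
    ∑₁ (λ k → a k * rec k ^ m * ∑₁ (λ n → b n * gap k n) N
         - ∑₁ (λ n → b n * rec n ^ m * (a k * gap k n)) N + fromℕ m * (a k * b k * rec k ^ suc m)) N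
      ≡⟨ trans (∑₁-+ _ _ N) (cong (_+ ∑₁ (λ k → fromℕ m * (a k * b k * rec k ^ suc m)) N) (trans (∑₁-- _ _ N)
           (cong (λ u → ∑₁ (λ k → a k * rec k ^ m * ∑₁ (λ n → b n * gap k n) N) N - u)
             (trans (∑₁-swap _ N N) (∑₁-cong N λ n _ → ∑₁-*ˡ (b (suc n) * rec (suc n) ^ m) _ N))))) ⟩
    ∑₁ (λ k → a k * rec k ^ m * ∑₁ (λ n → b n * gap k n) N) N
      - ∑₁ (λ n → b n * rec n ^ m * ∑₁ (λ k → a k * gap k n) N) N
      + ∑₁ (λ k → fromℕ m * (a k * b k * rec k ^ suc m)) N ∎
    where
    open ≡-Reasoning
    row : ∀ k → k ℕ.< N → a (suc k) * ∑₁ (λ n → b n * homogeneous (rec (suc k)) (rec n) m) N ≡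
      a (suc k) * rec (suc k) ^ m * ∑₁ (λ n → b n * gap (suc k) n) N
        - ∑₁ (λ n → b n * rec n ^ m * (a (suc k) * gap (suc k) n)) N
        + fromℕ m * (a (suc k) * b (suc k) * rec (suc k) ^ suc m)
    row k k<N = trans (sym (∑₁-*ˡ α _ N)) (trans (∑₁-cong N λ n _ →
        trans (cong (λ h → α * (b (suc n) * h)) (homogeneous-gap k n m))
          (solve 8 (λ α b g X Y d M X′ → α :* (b :* (g :* (X :- Y) :+ d :* (M :* X′))) :=
              α :* X :* (b :* g) :- b :* Y :* (α :* g) :+ d :* (M :* (α :* b :* X′))) refl
            α (b (suc n)) (gap k n) (rec (suc k) ^ m) (rec (suc n) ^ m) (δ k n) (fromℕ m) (rec (suc k) ^ suc m)))
      (trans (∑₁-+ (λ n → α * rec (suc k) ^ m * (b n * gap (suc k) n) - b n * rec n ^ m * (α * gap (suc k) n))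
                   (λ n → δ (suc k) n * (fromℕ m * (α * b n * rec (suc k) ^ suc m))) N)
        (cong₂ _+_ (trans (∑₁-- _ _ N) (cong (_- ∑₁ (λ n → b n * rec n ^ m * (α * gap (suc k) n)) N) (∑₁-*ˡ (α * rec (suc k) ^ m) _ N)))
          (∑₁-δ (λ n → fromℕ m * (α * b n * rec (suc k) ^ suc m)) k N k<N))))
      where α = a (suc k)

  double-sum-sum : ∀ N (a b : ℕ → ℚ) m →
    ∑₁ (λ k → a k * ∑₁ (λ n → b n * homogeneous (- rec k) (rec n) m) N) N ≡
    ∑₁ (λ k → sgn m * (a k * rec k ^ m * ∑₁ (λ n → b n * rec (k ℕ.+ n)) N)) N
      - ∑₁ (λ n → b n * rec n ^ m * ∑₁ (λ k → a k * rec (k ℕ.+ n)) N) N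
  double-sum-sum N a b m = trans (∑₁-cong N λ k _ → row k)
    (trans (∑₁-- _ (λ k → ∑₁ (entry k) N) N) (cong (λ u → ∑₁ (λ k → sgn m * (a k * rec k ^ m * ∑₁ (λ n → b n * rec (k ℕ.+ n)) N)) N - u)
      (trans (∑₁-swap entry N N) (∑₁-cong N λ n _ → ∑₁-*ˡ (b (suc n) * rec (suc n) ^ m) _ N))))
    where
    entry : ℕ → ℕ → ℚ
    entry k n = b n * rec n ^ m * (a k * rec (k ℕ.+ n))
    row : ∀ k → a (suc k) * ∑₁ (λ n → b n * homogeneous (- rec (suc k)) (rec n) m) N ≡
      sgn m * (a (suc k) * rec (suc k) ^ m * ∑₁ (λ n → b n * rec (suc k ℕ.+ n)) N)
        - ∑₁ (λ n → b n * rec n ^ m * (a (suc k) * rec (suc k ℕ.+ n))) N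
    row k = trans (sym (∑₁-*ˡ α _ N)) (trans (∑₁-cong N λ n _ →
        trans (cong (λ h → α * (b (suc n) * h)) (homogeneous-sum k n m))
          (solve 6 (λ α b g X Y s → α :* (b :* (g :* (s :* X :- Y))) :=
              s :* (α :* X) :* (b :* g) :- b :* Y :* (α :* g)) refl
            α (b (suc n)) (rec (suc k ℕ.+ suc n)) (rec (suc k) ^ m) (rec (suc n) ^ m) (sgn m)))
      (trans (∑₁-- (λ n → sgn m * (α * rec (suc k) ^ m) * (b n * rec (suc k ℕ.+ n)))
                   (λ n → b n * rec n ^ m * (α * rec (suc k ℕ.+ n))) N)
        (cong (_- ∑₁ (λ n → b n * rec n ^ m * (α * rec (suc k ℕ.+ n))) N)
          (trans (∑₁-*ˡ (sgn m * (α * rec (suc k) ^ m)) _ N) (ℚ.*-assoc (sgn m) (α * rec (suc k) ^ m) _)))))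
      where α = a (suc k)

  module Identities (N p : ℕ) where
    open Truncated N

    ⟨_⟩ : (ℕ → ℚ) → ℚ
    ⟨ f ⟩ = ∑₁ f N

    -- The parameter `p` is one less than that of the theorem, so `x^p+2` carries its exponent p +
    -- 1.
    x^p x^p+1 x^p+2 x^p+3 : ℕ → ℚ
    x^p   n = rec n ^ p
    x^p+1 n = rec n ^ (1 ℕ.+ p)
    x^p+2 n = rec n ^ (2 ℕ.+ p)
    x^p+3 n = rec n ^ (3 ℕ.+ p)

    -- `c₂₂` belongs to a zeta-star value with second argument barred 2, which is absent from the
    -- theorem; it cancels between `identity₁` and `identity₂`.
    A² B² CL DH hH hL gL c₂ c₂₂ : ℕ → ℚ
    A² n  = sgn n * x^p+2 n * (altHarmonic n * altHarmonic n)
    B² n  = sgn n * x^p+2 n * (harmonic n * harmonic n)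
    CL n  = sgn n * x^p+2 n * altHarmonic n
    DH n  = sgn n * x^p+2 n * harmonic n
    hH n  = sgn n * x^p+3 n * harmonic n
    hL n  = sgn n * x^p+3 n * altHarmonic n
    gL n  = x^p+3 n * altHarmonic n
    c₂ n  = sgn n * x^p+2 n * harmonic² n
    c₂₂ n = sgn n * x^p+2 n * altHarmonic² n

    sgn-^ : ℕ → ℕ → ℚ
    sgn-^ s n = sgn n * rec n ^ s

    -- The sum of `rec k * c k` is kept symbolic. It cancels against `Y 0` in `identity₁`, and
    -- between the two kernels in `identity₂`.
    ∑-rec-gapʳ : ∀ (c : ℕ → ℚ) n → n ℕ.< N → ⟨ (λ k → rec k * c k * gap k (suc n)) ⟩ ≡
      rec (suc n) * (⟨ (λ k → rec k * c k) ⟩ - ⟨ (λ k → c k * gap (suc n) k) ⟩ - c (suc n) * rec (suc n))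
    ∑-rec-gapʳ c n n<N = begin
      ⟨ (λ k → rec k * c k * gap k (suc n)) ⟩
        ≡⟨ ∑₁-cong N (λ k _ → pointwise k) ⟩
      ⟨ (λ k → y * (rec k * c k) - y * (c k * gap (suc n) k) - δ (suc n) k * (c k * (rec k * rec k))) ⟩
        ≡⟨ trans (∑₁-- _ _ N) (cong₂ _-_ (trans (∑₁-- _ _ N) (cong₂ _-_ (∑₁-*ˡ y _ N) (∑₁-*ˡ y _ N)))
             (∑₁-δ (λ k → c k * (rec k * rec k)) n N n<N)) ⟩
      y * ⟨ (λ k → rec k * c k) ⟩ - y * ⟨ (λ k → c k * gap (suc n) k) ⟩ - c (suc n) * (y * y)
        ≡⟨ solve 4 (λ y a b c → y :* a :- y :* b :- c :* (y :* y) := y :* (a :- b :- c :* y)) refl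
             y ⟨ (λ k → rec k * c k) ⟩ ⟨ (λ k → c k * gap (suc n) k) ⟩ (c (suc n)) ⟩
      y * (⟨ (λ k → rec k * c k) ⟩ - ⟨ (λ k → c k * gap (suc n) k) ⟩ - c (suc n) * y) ∎
      where
      open ≡-Reasoning
      y = rec (suc n)
      pointwise : ∀ k → rec (suc k) * c (suc k) * gap k n ≡
        y * (rec (suc k) * c (suc k)) - y * (c (suc k) * gap n k) - δ n k * (c (suc k) * (rec (suc k) * rec (suc k)))
      pointwise k = trans (solve 3 (λ x c g → x :* c :* g := c :* (g :* x)) refl (rec (suc k)) (c (suc k)) (gap k n))
        (trans (cong (c (suc k) *_) (trans (gap-fraction k n)
            (cong₂ (λ g d → g * y + rec (suc k) * y - d * (rec (suc k) * rec (suc k))) (gap-antisym k n) (δ-sym k n))))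
          (solve 5 (λ x c g y d → c :* (:- g :* y :+ x :* y :- d :* (x :* x)) := y :* (x :* c) :- y :* (c :* g) :- d :* (c :* (x :* x))) refl
            (rec (suc k)) (c (suc k)) (gap n k) y (δ n k)))

    ∑-rec-sumʳ : ∀ (c : ℕ → ℚ) n → ⟨ (λ k → rec k * c k * rec (k ℕ.+ suc n)) ⟩ ≡
      rec (suc n) * (⟨ (λ k → rec k * c k) ⟩ - ⟨ (λ k → c k * rec (suc n ℕ.+ k)) ⟩)
    ∑-rec-sumʳ c n = trans
      (∑₁-cong N λ k _ → trans (solve 3 (λ x c s → x :* c :* s := c :* (x :* s)) refl (rec (suc k)) (c (suc k)) (rec (suc k ℕ.+ suc n)))
        (cong (λ j → c (suc k) * (rec (suc k) * rec j)) (ℕ.+-comm (suc k) (suc n))))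
      (trans (∑-rec-rec c n) (cong (λ u → rec (suc n) * (u - ⟨ (λ k → c k * rec (suc n ℕ.+ k)) ⟩))
        (∑₁-cong N λ k _ → ℚ.*-comm (c (suc k)) (rec (suc k)))))

    by-sgn : ∀ n u v → sgn n * u ≡ v → u ≡ sgn n * v
    by-sgn n u v h = trans (trans (sym (ℚ.*-identityˡ u)) (cong (_* u) (sym (sgn-sq n))))
      (trans (ℚ.*-assoc (sgn n) (sgn n) u) (cong (sgn n *_) h))

    -- Grouped in the shape that `Tiny⇒Null` expects; the innermost `rec n` is the averaging weight
    -- of `Tiny-∑`.
    err₁ : ℕ → ℚ
    err₁ n = rec n * (sgn n * x^p n * (altHarmonic n * (rec n * errU n) + rec n * errY n))

    -- Concerns the products of ζ⋆(j, barred 1) with ζ̄. One factor 1/k is moved into `a`, leaving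
    -- the exponents of `homogeneous` for `suc p`. The alternating factor goes down to exponent 1,
    -- so no power of 1/n can be split off as well.
    identity₁ : ∑₀ (λ i → ⟨ (λ n → rec n ^ (2 ℕ.+ i) * altHarmonic n) ⟩ * ⟨ sgn-^ (suc p ℕ.∸ i) ⟩) (suc p) ≡
      (1ℚ + 1ℚ) * (lam * ⟨ CL ⟩) - (1ℚ + ½) * ⟨ A² ⟩ + ⟨ gL ⟩ - lam * ⟨ DH ⟩ + ⟨ c₂₂ ⟩ + ½ * ⟨ c₂ ⟩
        + (fromℕ (suc p) + 1ℚ) * ⟨ hL ⟩ + ⟨ err₁ ⟩
    identity₁ = begin
      ∑₀ (λ i → ⟨ (λ n → rec n ^ (2 ℕ.+ i) * altHarmonic n) ⟩ * ⟨ sgn-^ (suc p ℕ.∸ i) ⟩) (suc p)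
        ≡⟨ ∑₀-cong (suc p) (λ i _ → cong (_* ⟨ sgn-^ (suc p ℕ.∸ i) ⟩) (∑₁-cong N λ k _ →
             solve 3 (λ x X l → x :* X :* l := x :* l :* X) refl (rec (suc k)) (rec (suc k) ^ suc i) (altHarmonic (suc k)))) ⟩
      ∑₀ (λ i → ⟨ (λ k → a k * rec k ^ suc i) ⟩ * ⟨ (λ n → sgn n * rec n ^ (suc p ℕ.∸ i)) ⟩) (suc p)
        ≡⟨ trans (∑₀-homogeneous N rec rec a sgn (suc p)) (double-sum-gap N a sgn (suc p)) ⟩
      ⟨ (λ k → a k * x^p+1 k * U k) ⟩ - ⟨ (λ n → sgn n * x^p+1 n * ⟨ (λ k → a k * gap k n) ⟩) ⟩
        + ⟨ (λ k → fromℕ (suc p) * (a k * sgn k * x^p+2 k)) ⟩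
        ≡⟨ trans (cong (_+ ⟨ (λ k → fromℕ (suc p) * (a k * sgn k * x^p+2 k)) ⟩) (sym (∑₁-- _ _ N))) (sym (∑₁-+ _ _ N)) ⟩
      ⟨ (λ n → a n * x^p+1 n * U n - sgn n * x^p+1 n * ⟨ (λ k → a k * gap k n) ⟩ + fromℕ (suc p) * (a n * sgn n * x^p+2 n)) ⟩
        ≡⟨ ∑₁-cong N pointwise ⟩
      ⟨ combination terms ⟩
        ≡⟨ ∑₁-combination N terms ⟩
      (1ℚ + 1ℚ) * lam * ⟨ CL ⟩ + (- (1ℚ + ½) * ⟨ A² ⟩ + (1ℚ * ⟨ gL ⟩ + (- lam * ⟨ DH ⟩ + (1ℚ * ⟨ c₂₂ ⟩ +
        (½ * ⟨ c₂ ⟩ + ((fromℕ (suc p) + 1ℚ) * ⟨ hL ⟩ + (1ℚ * ⟨ err₁ ⟩ + 0ℚ)))))))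
        ≡⟨ solve 10 (λ l C A g D c d P h e →
             (con 1ℚ :+ con 1ℚ) :* l :* C :+ (:- (con 1ℚ :+ con ½) :* A :+ (con 1ℚ :* g :+ (:- l :* D :+ (con 1ℚ :* c :+
               (con ½ :* d :+ ((P :+ con 1ℚ) :* h :+ (con 1ℚ :* e :+ con 0ℚ))))))) :=
             (con 1ℚ :+ con 1ℚ) :* (l :* C) :- (con 1ℚ :+ con ½) :* A :+ g :- l :* D :+ c :+ con ½ :* d :+ (P :+ con 1ℚ) :* h :+ e) refl
             lam ⟨ CL ⟩ ⟨ A² ⟩ ⟨ gL ⟩ ⟨ DH ⟩ ⟨ c₂₂ ⟩ ⟨ c₂ ⟩ (fromℕ (suc p)) ⟨ hL ⟩ ⟨ err₁ ⟩ ⟩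
      (1ℚ + 1ℚ) * (lam * ⟨ CL ⟩) - (1ℚ + ½) * ⟨ A² ⟩ + ⟨ gL ⟩ - lam * ⟨ DH ⟩ + ⟨ c₂₂ ⟩ + ½ * ⟨ c₂ ⟩
        + (fromℕ (suc p) + 1ℚ) * ⟨ hL ⟩ + ⟨ err₁ ⟩ ∎
      where
      open ≡-Reasoning
      a : ℕ → ℚ
      a k = rec k * altHarmonic k
      terms : List (ℚ × (ℕ → ℚ))
      terms = ((1ℚ + 1ℚ) * lam , CL) ∷ (- (1ℚ + ½) , A²) ∷ (1ℚ , gL) ∷ (- lam , DH) ∷ (1ℚ , c₂₂) ∷
        (½ , c₂) ∷ (fromℕ (suc p) + 1ℚ , hL) ∷ (1ℚ , err₁) ∷ []
      -- `Z` cancels here. The solver leaves `s * s` only as the coefficient of the `gL` term, where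
      -- `ss≡1` then replaces it.
      rearrange : ∀ s x X l h h₂ l₂ lam eu ey P Z → s * s ≡ 1ℚ →
        x * l * (x * X) * (s * (lam - l + s * x + eu))
          - s * (x * X) * (x * (Z - (Z - lam * h + l₂ + lam * l - ½ * (l * l - h₂) + ey) - l * x))
          + P * (x * l * s * (x * (x * X))) ≡
        (1ℚ + 1ℚ) * lam * (s * (x * (x * X)) * l) + (- (1ℚ + ½) * (s * (x * (x * X)) * (l * l)) + (1ℚ * (x * (x * (x * X)) * l)
          + (- lam * (s * (x * (x * X)) * h) + (1ℚ * (s * (x * (x * X)) * l₂) + (½ * (s * (x * (x * X)) * h₂)
          + ((P + 1ℚ) * (s * (x * (x * (x * X))) * l) + (1ℚ * (x * (s * X * (l * (x * eu) + x * ey))) + 0ℚ)))))))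
      rearrange s x X l h h₂ l₂ lam eu ey P Z ss≡1 = trans
        (solve 12 (λ s x X l h h₂ l₂ lam eu ey P Z →
          x :* l :* (x :* X) :* (s :* (lam :- l :+ s :* x :+ eu))
            :- s :* (x :* X) :* (x :* (Z :- (Z :- lam :* h :+ l₂ :+ lam :* l :- con ½ :* (l :* l :- h₂) :+ ey) :- l :* x))
            :+ P :* (x :* l :* s :* (x :* (x :* X))) :=
          (con 1ℚ :+ con 1ℚ) :* lam :* (s :* (x :* (x :* X)) :* l) :+ (:- (con 1ℚ :+ con ½) :* (s :* (x :* (x :* X)) :* (l :* l)) :+ (s :* s :* (x :* (x :* (x :* X)) :* l)
            :+ (:- lam :* (s :* (x :* (x :* X)) :* h) :+ (con 1ℚ :* (s :* (x :* (x :* X)) :* l₂) :+ (con ½ :* (s :* (x :* (x :* X)) :* h₂)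
            :+ ((P :+ con 1ℚ) :* (s :* (x :* (x :* (x :* X))) :* l) :+ (con 1ℚ :* (x :* (s :* X :* (l :* (x :* eu) :+ x :* ey))) :+ con 0ℚ))))))))
          refl s x X l h h₂ l₂ lam eu ey P Z)
        (cong (λ t → (1ℚ + 1ℚ) * lam * (s * (x * (x * X)) * l) + (- (1ℚ + ½) * (s * (x * (x * X)) * (l * l)) + (t * (x * (x * (x * X)) * l)
          + (- lam * (s * (x * (x * X)) * h) + (1ℚ * (s * (x * (x * X)) * l₂) + (½ * (s * (x * (x * X)) * h₂)
          + ((P + 1ℚ) * (s * (x * (x * (x * X))) * l) + (1ℚ * (x * (s * X * (l * (x * eu) + x * ey))) + 0ℚ))))))))
          ss≡1)
      pointwise : ∀ n → n ℕ.< N → _ ≡ combination terms (suc n)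
      pointwise n n<N = trans
        (cong₂ (λ u v → a (suc n) * x^p+1 (suc n) * u - sgn (suc n) * x^p+1 (suc n) * v + fromℕ (suc p) * (a (suc n) * sgn (suc n) * x^p+2 (suc n)))
          (by-sgn (suc n) (U (suc n)) _ (U-closed (suc n)))
          (trans (∑-rec-gapʳ altHarmonic n n<N)
            (cong (λ y → rec (suc n) * (⟨ (λ k → rec k * altHarmonic k) ⟩ - y - altHarmonic (suc n) * rec (suc n)))
              (Y-closed (suc n) n<N))))
        (rearrange (sgn (suc n)) (rec (suc n)) (rec (suc n) ^ p) (altHarmonic (suc n)) (harmonic (suc n)) (harmonic² (suc n))
          (altHarmonic² (suc n)) lam (errU (suc n)) (errY (suc n)) (fromℕ (suc p)) ⟨ (λ k → rec k * altHarmonic k) ⟩ (sgn-sq (suc n)))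

  -- The two product sums containing ζ

  module Identities₂ (N p : ℕ) where
    open Truncated N
    open Identities N p

    ∑-^-suc : ∀ i → i ℕ.≤ p → ⟨ (λ n → rec n ^ (suc p ℕ.∸ i)) ⟩ ≡ ⟨ (λ n → rec n * rec n ^ (p ℕ.∸ i)) ⟩
    ∑-^-suc i i≤p = ∑₁-cong N λ n _ → ^-∸-suc (rec (suc n)) i≤p

    -- Moving the sign into the base is what replaces the kernel 1/(n - k) by 1/(n + k).
    sgn-*-∑ : ∀ (a : ℕ → ℚ) i → sgn i * ⟨ (λ k → a k * rec k ^ i) ⟩ ≡ ⟨ (λ k → a k * (- rec k) ^ i) ⟩
    sgn-*-∑ a i = trans (sym (∑₁-*ˡ (sgn i) (λ k → a k * rec k ^ i) N)) (∑₁-cong N λ k _ →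
      trans (solve 3 (λ s a X → s :* (a :* X) := a :* (s :* X)) refl (sgn i) (a (suc k)) (rec (suc k) ^ i))
        (cong (a (suc k) *_) (sym (^-neg (rec (suc k)) i))))

    err₂ : ℕ → ℚ
    err₂ n = rec n * (sgn n * x^p n * (rec n * (sgn p * (harmonic n * errC n) - harmonic n * errG n - errT n)))

    -- The coefficient 1 - (-1)^(i + 1) splits the sum into one geometric sum for each kernel. Every
    -- ζ factor has exponent at least 2, so 1/n is split off too, and `homogeneous` is needed only
    -- for exponent `p`.
    identity₂ : ∑₀ (λ i → (1ℚ - sgn (suc i)) * (⟨ (λ n → sgn n * rec n ^ (2 ℕ.+ i) * harmonic n) ⟩ * ⟨ (λ n → rec n ^ (suc p ℕ.∸ i)) ⟩)) p ≡
      (fromℕ p + fromℕ 3) * ⟨ hH ⟩ - (1ℚ + sgn p) * ⟨ B² ⟩ + altHarmonic² N * ⟨ sgn-^ (2 ℕ.+ p) ⟩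
        - lam * (⟨ x^p+3 ⟩ - ⟨ sgn-^ (3 ℕ.+ p) ⟩) - ⟨ hL ⟩ + ⟨ c₂₂ ⟩ + ⟨ c₂ ⟩ + ⟨ err₂ ⟩
    identity₂ = begin
      ∑₀ (λ i → (1ℚ - sgn (suc i)) * (⟨ (λ n → sgn n * rec n ^ (2 ℕ.+ i) * harmonic n) ⟩ * ⟨ (λ n → rec n ^ (suc p ℕ.∸ i)) ⟩)) p
        ≡⟨ ∑₀-cong p split ⟩
      ∑₀ (λ i → F i + - 1ℚ * F⁻ i) p
        ≡⟨ trans (∑₀-+ F (λ i → - 1ℚ * F⁻ i) p) (cong (λ u → ∑₀ F p + u) (∑₀-*ˡ (- 1ℚ) F⁻ p)) ⟩
      ∑₀ F p + - 1ℚ * ∑₀ F⁻ p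
        ≡⟨ cong₂ (λ u v → u + - 1ℚ * v)
             (trans (∑₀-homogeneous N rec rec a rec p) (double-sum-gap N a rec p))
             (trans (∑₀-homogeneous N (λ k → - rec k) rec a rec p) (double-sum-sum N a rec p)) ⟩
      ⟨ s₁ ⟩ - ⟨ s₂ ⟩ + ⟨ s₃ ⟩ + - 1ℚ * (⟨ s₄ ⟩ - ⟨ s₅ ⟩)
        ≡⟨ cong₂ (λ u v → u + ⟨ s₃ ⟩ + v) (sym (∑₁-- s₁ s₂ N))
             (trans (cong (- 1ℚ *_) (sym (∑₁-- s₄ s₅ N))) (sym (∑₁-*ˡ (- 1ℚ) _ N))) ⟩
      ⟨ (λ n → s₁ n - s₂ n) ⟩ + ⟨ s₃ ⟩ + ⟨ (λ n → - 1ℚ * (s₄ n - s₅ n)) ⟩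
        ≡⟨ trans (cong (_+ ⟨ (λ n → - 1ℚ * (s₄ n - s₅ n)) ⟩) (sym (∑₁-+ _ _ N))) (sym (∑₁-+ _ _ N)) ⟩
      ⟨ (λ n → s₁ n - s₂ n + s₃ n + - 1ℚ * (s₄ n - s₅ n)) ⟩
        ≡⟨ ∑₁-cong N pointwise ⟩
      ⟨ combination terms ⟩
        ≡⟨ ∑₁-combination N terms ⟩
      (fromℕ p + fromℕ 3) * ⟨ hH ⟩ + (- (1ℚ + sgn p) * ⟨ B² ⟩ + (E * ⟨ sgn-^ (2 ℕ.+ p) ⟩ + (- lam * ⟨ x^p+3 ⟩
        + (lam * ⟨ sgn-^ (3 ℕ.+ p) ⟩ + (- 1ℚ * ⟨ hL ⟩ + (1ℚ * ⟨ c₂₂ ⟩ + (1ℚ * ⟨ c₂ ⟩ + (1ℚ * ⟨ err₂ ⟩ + 0ℚ))))))))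
        ≡⟨ solve 13 (λ P h s b E e l x f H c d r →
            (P :+ con (fromℕ 3)) :* h :+ (:- (con 1ℚ :+ s) :* b :+ (E :* e :+ (:- l :* x
              :+ (l :* f :+ (con (- 1ℚ) :* H :+ (con 1ℚ :* c :+ (con 1ℚ :* d :+ (con 1ℚ :* r :+ con 0ℚ)))))))) :=
            (P :+ con (fromℕ 3)) :* h :- (con 1ℚ :+ s) :* b :+ E :* e :- l :* (x :- f) :- H :+ c :+ d :+ r) refl
            (fromℕ p) ⟨ hH ⟩ (sgn p) ⟨ B² ⟩ E ⟨ sgn-^ (2 ℕ.+ p) ⟩ lam ⟨ x^p+3 ⟩ ⟨ sgn-^ (3 ℕ.+ p) ⟩ ⟨ hL ⟩ ⟨ c₂₂ ⟩ ⟨ c₂ ⟩ ⟨ err₂ ⟩ ⟩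
      (fromℕ p + fromℕ 3) * ⟨ hH ⟩ - (1ℚ + sgn p) * ⟨ B² ⟩ + E * ⟨ sgn-^ (2 ℕ.+ p) ⟩
        - lam * (⟨ x^p+3 ⟩ - ⟨ sgn-^ (3 ℕ.+ p) ⟩) - ⟨ hL ⟩ + ⟨ c₂₂ ⟩ + ⟨ c₂ ⟩ + ⟨ err₂ ⟩ ∎
      where
      open ≡-Reasoning
      E = altHarmonic² N
      a s₁ s₂ s₃ s₄ s₅ F F⁻ : ℕ → ℚ
      a k  = rec k * altH k
      s₁ k = a k * x^p k * ⟨ (λ n → rec n * gap k n) ⟩
      s₂ n = rec n * x^p n * ⟨ (λ k → a k * gap k n) ⟩
      s₃ k = fromℕ p * (a k * rec k * x^p+1 k)
      s₄ k = sgn p * (a k * x^p k * ⟨ (λ n → rec n * rec (k ℕ.+ n)) ⟩)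
      s₅ n = rec n * x^p n * ⟨ (λ k → a k * rec (k ℕ.+ n)) ⟩
      F  i = ⟨ (λ k → a k * rec k ^ suc i) ⟩ * ⟨ (λ n → rec n * rec n ^ (p ℕ.∸ i)) ⟩
      F⁻ i = ⟨ (λ k → a k * (- rec k) ^ suc i) ⟩ * ⟨ (λ n → rec n * rec n ^ (p ℕ.∸ i)) ⟩
      terms : List (ℚ × (ℕ → ℚ))
      terms = (fromℕ p + fromℕ 3 , hH) ∷ (- (1ℚ + sgn p) , B²) ∷ (E , sgn-^ (2 ℕ.+ p)) ∷ (- lam , x^p+3) ∷
        (lam , sgn-^ (3 ℕ.+ p)) ∷ (- 1ℚ , hL) ∷ (1ℚ , c₂₂) ∷ (1ℚ , c₂) ∷ (1ℚ , err₂) ∷ []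
      split : ∀ i → i ℕ.< p → (1ℚ - sgn (suc i)) * (⟨ (λ n → sgn n * rec n ^ (2 ℕ.+ i) * harmonic n) ⟩ * ⟨ (λ n → rec n ^ (suc p ℕ.∸ i)) ⟩) ≡
        F i + - 1ℚ * F⁻ i
      split i i<p = trans
        (cong₂ (λ u v → (1ℚ - sgn (suc i)) * (u * v))
          (∑₁-cong {g = λ k → a k * rec k ^ suc i} N λ k _ → solve 4 (λ s x X h → s :* (x :* X) :* h := x :* (s :* h) :* X) refl
            (sgn (suc k)) (rec (suc k)) (rec (suc k) ^ suc i) (harmonic (suc k)))
          (∑-^-suc i (ℕ.<⇒≤ i<p)))
        (trans (solve 3 (λ s u v → (con 1ℚ :- s) :* (u :* v) := u :* v :+ con (- 1ℚ) :* ((s :* u) :* v)) refl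
            (sgn (suc i)) ⟨ (λ k → a k * rec k ^ suc i) ⟩ ⟨ (λ n → rec n * rec n ^ (p ℕ.∸ i)) ⟩)
          (cong (λ u → F i + - 1ℚ * (u * ⟨ (λ n → rec n * rec n ^ (p ℕ.∸ i)) ⟩)) (sgn-*-∑ a (suc i))))
      -- After `Z` cancels, the two kernel sums enter only through `B - A`, for which
      -- `signedT-closed` is available.
      isolate : ∀ s x X h g Z A B P σ c t → B - A ≡ t →
        x * (s * h) * X * (x * (x + x - h - g)) - x * X * (x * (Z - A - s * h * x))
          + P * (x * (s * h) * x * (x * X)) + - 1ℚ * (σ * (x * (s * h) * X * (x * (h - c))) - x * X * (x * (Z - B))) ≡
        x * (s * h) * X * (x * (x + x - h - g)) + P * (x * (s * h) * x * (x * X))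
          - σ * (x * (s * h) * X * (x * (h - c))) + x * (x * X) * (s * h * x - t)
      isolate s x X h g Z A B P σ c _ refl = solve 11 (λ s x X h g Z A B P σ c →
        x :* (s :* h) :* X :* (x :* (x :+ x :- h :- g)) :- x :* X :* (x :* (Z :- A :- s :* h :* x))
          :+ P :* (x :* (s :* h) :* x :* (x :* X)) :+ con (- 1ℚ) :* (σ :* (x :* (s :* h) :* X :* (x :* (h :- c))) :- x :* X :* (x :* (Z :- B))) :=
        x :* (s :* h) :* X :* (x :* (x :+ x :- h :- g)) :+ P :* (x :* (s :* h) :* x :* (x :* X))
          :- σ :* (x :* (s :* h) :* X :* (x :* (h :- c))) :+ x :* (x :* X) :* (s :* h :* x :- (B :- A))) refl s x X h g Z A B P σ c
      collect : ∀ s x X h g P σ c E lam l l₂ q t → s * s ≡ 1ℚ →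
        x * (s * h) * X * (x * (x + x - h - g)) + P * (x * (s * h) * x * (x * X))
          - σ * (x * (s * h) * X * (x * (h - c))) + x * (x * X) * (s * h * x - s * (- E + lam * (s * x - x) + x * l - l₂ - q + t)) ≡
        (P + fromℕ 3) * (s * (x * (x * (x * X))) * h) + (- (1ℚ + σ) * (s * (x * (x * X)) * (h * h)) + (E * (s * (x * (x * X)))
          + (- lam * (x * (x * (x * X))) + (lam * (s * (x * (x * (x * X)))) + (- 1ℚ * (s * (x * (x * (x * X))) * l)
          + (1ℚ * (s * (x * (x * X)) * l₂) + (1ℚ * (s * (x * (x * X)) * q)
          + (1ℚ * (x * (s * X * (x * (σ * (h * c) - h * g - t)))) + 0ℚ))))))))
      collect s x X h g P σ c E lam l l₂ q t ss≡1 = trans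
        (solve 14 (λ s x X h g P σ c E lam l l₂ q t →
          x :* (s :* h) :* X :* (x :* (x :+ x :- h :- g)) :+ P :* (x :* (s :* h) :* x :* (x :* X))
            :- σ :* (x :* (s :* h) :* X :* (x :* (h :- c))) :+ x :* (x :* X) :* (s :* h :* x :- s :* (:- E :+ lam :* (s :* x :- x) :+ x :* l :- l₂ :- q :+ t)) :=
          (P :+ con (fromℕ 3)) :* (s :* (x :* (x :* (x :* X))) :* h) :+ (:- (con 1ℚ :+ σ) :* (s :* (x :* (x :* X)) :* (h :* h)) :+ (E :* (s :* (x :* (x :* X)))
            :+ (:- lam :* (s :* s :* (x :* (x :* (x :* X)))) :+ (lam :* (s :* (x :* (x :* (x :* X)))) :+ (con (- 1ℚ) :* (s :* (x :* (x :* (x :* X))) :* l)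
            :+ (con 1ℚ :* (s :* (x :* (x :* X)) :* l₂) :+ (con 1ℚ :* (s :* (x :* (x :* X)) :* q)
            :+ (con 1ℚ :* (x :* (s :* X :* (x :* (σ :* (h :* c) :- h :* g :- t)))) :+ con 0ℚ)))))))))
          refl s x X h g P σ c E lam l l₂ q t)
        (cong (λ u → (P + fromℕ 3) * (s * (x * (x * (x * X))) * h) + (- (1ℚ + σ) * (s * (x * (x * X)) * (h * h)) + (E * (s * (x * (x * X)))
          + (- lam * u + (lam * (s * (x * (x * (x * X)))) + (- 1ℚ * (s * (x * (x * (x * X))) * l)
          + (1ℚ * (s * (x * (x * X)) * l₂) + (1ℚ * (s * (x * (x * X)) * q)
          + (1ℚ * (x * (s * X * (x * (σ * (h * c) - h * g - t)))) + 0ℚ)))))))))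
          (trans (cong (_* (x * (x * (x * X)))) ss≡1) (ℚ.*-identityˡ _)))
      pointwise : ∀ n → n ℕ.< N → s₁ (suc n) - s₂ (suc n) + s₃ (suc n) + - 1ℚ * (s₄ (suc n) - s₅ (suc n)) ≡ combination terms (suc n)
      pointwise n n<N = trans
        (cong₂ (λ u v → u + s₃ (suc n) + - 1ℚ * v)
          (cong₂ (λ u v → a (suc n) * x^p (suc n) * u - rec (suc n) * x^p (suc n) * v)
            (∑-rec-gap n n<N) (∑-rec-gapʳ altH n n<N))
          (cong₂ (λ u v → sgn p * (a (suc n) * x^p (suc n) * u) - rec (suc n) * x^p (suc n) * v)
            (∑-rec-sum n) (∑-rec-sumʳ altH n)))
        (trans (isolate s x X h g Z (A (suc n)) (B (suc n)) (fromℕ p) (sgn p) c _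
          (by-sgn (suc n) (T (suc n)) _ (signedT-closed (suc n) n<N)))
        (collect s x X h g (fromℕ p) (sgn p) c E lam (altHarmonic (suc n)) (altHarmonic² (suc n)) (harmonic² (suc n)) (errT (suc n)) (sgn-sq (suc n))))
        where
        s = sgn (suc n)
        x = rec (suc n)
        X = rec (suc n) ^ p
        h = harmonic (suc n)
        g = errG (suc n)
        c = errC (suc n)
        Z = ⟨ (λ k → rec k * altH k) ⟩

    err₃ : ℕ → ℚ
    err₃ n = rec n * (sgn n * x^p n * (rec n * (rec n * (sgn p * errC n + errK n))))

    -- The alternating sign goes into the base, so only the kernel 1/(n + k) occurs; it has no
    -- diagonal, hence no coefficient linear in `p`. The outer factor `- 1ℚ` arises because the base
    -- is raised to `suc i` while the sign is `sgn i`.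
    identity₃ : ∑₀ (λ i → sgn i * (⟨ (λ n → rec n ^ (suc p ℕ.∸ i)) ⟩ * ⟨ sgn-^ (3 ℕ.+ i) ⟩)) p ≡
      - (sgn p * ⟨ hH ⟩) + altHarmonic² N * ⟨ x^p+2 ⟩ - lam * (⟨ x^p+3 ⟩ - ⟨ sgn-^ (3 ℕ.+ p) ⟩) - ⟨ hL ⟩ + ⟨ err₃ ⟩
    identity₃ = begin
      ∑₀ (λ i → sgn i * (⟨ (λ n → rec n ^ (suc p ℕ.∸ i)) ⟩ * ⟨ sgn-^ (3 ℕ.+ i) ⟩)) p
        ≡⟨ ∑₀-cong p split ⟩
      ∑₀ (λ i → - 1ℚ * F⁻ i) p
        ≡⟨ trans (∑₀-*ˡ (- 1ℚ) F⁻ p) (cong (- 1ℚ *_)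
             (trans (∑₀-homogeneous N (λ k → - rec k) rec a rec p) (double-sum-sum N a rec p))) ⟩
      - 1ℚ * (⟨ s₄ ⟩ - ⟨ s₅ ⟩)
        ≡⟨ trans (cong (- 1ℚ *_) (sym (∑₁-- s₄ s₅ N))) (sym (∑₁-*ˡ (- 1ℚ) _ N)) ⟩
      ⟨ (λ n → - 1ℚ * (s₄ n - s₅ n)) ⟩
        ≡⟨ ∑₁-cong N (λ n _ → pointwise n) ⟩
      ⟨ combination terms ⟩
        ≡⟨ ∑₁-combination N terms ⟩
      - sgn p * ⟨ hH ⟩ + (E * ⟨ x^p+2 ⟩ + (- lam * ⟨ x^p+3 ⟩ + (lam * ⟨ sgn-^ (3 ℕ.+ p) ⟩ + (- 1ℚ * ⟨ hL ⟩ + (1ℚ * ⟨ err₃ ⟩ + 0ℚ)))))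
        ≡⟨ solve 9 (λ s h E e l x f H r →
            :- s :* h :+ (E :* e :+ (:- l :* x :+ (l :* f :+ (con (- 1ℚ) :* H :+ (con 1ℚ :* r :+ con 0ℚ))))) :=
            :- (s :* h) :+ E :* e :- l :* (x :- f) :- H :+ r) refl
            (sgn p) ⟨ hH ⟩ E ⟨ x^p+2 ⟩ lam ⟨ x^p+3 ⟩ ⟨ sgn-^ (3 ℕ.+ p) ⟩ ⟨ hL ⟩ ⟨ err₃ ⟩ ⟩
      - (sgn p * ⟨ hH ⟩) + E * ⟨ x^p+2 ⟩ - lam * (⟨ x^p+3 ⟩ - ⟨ sgn-^ (3 ℕ.+ p) ⟩) - ⟨ hL ⟩ + ⟨ err₃ ⟩ ∎
      where
      open ≡-Reasoning
      E = altHarmonic² N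
      a s₄ s₅ F⁻ : ℕ → ℚ
      a k  = rec k * (sgn k * rec k)
      s₄ k = sgn p * (a k * x^p k * ⟨ (λ n → rec n * rec (k ℕ.+ n)) ⟩)
      s₅ n = rec n * x^p n * ⟨ (λ k → a k * rec (k ℕ.+ n)) ⟩
      F⁻ i = ⟨ (λ k → a k * (- rec k) ^ suc i) ⟩ * ⟨ (λ n → rec n * rec n ^ (p ℕ.∸ i)) ⟩
      terms : List (ℚ × (ℕ → ℚ))
      terms = (- sgn p , hH) ∷ (E , x^p+2) ∷ (- lam , x^p+3) ∷ (lam , sgn-^ (3 ℕ.+ p)) ∷ (- 1ℚ , hL) ∷ (1ℚ , err₃) ∷ []
      split : ∀ i → i ℕ.< p → sgn i * (⟨ (λ n → rec n ^ (suc p ℕ.∸ i)) ⟩ * ⟨ sgn-^ (3 ℕ.+ i) ⟩) ≡ - 1ℚ * F⁻ i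
      split i i<p = trans
        (cong₂ (λ u v → sgn i * (u * v)) (∑-^-suc i (ℕ.<⇒≤ i<p))
          (∑₁-cong {g = λ k → a k * rec k ^ suc i} N λ k _ → solve 3 (λ e x X → e :* (x :* (x :* X)) := x :* (e :* x) :* X) refl
            (sgn (suc k)) (rec (suc k)) (rec (suc k) ^ suc i)))
        (trans (solve 3 (λ s u v → s :* (u :* v) := con (- 1ℚ) :* ((con (- 1ℚ) :* s :* v) :* u)) refl
            (sgn i) ⟨ (λ n → rec n * rec n ^ (p ℕ.∸ i)) ⟩ ⟨ (λ k → a k * rec k ^ suc i) ⟩)
          (cong (λ u → - 1ℚ * (u * ⟨ (λ n → rec n * rec n ^ (p ℕ.∸ i)) ⟩)) (sgn-*-∑ a (suc i))))
      collect : ∀ s x X h σ c E lam l k →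
        - 1ℚ * (σ * (x * (s * x) * X * (x * (h - c))) - x * X * (x * (E - x * (lam - s * (lam - l + k))))) ≡
        - σ * (s * (x * (x * (x * X))) * h) + (E * (x * (x * X)) + (- lam * (x * (x * (x * X))) + (lam * (s * (x * (x * (x * X))))
          + (- 1ℚ * (s * (x * (x * (x * X))) * l) + (1ℚ * (x * (s * X * (x * (x * (σ * c + k))))) + 0ℚ)))))
      collect s x X h σ c E lam l k = solve 10 (λ s x X h σ c E lam l k →
        con (- 1ℚ) :* (σ :* (x :* (s :* x) :* X :* (x :* (h :- c))) :- x :* X :* (x :* (E :- x :* (lam :- s :* (lam :- l :+ k))))) :=
        :- σ :* (s :* (x :* (x :* (x :* X))) :* h) :+ (E :* (x :* (x :* X)) :+ (:- lam :* (x :* (x :* (x :* X))) :+ (lam :* (s :* (x :* (x :* (x :* X))))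
          :+ (con (- 1ℚ) :* (s :* (x :* (x :* (x :* X))) :* l) :+ (con 1ℚ :* (x :* (s :* X :* (x :* (x :* (σ :* c :+ k))))) :+ con 0ℚ)))))) refl
        s x X h σ c E lam l k
      pointwise : ∀ n → - 1ℚ * (s₄ (suc n) - s₅ (suc n)) ≡ combination terms (suc n)
      pointwise n = trans
        (cong₂ (λ u v → - 1ℚ * (sgn p * (a (suc n) * x^p (suc n) * u) - rec (suc n) * x^p (suc n) * v))
          (∑-rec-sum n)
          (trans (∑-rec-sumʳ (λ k → sgn k * rec k) n) (cong₂ (λ u v → rec (suc n) * (u - v))
            (∑₁-cong N λ k _ → solve 2 (λ x s → x :* (s :* x) := s :* (x :* x)) refl (rec (suc k)) (sgn (suc k)))
            (trans (∑₁-cong N λ k _ → ℚ.*-assoc (sgn (suc k)) (rec (suc k)) (rec (suc n ℕ.+ suc k)))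
              (trans (J-suc n) (cong (λ u → rec (suc n) * (lam - u)) (by-sgn (suc n) (K (suc n)) _ (K-closed (suc n)))))))))
        (collect (sgn (suc n)) (rec (suc n)) (rec (suc n) ^ p) (harmonic (suc n)) (sgn p) (errC (suc n)) E lam
          (altHarmonic (suc n)) (errK (suc n)))

  -- Null sequences and error bounds.

  Null : (ℕ → ℚ) → Set
  Null x = ∀ ε → 0ℚ < ε → ∃[ M ] (∀ n → M ℕ.≤ n → ∣ x n ∣ < ε)

  Null-cong : ∀ {x y} → (∀ n → x n ≡ y n) → Null x → Null y
  Null-cong h nx ε 0<ε = proj₁ (nx ε 0<ε) , λ n M≤n → subst (λ u → ∣ u ∣ < ε) (h n) (proj₂ (nx ε 0<ε) n M≤n)

  Null-+ : ∀ {x y} → Null x → Null y → Null (λ n → x n + y n)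
  Null-+ {x} {y} nx ny ε 0<ε with nx (½ * ε) (0<* 0<½ 0<ε) | ny (½ * ε) (0<* 0<½ 0<ε)
  ... | M , hx | M′ , hy = M ℕ.⊔ M′ , λ n le → ℚ.≤-<-trans (ℚ.∣p+q∣≤∣p∣+∣q∣ (x n) (y n))
    (subst (_ <_) (halves ε) (ℚ.+-mono-< (hx n (ℕ.m⊔n≤o⇒m≤o M M′ le)) (hy n (ℕ.m⊔n≤o⇒n≤o M M′ le))))

  Null-neg : ∀ {x} → Null x → Null (λ n → - x n)
  Null-neg {x} nx ε 0<ε = proj₁ (nx ε 0<ε) , λ n le → subst (_< ε) (sym (ℚ.∣-p∣≡∣p∣ (x n))) (proj₂ (nx ε 0<ε) n le)

  Null-*-Cauchy : ∀ {x y} → Null x → IsCauchy y → Null (λ n → x n * y n)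
  Null-*-Cauchy {x} {y} nx cy ε 0<ε with eventually-bounded y cy
  ... | K , 0<K , M , hy with shrink K 0<K ε 0<ε
  ... | δ , 0<δ , Kδ≡ε with nx δ 0<δ
  ... | M′ , hx = M ℕ.⊔ M′ , λ n le → subst₂ _<_
    (trans (ℚ.*-comm ∣ y n ∣ ∣ x n ∣) (sym (ℚ.∣p*q∣≡∣p∣*∣q∣ (x n) (y n)))) Kδ≡ε
    (ℚ.≤-<-trans (ℚ.*-monoʳ-≤-nonNeg ∣ x n ∣ {{nonNegative (ℚ.0≤∣p∣ (x n))}} (hy n (ℕ.m⊔n≤o⇒m≤o M M′ le)))
      (ℚ.*-monoʳ-<-pos K {{positive 0<K}} (hx n (ℕ.m⊔n≤o⇒n≤o M M′ le))))

  Null-dominated : ∀ {x y} → (∀ n → ∣ x n ∣ ≤ y n) → Null y → Null x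
  Null-dominated {x} {y} h ny ε 0<ε = proj₁ (ny ε 0<ε) , λ n le →
    ℚ.≤-<-trans (ℚ.≤-trans (h n) (p≤∣p∣ (y n) (ℚ.≤-trans (ℚ.0≤∣p∣ (x n)) (h n)))) (proj₂ (ny ε 0<ε) n le)
    where
    p≤∣p∣ : ∀ p → 0ℚ ≤ p → p ≤ ∣ p ∣
    p≤∣p∣ p 0≤p = ℚ.≤-reflexive (sym (ℚ.0≤p⇒∣p∣≡p 0≤p))

  rec-nonNeg : ∀ n → 0ℚ ≤ rec n
  rec-nonNeg zero    = ℚ.≤-reflexive (sym rec-zero)
  rec-nonNeg (suc n) = subst (0ℚ ≤_) (sym (rec-suc n)) (recip-nonNeg (suc n))

  rec≤1 : ∀ n → rec n ≤ 1ℚ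
  rec≤1 zero    = subst (_≤ 1ℚ) (sym rec-zero) 0≤1
  rec≤1 (suc n) = subst (_≤ 1ℚ) (sym (rec-suc n)) (recip≤1 n)

  rec-antitone : ∀ n k → rec (suc n ℕ.+ k) ≤ rec (suc n)
  rec-antitone n k = subst₂ _≤_ (sym (rec-suc (n ℕ.+ k))) (sym (rec-suc n)) (recip-antitone* n k)

  rec^-bounds : ∀ n m → 0ℚ ≤ rec n ^ m × rec n ^ m ≤ 1ℚ
  rec^-bounds n zero    = 0≤1 , ℚ.≤-refl
  rec^-bounds n (suc m) = 0≤* (rec-nonNeg n) (proj₁ (rec^-bounds n m)) ,
    *-mono-≤ (rec-nonNeg n) 0≤1 (rec≤1 n) (proj₂ (rec^-bounds n m))

  harmonic-nonNeg : ∀ n → 0ℚ ≤ harmonic n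
  harmonic-nonNeg zero    = ℚ.≤-refl
  harmonic-nonNeg (suc n) = 0≤+ (harmonic-nonNeg n) (rec-nonNeg (suc n))

  harmonic-suc≤ : ∀ n → harmonic n ≤ harmonic (suc n)
  harmonic-suc≤ n = subst (_≤ harmonic (suc n)) (ℚ.+-identityʳ (harmonic n)) (ℚ.+-monoʳ-≤ (harmonic n) (rec-nonNeg (suc n)))

  harmonic-mono : ∀ {m n} → m ℕ.≤ n → harmonic m ≤ harmonic n
  harmonic-mono {m} {zero}  z≤n = ℚ.≤-refl
  harmonic-mono {m} {suc n} m≤n with ℕ.m≤n⇒m<n∨m≡n m≤n
  ... | inj₁ (s≤s m≤n′) = ℚ.≤-trans (harmonic-mono m≤n′) (harmonic-suc≤ n)
  ... | inj₂ refl       = ℚ.≤-refl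

  1≤harmonic : ∀ {n N} → n ℕ.< N → 1ℚ ≤ harmonic N
  1≤harmonic {n} {N} n<N = ℚ.≤-trans (ℚ.≤-reflexive (sym one)) (harmonic-mono {1} {N} (ℕ.≤-trans (s≤s z≤n) n<N))
    where
    one : harmonic 1 ≡ 1ℚ
    one = trans (ℚ.+-identityˡ (rec 1)) (rec-suc 0)

  ∣sgn∣ : ∀ n → ∣ sgn n ∣ ≡ 1ℚ
  ∣sgn∣ = ∣[-1]^n∣

  ∣altHarmonic∣≤ : ∀ n → ∣ altHarmonic n ∣ ≤ harmonic n
  ∣altHarmonic∣≤ zero    = ℚ.≤-refl
  ∣altHarmonic∣≤ (suc n) = ℚ.≤-trans (ℚ.∣p+q∣≤∣p∣+∣q∣ (altHarmonic n) (sgn (suc n) * rec (suc n)))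
    (ℚ.+-mono-≤ (∣altHarmonic∣≤ n) (ℚ.≤-reflexive (trans (ℚ.∣p*q∣≡∣p∣*∣q∣ (sgn (suc n)) (rec (suc n)))
      (trans (cong₂ _*_ (∣sgn∣ (suc n)) (ℚ.0≤p⇒∣p∣≡p (rec-nonNeg (suc n)))) (ℚ.*-identityˡ _)))))

  ∣altH∣ : ∀ n → ∣ altH n ∣ ≡ harmonic n
  ∣altH∣ n = trans (ℚ.∣p*q∣≡∣p∣*∣q∣ (sgn n) (harmonic n))
    (trans (cong₂ _*_ (∣sgn∣ n) (ℚ.0≤p⇒∣p∣≡p (harmonic-nonNeg n))) (ℚ.*-identityˡ _))

  gap-nonNeg : ∀ {n N} → n ℕ.≤ N → 0ℚ ≤ gap n N
  gap-nonNeg {zero}  {N}     _         = rec-nonNeg N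
  gap-nonNeg {suc n} {suc N} (s≤s n≤N) = gap-nonNeg n≤N

  gap-suc : ∀ n N → suc n ℕ.< N → gap n N ≤ gap (suc n) N
  gap-suc zero    (suc (suc N)) _         =
    subst (λ k → rec k ≤ rec (suc N)) (ℕ.+-comm (suc N) 1) (rec-antitone N 1)
  gap-suc zero    (suc zero)    (s≤s ())
  gap-suc (suc n) (suc N)       (s≤s n<N) = gap-suc n N n<N

  gap-mono : ∀ {i n N} → i ℕ.≤ n → n ℕ.< N → gap i N ≤ gap n N
  gap-mono {i} {zero}  z≤n _   = ℚ.≤-refl
  gap-mono {i} {suc n} {N} i≤n n<N with ℕ.m≤n⇒m<n∨m≡n i≤n
  ... | inj₁ (s≤s i≤n′) = ℚ.≤-trans (gap-mono i≤n′ (ℕ.<-trans (ℕ.n<1+n n) n<N)) (gap-suc n N n<N)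
  ... | inj₂ refl       = ℚ.≤-refl

  -- Both are compared with 1/N. It lets the boundary terms of the kernel 1/(n + k) share the bound
  -- used for 1/(n - k).
  rec-far≤gap : ∀ {n N} → n ℕ.< N → rec (suc n ℕ.+ N) ≤ gap n N
  rec-far≤gap {n} {suc N} n<N = ℚ.≤-trans
    (subst (λ k → rec k ≤ rec (suc N)) (ℕ.+-comm (suc N) (suc n)) (rec-antitone N (suc n)))
    (gap-mono {0} {n} z≤n n<N)

  -- A doubly indexed error, indexed by 1 ≤ n ≤ N, of size O(h N / (N + 1 - n)).
  record Tiny (h : ℕ → ℚ) (d : ℕ → ℕ → ℚ) : Set where
    constructor tiny
    field
      constant : ℚ
      nonNeg   : 0ℚ ≤ constant
      bound    : ∀ N n → n ℕ.< N → ∣ d N (suc n) ∣ ≤ constant * (h N * gap n N)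

  one : ℕ → ℚ
  one _ = 1ℚ

  Tiny-cong : ∀ {h d d′} → (∀ N n → n ℕ.< N → d N (suc n) ≡ d′ N (suc n)) → Tiny h d → Tiny h d′
  Tiny-cong {h} eq (tiny c 0≤c H) = tiny c 0≤c λ N n n<N → subst (λ u → ∣ u ∣ ≤ c * (h N * gap n N)) (eq N n n<N) (H N n n<N)

  Tiny-+ : ∀ {h d d′} → Tiny h d → Tiny h d′ → Tiny h (λ N n → d N n + d′ N n)
  Tiny-+ {h} {d} {d′} (tiny c 0≤c H) (tiny c′ 0≤c′ H′) = tiny (c + c′) (0≤+ 0≤c 0≤c′) λ N n n<N →
    ℚ.≤-trans (ℚ.∣p+q∣≤∣p∣+∣q∣ (d N (suc n)) (d′ N (suc n)))
      (subst (_ ≤_) (sym (ℚ.*-distribʳ-+ (h N * gap n N) c c′)) (ℚ.+-mono-≤ (H N n n<N) (H′ N n n<N)))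

  Tiny-* : ∀ {h k h′ : ℕ → ℚ} {d} (y : ℕ → ℕ → ℚ) → (∀ N → 0ℚ ≤ k N) → (∀ N → k N * h N ≤ h′ N) →
    (∀ N n → n ℕ.< N → ∣ y N (suc n) ∣ ≤ k N) → Tiny h d → Tiny h′ (λ N n → y N n * d N n)
  Tiny-* {h} {k} {h′} {d} y 0≤k kh≤h′ y≤k (tiny c 0≤c H) = tiny c 0≤c λ N n n<N →
    let g≥0 = gap-nonNeg (ℕ.<⇒≤ n<N) in
    subst (_≤ c * (h′ N * gap n N)) (sym (ℚ.∣p*q∣≡∣p∣*∣q∣ (y N (suc n)) (d N (suc n))))
      (ℚ.≤-trans (*-mono-≤ (ℚ.0≤∣p∣ (y N (suc n))) (ℚ.≤-trans (ℚ.0≤∣p∣ (d N (suc n))) (H N n n<N)) (y≤k N n n<N) (H N n n<N))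
      (subst (_≤ c * (h′ N * gap n N))
        (solve 4 (λ k c h g → c :* (k :* h :* g) := k :* (c :* (h :* g))) refl (k N) c (h N) (gap n N))
        (ℚ.*-monoˡ-≤-nonNeg c {{nonNegative 0≤c}} (ℚ.*-monoʳ-≤-nonNeg (gap n N) {{nonNegative g≥0}} (kh≤h′ N)))))

  Tiny-*-unit : ∀ {h d} (y : ℕ → ℕ → ℚ) → (∀ N n → n ℕ.< N → ∣ y N (suc n) ∣ ≤ 1ℚ) → Tiny h d → Tiny h (λ N n → y N n * d N n)
  Tiny-*-unit y = Tiny-* {k = one} y (λ _ → 0≤1) (λ N → ℚ.≤-reflexive (ℚ.*-identityˡ _))

  Tiny-*-harmonic : ∀ {d} (y : ℕ → ℕ → ℚ) → (∀ N n → n ℕ.< N → ∣ y N (suc n) ∣ ≤ harmonic N) → Tiny one d → Tiny harmonic (λ N n → y N n * d N n)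
  Tiny-*-harmonic y = Tiny-* {k = harmonic} y harmonic-nonNeg (λ N → ℚ.≤-reflexive (ℚ.*-identityʳ _))

  Tiny-neg : ∀ {h d} → Tiny h d → Tiny h (λ N n → - d N n)
  Tiny-neg {h} {d} t = Tiny-cong (λ N n _ → sym (neg-as-* (d N (suc n)))) (Tiny-*-unit {d = d} (λ _ _ → - 1ℚ) (λ _ _ _ → ℚ.≤-refl) t)

  Tiny-one⇒harmonic : ∀ {d} → Tiny one d → Tiny harmonic d
  Tiny-one⇒harmonic {d} t = Tiny-cong (λ N n _ → ℚ.*-identityˡ (d N (suc n)))
    (Tiny-*-harmonic (λ _ _ → 1ℚ) (λ N n n<N → 1≤harmonic n<N) t)

  -- 1/(N + 1 - n) increases with `n`, so the bound at the previous index suffices; index 0 has no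
  -- bound and needs `f` to vanish there.
  Tiny-pred : ∀ {h f} → (∀ N → 0ℚ ≤ h N) → (∀ N → f N 0 ≡ 0ℚ) → Tiny h f → Tiny h (λ N n → f N (ℕ.pred n))
  Tiny-pred {h} {f} 0≤h f0 (tiny c 0≤c H) = tiny c 0≤c bound
    where
    bound : ∀ N n → n ℕ.< N → ∣ f N n ∣ ≤ c * (h N * gap n N)
    bound N zero    n<N = subst (_≤ c * (h N * gap 0 N)) (sym (cong ∣_∣ (f0 N))) (0≤* 0≤c (0≤* (0≤h N) (gap-nonNeg {0} {N} z≤n)))
    bound N (suc n) n<N = ℚ.≤-trans (H N n (ℕ.<-trans (ℕ.n<1+n n) n<N))
      (ℚ.*-monoˡ-≤-nonNeg c {{nonNegative 0≤c}} (ℚ.*-monoˡ-≤-nonNeg (h N) {{nonNegative (0≤h N)}} (gap-suc n N n<N)))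

  ∣∑₁∣≤ : ∀ (f : ℕ → ℚ) b m → (∀ i → i ℕ.< m → ∣ f (suc i) ∣ ≤ b) → ∣ ∑₁ f m ∣ ≤ fromℕ m * b
  ∣∑₁∣≤ f b zero    _ = ℚ.≤-reflexive (sym (ℚ.*-zeroˡ b))
  ∣∑₁∣≤ f b (suc m) h = ℚ.≤-trans (ℚ.∣p+q∣≤∣p∣+∣q∣ (∑₁ f m) (f (suc m)))
    (subst (_ ≤_) (trans (solve 2 (λ m b → m :* b :+ b := (m :+ con 1ℚ) :* b) refl (fromℕ m) b) (cong (_* b) (sym (fromℕ-suc m))))
      (ℚ.+-mono-≤ (∣∑₁∣≤ f b m λ i i<m → h i (ℕ.m≤n⇒m≤1+n i<m)) (h m ℕ.≤-refl)))

  -- The n summands are each at most the bound for the last one, and 1/n cancels their number.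
  Tiny-∑ : ∀ {h d} → (∀ N → 0ℚ ≤ h N) → Tiny h d → Tiny h (λ N n → rec n * ∑₁ (d N) n)
  Tiny-∑ {h} {d} 0≤h (tiny c 0≤c H) = tiny c 0≤c λ N n n<N →
    let b = c * (h N * gap n N) in
    subst₂ _≤_
      (sym (trans (ℚ.∣p*q∣≡∣p∣*∣q∣ (rec (suc n)) (∑₁ (d N) (suc n)))
        (cong (_* ∣ ∑₁ (d N) (suc n) ∣) (ℚ.0≤p⇒∣p∣≡p (rec-nonNeg (suc n))))))
      (trans (solve 3 (λ x m b → x :* (m :* b) := m :* x :* b) refl (rec (suc n)) (fromℕ (suc n)) b)
        (trans (cong (_* b) (fromℕ*rec n)) (ℚ.*-identityˡ b)))
      (ℚ.*-monoˡ-≤-nonNeg (rec (suc n)) {{nonNegative (rec-nonNeg (suc n))}}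
        (∣∑₁∣≤ (d N) b (suc n) λ i i≤n → ℚ.≤-trans (H N i (ℕ.<-≤-trans i≤n n<N))
          (ℚ.*-monoˡ-≤-nonNeg c {{nonNegative 0≤c}} (ℚ.*-monoˡ-≤-nonNeg (h N) {{nonNegative (0≤h N)}} (gap-mono (ℕ.≤-pred i≤n) n<N)))))

  ∑-gap : ∀ N → ∑₁ (λ i → gap (ℕ.pred i) N) N ≡ harmonic N
  ∑-gap zero    = refl
  ∑-gap (suc N) = trans (∑₁-shift (λ i → gap i (suc N)) (suc N))
    (trans (solve 3 (λ x s y → x :+ (s :+ y) :- y := s :+ x) refl (rec (suc N)) (∑₁ (λ i → gap i (suc N)) N) (gap N N))
      (cong (_+ rec (suc N)) (trans (∑₁-cong N λ _ _ → refl) (∑-gap N))))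

  -- Partial fractions: 1/(n (N + 1 - n)) is (1/n + 1/(N + 1 - n))/(N + 1), and both parts sum to
  -- `harmonic N`.
  ∑-rec-gap-pred : ∀ N → ∑₁ (λ n → rec n * gap (ℕ.pred n) N) N ≡ rec (suc N) * (harmonic N + harmonic N)
  ∑-rec-gap-pred N = trans (∑₁-cong N λ n n<N → trans (ℚ.*-comm (rec (suc n)) (gap n N)) (trans (gap-fraction n N)
      (trans (cong (λ d → gap n N * y + rec (suc n) * y - d * (rec (suc n) * rec (suc n))) (δ-< n<N))
        (solve 3 (λ g x y → g :* y :+ x :* y :- con 0ℚ :* (x :* x) := y :* (g :+ x)) refl (gap n N) (rec (suc n)) y))))
    (trans (∑₁-*ˡ y (λ n → gap (ℕ.pred n) N + rec n) N) (cong (y *_)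
      (trans (∑₁-+ (λ n → gap (ℕ.pred n) N) rec N) (cong (_+ harmonic N) (∑-gap N)))))
    where y = rec (suc N)

  ∣∑₁∣≤∑₁ : ∀ (f b : ℕ → ℚ) m → (∀ i → i ℕ.< m → ∣ f (suc i) ∣ ≤ b (suc i)) → ∣ ∑₁ f m ∣ ≤ ∑₁ b m
  ∣∑₁∣≤∑₁ f b zero    _ = ℚ.≤-refl
  ∣∑₁∣≤∑₁ f b (suc m) h = ℚ.≤-trans (ℚ.∣p+q∣≤∣p∣+∣q∣ (∑₁ f m) (f (suc m)))
    (ℚ.+-mono-≤ (∣∑₁∣≤∑₁ f b m λ i i<m → h i (ℕ.m≤n⇒m≤1+n i<m)) (h m ℕ.≤-refl))

  H≡harmonic : ∀ n → H n ≡ harmonic n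
  H≡harmonic n = partialSum≡∑₁ n λ k → sym (rec-suc k)

  -- Dominated by the tail bound (h² + 4h + 6)/(n + 1) of the comparison series, with h the next
  -- harmonic number, which is already known to be null.
  harmonic²/n-null : Null (λ N → harmonic N * harmonic N * rec (suc N))
  harmonic²/n-null ε 0<ε = proj₁ small , λ n le → ℚ.≤-<-trans (bound n) (proj₂ small n le)
    where
    small = Majorant.tailBound-small ε 0<ε
    bound : ∀ n → ∣ harmonic n * harmonic n * rec (suc n) ∣ ≤ Majorant.tailBound n
    bound n = subst (_≤ Majorant.tailBound n)
      (sym (ℚ.0≤p⇒∣p∣≡p (0≤* (0≤* (harmonic-nonNeg n) (harmonic-nonNeg n)) (rec-nonNeg (suc n)))))
      (subst (λ x → harmonic n * harmonic n * x ≤ Majorant.tailBound n) (sym (rec-suc n))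
        (ℚ.*-monoʳ-≤-nonNeg (recip (suc n)) {{nonNegative (recip-nonNeg (suc n))}}
          (ℚ.≤-trans (*-mono-≤ (harmonic-nonNeg n) h≥0 h≤ h≤)
            (diff⇒≤ {H (suc n) * H (suc n)} {Majorant.P (H (suc n))} (subst (0ℚ ≤_) (solve 1 (λ h → con (fromℕ 4) :* h :+ con (fromℕ 6) := h :* h :+ con (fromℕ 4) :* h :+ con (fromℕ 6) :- h :* h) refl (H (suc n)))
              (0≤+ (0≤* (fromℕ-nonNeg 4) h≥0) (fromℕ-nonNeg 6)))))))
      where
      h≥0 = H-nonNeg (suc n)
      h≤ : harmonic n ≤ H (suc n)
      h≤ = subst (harmonic n ≤_) (sym (H≡harmonic (suc n))) (harmonic-suc≤ n)

  Tiny⇒Null : ∀ {d} → Tiny harmonic d → ∀ p → Null (λ N → ∑₁ (λ n → rec n * (sgn n * rec n ^ p * d N n)) N)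
  Tiny⇒Null {d} (tiny c 0≤c H) p = Null-dominated bound
    (Null-*-Cauchy harmonic²/n-null (const-isCauchy (c + c)))
    where
    bound : ∀ N → ∣ ∑₁ (λ n → rec n * (sgn n * rec n ^ p * d N n)) N ∣ ≤ harmonic N * harmonic N * rec (suc N) * (c + c)
    bound N = subst (∣ ∑₁ (λ n → rec n * (sgn n * rec n ^ p * d N n)) N ∣ ≤_)
      (trans (∑₁-*ˡ (c * harmonic N) (λ n → rec n * gap (ℕ.pred n) N) N)
        (trans (cong (c * harmonic N *_) (∑-rec-gap-pred N))
          (solve 3 (λ c h x → c :* h :* (x :* (h :+ h)) := h :* h :* x :* (c :+ c)) refl c (harmonic N) (rec (suc N)))))
      (∣∑₁∣≤∑₁ _ (λ n → c * harmonic N * (rec n * gap (ℕ.pred n) N)) N term)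
      where
      term : ∀ n → n ℕ.< N → ∣ rec (suc n) * (sgn (suc n) * rec (suc n) ^ p * d N (suc n)) ∣ ≤ c * harmonic N * (rec (suc n) * gap n N)
      term n n<N = subst₂ _≤_
        (sym (trans (ℚ.∣p*q∣≡∣p∣*∣q∣ x (s * X * e)) (cong₂ _*_ (ℚ.0≤p⇒∣p∣≡p (rec-nonNeg (suc n)))
          (trans (ℚ.∣p*q∣≡∣p∣*∣q∣ (s * X) e) (cong (_* ∣ e ∣) (trans (ℚ.∣p*q∣≡∣p∣*∣q∣ s X)
            (trans (cong₂ _*_ (∣sgn∣ (suc n)) (ℚ.0≤p⇒∣p∣≡p (proj₁ (rec^-bounds (suc n) p)))) (ℚ.*-identityˡ X))))))))
        (solve 4 (λ x c h g → x :* (con 1ℚ :* (c :* (h :* g))) := c :* h :* (x :* g)) refl x c (harmonic N) (gap n N))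
        (ℚ.*-monoˡ-≤-nonNeg x {{nonNegative (rec-nonNeg (suc n))}}
          (*-mono-≤ (proj₁ (rec^-bounds (suc n) p)) (ℚ.≤-trans (ℚ.0≤∣p∣ e) (H N n n<N)) (proj₂ (rec^-bounds (suc n) p)) (H N n n<N)))
        where
        x = rec (suc n)
        s = sgn (suc n)
        X = rec (suc n) ^ p
        e = d N (suc n)

  -- Bounds for the individual errors

  module _ where
    open Truncated

    0≤one : ∀ N → 0ℚ ≤ one N
    0≤one _ = 0≤1

    ∣sgn∣≤1 : ∀ n → ∣ sgn n ∣ ≤ 1ℚ
    ∣sgn∣≤1 n = ℚ.≤-reflexive (∣sgn∣ n)

    Tiny-gap : Tiny one (λ N n → gap (ℕ.pred n) N)
    Tiny-gap = tiny 1ℚ 0≤1 λ N n n<N → ℚ.≤-reflexive (trans (ℚ.0≤p⇒∣p∣≡p (gap-nonNeg (ℕ.<⇒≤ n<N)))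
      (solve 1 (λ g → g := con 1ℚ :* (con 1ℚ :* g)) refl (gap n N)))

    Tiny-far : Tiny one (λ N n → rec (n ℕ.+ N))
    Tiny-far = tiny 1ℚ 0≤1 λ N n n<N → subst₂ _≤_ (sym (ℚ.0≤p⇒∣p∣≡p (rec-nonNeg (suc n ℕ.+ N))))
      (solve 1 (λ g → g := con 1ℚ :* (con 1ℚ :* g)) refl (gap n N)) (rec-far≤gap n<N)

    Tiny-sgn-* : ∀ {h d} → Tiny h d → Tiny h (λ N n → sgn n * d N n)
    Tiny-sgn-* {h} {d} = Tiny-*-unit {d = d} (λ _ n → sgn n) (λ _ n _ → ∣sgn∣≤1 (suc n))

    Tiny-sgnN-* : ∀ {h d} → Tiny h d → Tiny h (λ N n → sgn N * d N n)
    Tiny-sgnN-* {h} {d} = Tiny-*-unit {d = d} (λ N _ → sgn N) (λ N _ _ → ∣sgn∣≤1 N)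

    Tiny-rec-* : ∀ {h d} → Tiny h d → Tiny h (λ N n → rec n * d N n)
    Tiny-rec-* {h} {d} = Tiny-*-unit {d = d} (λ _ n → rec n)
      (λ _ n _ → subst (_≤ 1ℚ) (sym (ℚ.0≤p⇒∣p∣≡p (rec-nonNeg (suc n)))) (rec≤1 (suc n)))

    Tiny-errU : Tiny one (λ N n → rec n * errU N n)
    Tiny-errU = Tiny-∑ 0≤one (Tiny-sgn-* (Tiny-sgnN-* Tiny-gap))

    Tiny-errK : Tiny one (λ N n → rec n * errK N n)
    Tiny-errK = Tiny-∑ 0≤one (Tiny-sgn-* (Tiny-sgnN-* Tiny-far))

    Tiny-errG : Tiny one (λ N n → rec n * errG N n)
    Tiny-errG = Tiny-∑ 0≤one Tiny-gap

    Tiny-errC : Tiny one (λ N n → rec n * errC N n)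
    Tiny-errC = Tiny-∑ 0≤one Tiny-far

    Tiny-errY : Tiny harmonic (λ N n → rec n * errY N n)
    Tiny-errY = Tiny-∑ harmonic-nonNeg (Tiny-+ (Tiny-one⇒harmonic (Tiny-sgn-* Tiny-errU))
      (Tiny-neg (Tiny-*-harmonic (λ N _ → altHarmonic N) (λ N _ _ → ∣altHarmonic∣≤ N) Tiny-gap)))

    -- The logarithm in the bound is genuine here: the boundary coefficient `altH N` has modulus
    -- `harmonic N`.
    Tiny-errT : Tiny harmonic (λ N n → rec n * errT N n)
    Tiny-errT = Tiny-∑ harmonic-nonNeg (Tiny-+ (Tiny-+
      (Tiny-one⇒harmonic (Tiny-pred 0≤one (λ N → ℚ.*-zeroʳ (rec 0)) Tiny-errK))
      (Tiny-sgn-* (Tiny-*-harmonic (λ N _ → altH N) (λ N _ _ → ℚ.≤-reflexive (∣altH∣ N)) (Tiny-+ Tiny-far (Tiny-neg Tiny-gap)))))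
      (Tiny-neg (Tiny-one⇒harmonic Tiny-errU)))

    Tiny-harmonic-* : ∀ {d} → Tiny one d → Tiny harmonic (λ N n → harmonic n * d N n)
    Tiny-harmonic-* = Tiny-*-harmonic (λ _ n → harmonic n) λ N n n<N →
      subst (_≤ harmonic N) (sym (ℚ.0≤p⇒∣p∣≡p (harmonic-nonNeg (suc n)))) (harmonic-mono n<N)

    err₁-null : ∀ p → Null (λ N → ∑₁ (Identities.err₁ N p) N)
    err₁-null = Tiny⇒Null (Tiny-+
      (Tiny-*-harmonic (λ _ n → altHarmonic n)
        (λ N n n<N → ℚ.≤-trans (∣altHarmonic∣≤ (suc n)) (harmonic-mono n<N)) Tiny-errU) Tiny-errY)

    err₂-null : ∀ p → Null (λ N → ∑₁ (Identities₂.err₂ N p) N)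
    err₂-null p = Tiny⇒Null (Tiny-cong
      (λ N n _ → solve 6 (λ x s h c g t → s :* (h :* (x :* c)) :+ :- (h :* (x :* g)) :+ :- (x :* t)
          := x :* (s :* (h :* c) :- h :* g :- t)) refl
        (rec (suc n)) (sgn p) (harmonic (suc n)) (errC N (suc n)) (errG N (suc n)) (errT N (suc n)))
      (Tiny-+ (Tiny-+ (Tiny-*-unit (λ _ _ → sgn p) (λ _ _ _ → ∣sgn∣≤1 p) (Tiny-harmonic-* Tiny-errC))
        (Tiny-neg (Tiny-harmonic-* Tiny-errG))) (Tiny-neg Tiny-errT))) p

    err₃-null : ∀ p → Null (λ N → ∑₁ (Identities₂.err₃ N p) N)
    err₃-null p = Tiny⇒Null (Tiny-one⇒harmonic (Tiny-rec-* (Tiny-cong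
      (λ N n _ → solve 4 (λ x s c k → s :* (x :* c) :+ x :* k := x :* (s :* c :+ k)) refl
        (rec (suc n)) (sgn p) (errC N (suc n)) (errK N (suc n)))
      (Tiny-+ (Tiny-*-unit (λ _ _ → sgn p) (λ _ _ _ → ∣sgn∣≤1 p) Tiny-errC) Tiny-errK)))) p

  -- Passage to the limit.

  neg-involutive : ∀ a → - - a ≡ a
  neg-involutive = solve 1 (λ a → :- :- a := a) refl

  IsCauchy-cong : ∀ (x : ℝ) y → (∀ n → approx x n ≡ y n) → IsCauchy y
  IsCauchy-cong (mkℝ x cx) y h ε 0<ε = proj₁ (cx ε 0<ε) , λ m n N≤m N≤n →
    subst₂ (λ u v → ∣ u - v ∣ < ε) (h m) (h n) (proj₂ (cx ε 0<ε) m n N≤m N≤n)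

  doubling-null : ∀ (x : ℝ) → Null (λ n → approx x (n ℕ.+ n) - approx x n)
  doubling-null (mkℝ x cx) ε 0<ε = proj₁ (cx ε 0<ε) , λ n N≤n →
    proj₂ (cx ε 0<ε) (n ℕ.+ n) n (ℕ.≤-trans N≤n (ℕ.m≤m+n n n)) N≤n

  even-null⇒null : ∀ (x : ℝ) → Null (λ n → approx x (n ℕ.+ n)) → Null (approx x)
  even-null⇒null x nx = Null-cong (λ n → solve 2 (λ a b → a :+ :- (a :- b) := b) refl (approx x (n ℕ.+ n)) (approx x n))
    (Null-+ nx (Null-neg (doubling-null x)))

  recip^ : ∀ n s → recip (suc n) ^ s ≡ rec (suc n) ^ s
  recip^ n s = cong (_^ s) (sym (rec-suc n))

  partialSum-ζ : ∀ s N → partialSum (λ n → recip n ^ s) N ≡ ∑₁ (λ n → rec n ^ s) N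
  partialSum-ζ s N = partialSum≡∑₁ N λ n → recip^ n s

  partialSum-ζ̄ : ∀ s N → partialSum (λ n → (- 1ℚ) ^ (n ℕ.∸ 1) * recip n ^ s) N ≡ - ∑₁ (λ n → sgn n * rec n ^ s) N
  partialSum-ζ̄ s N = trans (partialSum≡∑₁ N λ n → trans (cong (sgn n *_) (recip^ n s))
      (solve 2 (λ s X → s :* X := :- (con (- 1ℚ) :* s :* X)) refl (sgn n) (rec (suc n) ^ s)))
    (∑₁-neg (λ n → sgn n * rec n ^ s) N)

  L≡-altHarmonic : ∀ N → L 1 N ≡ - altHarmonic N
  L≡-altHarmonic N = trans (partialSum-ζ̄ 1 N) (cong -_ (∑₁-cong N λ n _ → cong (sgn (suc n) *_) (ℚ.*-identityʳ (rec (suc n)))))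

  1^n : ∀ n → 1ℚ ^ n ≡ 1ℚ
  1^n zero    = refl
  1^n (suc n) = trans (ℚ.*-identityˡ (1ℚ ^ n)) (1^n n)

  factor-bar : ∀ s n → factor (bar s) (suc n) ≡ sgn (suc n) * rec (suc n) ^ s
  factor-bar s n = cong (sgn (suc n) *_) (recip^ n s)

  factor-plain : ∀ s n → factor (plain s) (suc n) ≡ rec (suc n) ^ s
  factor-plain s n = trans (cong₂ _*_ (1^n (suc n)) (recip^ n s)) (ℚ.*-identityˡ _)

  ∑-factor-bar₁ : ∀ N → partialSum (factor (bar 1)) N ≡ altHarmonic N
  ∑-factor-bar₁ N = partialSum≡∑₁ N λ n → trans (factor-bar 1 n) (cong (sgn (suc n) *_) (ℚ.*-identityʳ _))

  ∑-factor-plain₁ : ∀ N → partialSum (factor (plain 1)) N ≡ harmonic N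
  ∑-factor-plain₁ N = partialSum≡∑₁ N λ n → trans (factor-plain 1 n) (ℚ.*-identityʳ _)

  ∑-factor-plain₂ : ∀ N → partialSum (factor (plain 2)) N ≡ harmonic² N
  ∑-factor-plain₂ N = partialSum≡∑₁ N λ n → trans (factor-plain 2 n) (cong (rec (suc n) *_) (ℚ.*-identityʳ _))

  partialSum-ζ⋆ : ∀ s₁ s₂ (f g : ℕ → ℚ) N → (∀ n → factor s₁ (suc n) ≡ f (suc n)) → (∀ n → partialSum (factor s₂) n ≡ g n) →
    partialSum (λ n → factor s₁ n * partialSum (factor s₂) n) N ≡ ∑₁ (λ n → f n * g n) N
  partialSum-ζ⋆ s₁ s₂ f g N hf hg = partialSum≡∑₁ {f = λ n → f n * g n} N λ n → cong₂ _*_ (hf n) (hg (suc n))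

  partialSum-square : ∀ q (f g : ℕ → ℚ) N → (∀ n → f n * f n ≡ g n * g n) →
    partialSum (λ n → (- 1ℚ) ^ (n ℕ.∸ 1) * recip n ^ q * f n ^ 2) N ≡ - ∑₁ (λ n → sgn n * rec n ^ q * (g n * g n)) N
  partialSum-square q f g N h = trans (partialSum≡∑₁ N λ n →
      trans (cong₂ (λ u v → sgn n * u * v) (recip^ n q) (trans (cong (f (suc n) *_) (ℚ.*-identityʳ (f (suc n)))) (h (suc n))))
        (solve 3 (λ s X g → s :* X :* g := :- (con (- 1ℚ) :* s :* X :* g)) refl (sgn n) (rec (suc n) ^ q) (g (suc n) * g (suc n))))
    (∑₁-neg (λ n → sgn n * rec n ^ q * (g n * g n)) N)

  -- By Catalan's identity `riemannSum N` is the alternating sum up to 2N, so this is the difference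
  -- of the series ζ̄(1) truncated at 2N and at N.
  ln2-null : Null (λ N → riemannSum N + altHarmonic N)
  ln2-null = Null-cong (λ N → trans (cong₂ _-_ (RiemannSum.riemannSum≡L N) (L≡-altHarmonic N))
      (solve 2 (λ r l → r :- :- l := r :+ l) refl (riemannSum N) (altHarmonic N)))
    (doubling-null (ζ̄ 1))

  partialSum-ζ2 : ∀ N → partialSum (λ n → recip n ^ 2) N ≡ harmonic² N
  partialSum-ζ2 N = trans (partialSum-ζ 2 N) (∑₁-cong N λ n _ → cong (rec (suc n) *_) (ℚ.*-identityʳ (rec (suc n))))

  harmonic²-isCauchy : IsCauchy harmonic²
  harmonic²-isCauchy = IsCauchy-cong (ζ 2) harmonic² partialSum-ζ2

  altHarmonic²-isCauchy : IsCauchy altHarmonic²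
  altHarmonic²-isCauchy = IsCauchy-cong (⊖ ζ̄ 2) altHarmonic² λ N → trans (cong -_ (partialSum-ζ̄ 2 N))
    (trans (neg-involutive (∑₁ (λ n → sgn n * rec n ^ 2) N))
      (∑₁-cong N λ n _ → cong (λ u → sgn (suc n) * (rec (suc n) * u)) (ℚ.*-identityʳ (rec (suc n)))))

  -- Odd terms cancel and even ones double, and 2/(2k)² is half of 1/k².
  altHarmonic²-even : ∀ n → altHarmonic² (n ℕ.+ n) + harmonic² (n ℕ.+ n) ≡ ½ * harmonic² n
  altHarmonic²-even zero    = refl
  altHarmonic²-even (suc n) = subst (λ k → altHarmonic² (suc k) + harmonic² (suc k) ≡ ½ * harmonic² (suc n)) (sym (ℕ.+-suc n n))
    (step (altHarmonic² (n ℕ.+ n)) (harmonic² (n ℕ.+ n)) (sgn (n ℕ.+ n)) (rec (suc (n ℕ.+ n))) (rec (ℕ.2+ (n ℕ.+ n)))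
      (harmonic² n) (rec (suc n)) (RiemannSum.[-1]^even n)
      (trans (rec-suc n) (trans (RiemannSum.recip-double n) (sym (cong₂ _+_ (rec-suc (suc (n ℕ.+ n))) (rec-suc (suc (n ℕ.+ n)))))))
      (altHarmonic²-even n))
    where
    step : ∀ a h s x y g r → s ≡ 1ℚ → r ≡ y + y → a + h ≡ ½ * g →
      (a + (- 1ℚ * s) * (x * x) + (- 1ℚ * (- 1ℚ * s)) * (y * y)) + (h + x * x + y * y) ≡ ½ * (g + r * r)
    step a h _ x y g _ refl refl eq = trans
      (solve 4 (λ a h x y → (a :+ (con (- 1ℚ) :* con 1ℚ) :* (x :* x) :+ (con (- 1ℚ) :* (con (- 1ℚ) :* con 1ℚ)) :* (y :* y)) :+ (h :+ x :* x :+ y :* y)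
        := (a :+ h) :+ con ½ :* ((y :+ y) :* (y :+ y))) refl a h x y)
      (trans (cong (_+ ½ * ((y + y) * (y + y))) eq) (sym (ℚ.*-distribˡ-+ ½ g ((y + y) * (y + y)))))

  -- ζ̄(2) = ζ(2)/2.
  ζ̄2-null : Null (λ N → ½ * harmonic² N + altHarmonic² N)
  ζ̄2-null = even-null⇒null
    (fromℚ ½ ⊗ mkℝ harmonic² harmonic²-isCauchy ⊕ mkℝ altHarmonic² altHarmonic²-isCauchy)
    -- Truncated at 2N, the expression is half the difference of `harmonic²` at N and at 2N.
    (Null-cong (λ N → trans
      (solve 2 (λ h g → (h :- g) :* con (- ½) := con ½ :* g :- con ½ :* h) refl (harmonic² (N ℕ.+ N)) (harmonic² N))
      (trans (cong (_- ½ * harmonic² (N ℕ.+ N)) (sym (altHarmonic²-even N)))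
      (solve 2 (λ h a → a :+ h :- con ½ :* h := con ½ :* h :+ a) refl (harmonic² (N ℕ.+ N)) (altHarmonic² (N ℕ.+ N)))))
    (Null-*-Cauchy (doubling-null (mkℝ harmonic² harmonic²-isCauchy)) (const-isCauchy (- ½))))

  abstract
    -- `l` and `Z₂` stand for the truncations of ln 2 and ζ(2), and `lam` and `E` for
    -- `altHarmonic N` and `altHarmonic² N`. Once the three identities are inserted, everything
    -- cancels at finite `N` except `l` against `- lam`, half of `Z₂` against `- E`, and the errors.
    assemble : ∀ l lam C D Z₂ E Zq Eq c₂ c₂₂ A B P σ hH gL hL Z E′ e₁ e₂ e₃ I₁ I₂ I₃ →
      I₁ ≡ (1ℚ + 1ℚ) * (lam * C) - (1ℚ + ½) * A + gL - lam * D + c₂₂ + ½ * c₂ + (P + 1ℚ + 1ℚ) * hL + e₁ →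
      I₂ ≡ (P + fromℕ 3) * hH - (1ℚ + σ) * B + E * Eq - lam * (Z - E′) - hL + c₂₂ + c₂ + e₂ →
      I₃ ≡ - (σ * hH) + E * Zq - lam * (Z - E′) - hL + e₃ →
      (+ 3 / 2) * - A + - ((1ℚ + σ) * - B)
        - (l * (C + - D) + ½ * Z₂ * (Zq + - Eq) + ½ * c₂ + - I₂ + - - I₁ + (P + fromℕ 3 + σ) * hH + - gL + - - I₃ + - ((P + 1ℚ + 1ℚ) * hL) + l * C)
      ≡ (l + lam) * (D - (C + C)) + (½ * Z₂ + E) * (Eq - Zq) + - e₁ + e₂ + - e₃
    assemble l lam C D Z₂ E Zq Eq c₂ c₂₂ A B P σ hH gL hL Z E′ e₁ e₂ e₃ _ _ _ refl refl refl =
      solve 22 (λ l lam C D Z₂ E Zq Eq c₂ c₂₂ A B P σ hH gL hL Z E′ e₁ e₂ e₃ →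
        con (+ 3 / 2) :* :- A :+ :- ((con 1ℚ :+ σ) :* :- B)
          :- (l :* (C :+ :- D) :+ con ½ :* Z₂ :* (Zq :+ :- Eq) :+ con ½ :* c₂
            :+ :- ((P :+ con (fromℕ 3)) :* hH :- (con 1ℚ :+ σ) :* B :+ E :* Eq :- lam :* (Z :- E′) :- hL :+ c₂₂ :+ c₂ :+ e₂)
            :+ :- :- ((con 1ℚ :+ con 1ℚ) :* (lam :* C) :- (con 1ℚ :+ con ½) :* A :+ gL :- lam :* D :+ c₂₂ :+ con ½ :* c₂ :+ (P :+ con 1ℚ :+ con 1ℚ) :* hL :+ e₁)
            :+ (P :+ con (fromℕ 3) :+ σ) :* hH :+ :- gL
            :+ :- :- (:- (σ :* hH) :+ E :* Zq :- lam :* (Z :- E′) :- hL :+ e₃)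
            :+ :- ((P :+ con 1ℚ :+ con 1ℚ) :* hL) :+ l :* C)
        := (l :+ lam) :* (D :- (C :+ C)) :+ (con ½ :* Z₂ :+ E) :* (Eq :- Zq) :+ :- e₁ :+ e₂ :+ :- e₃) refl
        l lam C D Z₂ E Zq Eq c₂ c₂₂ A B P σ hH gL hL Z E′ e₁ e₂ e₃

  -- The truncated form of the theorem

  module Assembly (p : ℕ) where

    errors : ℕ → ℚ
    errors N = (riemannSum N + lam) * (⟨ DH ⟩ - (⟨ CL ⟩ + ⟨ CL ⟩)) + (½ * harmonic² N + altHarmonic² N) * (⟨ sgn-^ (2 ℕ.+ p) ⟩ - ⟨ x^p+2 ⟩)
      + - ⟨ err₁ ⟩ + ⟨ err₂ ⟩ + - ⟨ err₃ ⟩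
      where
      open Truncated N
      open Identities N p
      open Identities₂ N p

    q : ℕ
    q = 2 ℕ.+ p

    -- Packaged as reals so that the cofactors in `errors` are Cauchy by the arithmetic of `ℝ`, as
    -- `Null-*-Cauchy` requires.
    ⟨CL⟩ ⟨DH⟩ Zq Eq : ℝ
    ⟨CL⟩ = mkℝ (∑₁ λ n → sgn n * rec n ^ q * altHarmonic n) (IsCauchy-cong (ζ⋆ (bar q) (bar 1)) _ λ N →
      partialSum-ζ⋆ (bar q) (bar 1) (λ n → sgn n * rec n ^ q) altHarmonic N (factor-bar q) ∑-factor-bar₁)
    ⟨DH⟩ = mkℝ (∑₁ λ n → sgn n * rec n ^ q * harmonic n) (IsCauchy-cong (ζ⋆ (bar q) (plain 1)) _ λ N →
      partialSum-ζ⋆ (bar q) (plain 1) (λ n → sgn n * rec n ^ q) harmonic N (factor-bar q) ∑-factor-plain₁)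
    Zq = mkℝ (∑₁ λ n → rec n ^ q) (IsCauchy-cong (ζ q) _ (partialSum-ζ q))
    Eq = mkℝ (∑₁ λ n → sgn n * rec n ^ q) (IsCauchy-cong (⊖ ζ̄ q) _ λ N →
      trans (cong -_ (partialSum-ζ̄ q N)) (neg-involutive (∑₁ (λ n → sgn n * rec n ^ q) N)))

    errors-null : Null errors
    errors-null = Null-+ (Null-+ (Null-+ (Null-+
      (Null-*-Cauchy ln2-null (isCauchy (⟨DH⟩ ⊝ (⟨CL⟩ ⊕ ⟨CL⟩))))
      (Null-*-Cauchy ζ̄2-null (isCauchy (Eq ⊝ Zq))))
      (Null-neg (err₁-null p))) (err₂-null p)) (Null-neg (err₃-null p))

    module _ (N : ℕ) where
      open Truncated N
      open Identities N p
      open Identities₂ N p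

      Σ₁ Σ₂ Σ₃ : ℕ → ℚ
      Σ₁ i = (1ℚ - sgn (suc i)) * (⟨ (λ n → sgn n * rec n ^ (2 ℕ.+ i) * harmonic n) ⟩ * ⟨ (λ n → rec n ^ (suc p ℕ.∸ i)) ⟩)
      Σ₂ i = ⟨ (λ n → rec n ^ (2 ℕ.+ i) * altHarmonic n) ⟩ * ⟨ sgn-^ (suc p ℕ.∸ i) ⟩
      Σ₃ i = sgn i * (⟨ (λ n → rec n ^ (suc p ℕ.∸ i)) ⟩ * ⟨ sgn-^ (3 ℕ.+ i) ⟩)

      bar-bar₁ : ∀ s → partialSum (λ n → factor (bar s) n * partialSum (factor (bar 1)) n) N ≡ ⟨ (λ n → sgn n * rec n ^ s * altHarmonic n) ⟩
      bar-bar₁ s = partialSum-ζ⋆ (bar s) (bar 1) (sgn-^ s) altHarmonic N (factor-bar s) ∑-factor-bar₁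

      bar-plain₁ : ∀ s → partialSum (λ n → factor (bar s) n * partialSum (factor (plain 1)) n) N ≡ ⟨ (λ n → sgn n * rec n ^ s * harmonic n) ⟩
      bar-plain₁ s = partialSum-ζ⋆ (bar s) (plain 1) (sgn-^ s) harmonic N (factor-bar s) ∑-factor-plain₁

      bar-plain₂ : ∀ s → partialSum (λ n → factor (bar s) n * partialSum (factor (plain 2)) n) N ≡ ⟨ (λ n → sgn n * rec n ^ s * harmonic² n) ⟩
      bar-plain₂ s = partialSum-ζ⋆ (bar s) (plain 2) (sgn-^ s) harmonic² N (factor-bar s) ∑-factor-plain₂

      plain-bar₁ : ∀ s → partialSum (λ n → factor (plain s) n * partialSum (factor (bar 1)) n) N ≡ ⟨ (λ n → rec n ^ s * altHarmonic n) ⟩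
      plain-bar₁ s = partialSum-ζ⋆ (plain s) (bar 1) (λ n → rec n ^ s) altHarmonic N (factor-plain s) ∑-factor-bar₁

      A²-sum : partialSum (λ n → (- 1ℚ) ^ (n ℕ.∸ 1) * recip n ^ q * L 1 n ^ 2) N ≡ - ⟨ A² ⟩
      A²-sum = partialSum-square q (L 1) altHarmonic N λ n → trans (cong (λ u → u * u) (L≡-altHarmonic n))
        (solve 1 (λ l → :- l :* :- l := l :* l) refl (altHarmonic n))

      B²-sum : partialSum (λ n → (- 1ℚ) ^ (n ℕ.∸ 1) * recip n ^ q * H n ^ 2) N ≡ - ⟨ B² ⟩
      B²-sum = partialSum-square q H harmonic N λ n → cong (λ u → u * u) (H≡harmonic n)

      Σ₁-term : ∀ i {x z} → x ≡ ⟨ (λ n → sgn n * rec n ^ (2 ℕ.+ i) * harmonic n) ⟩ → z ≡ ⟨ (λ n → rec n ^ (suc p ℕ.∸ i)) ⟩ →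
        (1ℚ - sgn (suc i)) * x * z ≡ Σ₁ i
      Σ₁-term i refl refl = ℚ.*-assoc (1ℚ - sgn (suc i)) _ _

      Σ₂-term : ∀ i {x z} → x ≡ ⟨ (λ n → rec n ^ (2 ℕ.+ i) * altHarmonic n) ⟩ → z ≡ - ⟨ sgn-^ (suc p ℕ.∸ i) ⟩ → x * z ≡ - Σ₂ i
      Σ₂-term i refl refl = sym (ℚ.neg-distribʳ-* ⟨ (λ n → rec n ^ (2 ℕ.+ i) * altHarmonic n) ⟩ ⟨ sgn-^ (suc p ℕ.∸ i) ⟩)

      Σ₃-term : ∀ i {x z} → x ≡ ⟨ (λ n → rec n ^ (suc p ℕ.∸ i)) ⟩ → z ≡ - ⟨ sgn-^ (3 ℕ.+ i) ⟩ → sgn i * x * z ≡ - Σ₃ i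
      Σ₃-term i refl refl = solve 3 (λ s x y → s :* x :* :- y := :- (s :* (x :* y))) refl
        (sgn i) ⟨ (λ n → rec n ^ (suc p ℕ.∸ i)) ⟩ ⟨ sgn-^ (3 ℕ.+ i) ⟩

      p+2-cast : fromℕ (suc p ℕ.+ 2) ≡ fromℕ p + fromℕ 3
      p+2-cast = trans (cong fromℕ (sym (ℕ.+-suc p 2))) (RiemannSum.fromℕ-+ p 3)

      p+1-cast : fromℕ (suc p ℕ.+ 1) ≡ fromℕ p + 1ℚ + 1ℚ
      p+1-cast = trans (RiemannSum.fromℕ-+ (suc p) 1) (cong (_+ 1ℚ) (fromℕ-suc p))

      total : _
      total = assemble (riemannSum N) lam ⟨ CL ⟩ ⟨ DH ⟩ (harmonic² N) (altHarmonic² N) ⟨ x^p+2 ⟩ ⟨ sgn-^ (2 ℕ.+ p) ⟩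
        ⟨ c₂ ⟩ ⟨ c₂₂ ⟩ ⟨ A² ⟩ ⟨ B² ⟩ (fromℕ p) (sgn p) ⟨ hH ⟩ ⟨ gL ⟩ ⟨ hL ⟩ ⟨ x^p+3 ⟩ ⟨ sgn-^ (3 ℕ.+ p) ⟩
        ⟨ err₁ ⟩ ⟨ err₂ ⟩ ⟨ err₃ ⟩ (∑₀ Σ₂ (suc p)) (∑₀ Σ₁ p) (∑₀ Σ₃ p)
        (trans identity₁ (cong (λ u → (1ℚ + 1ℚ) * (lam * ⟨ CL ⟩) - (1ℚ + ½) * ⟨ A² ⟩ + ⟨ gL ⟩ - lam * ⟨ DH ⟩ + ⟨ c₂₂ ⟩ + ½ * ⟨ c₂ ⟩
          + (u + 1ℚ) * ⟨ hL ⟩ + ⟨ err₁ ⟩) (fromℕ-suc p)))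
        identity₂ identity₃

open import Defs
open import Data.Integer.Base using (+_)
open import Data.Nat.Base using (ℕ; NonZero; _+_; _∸_; n>1⇒nonTrivial)
open import Data.Rational.Base as ℚ using (1ℚ; ½; -_)
open import Data.Nat.Base using (suc)
open import Relation.Binary.PropositionalEquality using (_≡_; sym; trans; cong; cong₂)
open Truncation

-- Return to the series of the theorem

open SumValue

∑-Σ₁ : ∀ p .{{_ : NonZero p}} N → SumValue {2} {p} (λ j 2≤j j≤p →
    fromℚ (1ℚ ℚ.- (- 1ℚ) ^ (j ∸ 1))
    ⊗ ζ⋆ (bar j) (plain 1) {{n>1⇒nonTrivial 2≤j}}
    ⊗ ζ (2 + p ∸ j) {{nonTrivial-2+p∸j j≤p}})
  (Assembly.Σ₁ (p ∸ 1) N) N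
∑-Σ₁ (suc p) N = ∑-value λ i _ → Σ₁-term N i (bar-plain₁ N (2 + i)) (partialSum-ζ (suc p ∸ i) N)
  where open Assembly p

∑-Σ₂ : ∀ p .{{_ : NonZero p}} N → SumValue {2} {1 + p} (λ j 2≤j j≤1+p →
    ζ⋆ (plain j) (bar 1) {{n>1⇒nonTrivial 2≤j}}
    ⊗ ζ̄ (2 + p ∸ j) {{nonZero-2+p∸j j≤1+p}})
  (λ i → - Assembly.Σ₂ (p ∸ 1) N i) N
∑-Σ₂ (suc p) N = ∑-value λ i _ → Σ₂-term N i (plain-bar₁ N (2 + i)) (partialSum-ζ̄ (suc p ∸ i) N)
  where open Assembly p

∑-Σ₃ : ∀ p .{{_ : NonZero p}} N → SumValue {1} {p ∸ 1} (λ i 1≤i i≤p-1 →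
    fromℚ ((- 1ℚ) ^ (i ∸ 1))
    ⊗ ζ (1 + p ∸ i) {{nonTrivial-1+p∸i i≤p-1}}
    ⊗ ζ̄ (2 + i))
  (λ i → - Assembly.Σ₃ (p ∸ 1) N i) N
∑-Σ₃ (suc p) N = ∑-value λ i _ → Σ₃-term N i (partialSum-ζ (suc p ∸ i) N) (partialSum-ζ̄ (3 + i) N)
  where open Assembly p

-- Both approximants unfold to rational expressions, in which each partial sum is replaced by its
-- `∑₁` form, summand by summand; `total` then applies. Matching on `suc p` provides the shifted
-- parameter of `Assembly`.
difference : ∀ p .{{_ : NonZero p}} N →
    approx (fromℚ (+ 3 ℚ./ 2) ⊗ ∑∞ (λ n → (- 1ℚ) ^ (n ∸ 1) ℚ.* recip n ^ (1 + p) ℚ.* L 1 n ^ 2) (L²-convergent 1 (1 + p))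
    ⊝ fromℚ (1ℚ ℚ.+ (- 1ℚ) ^ (p ∸ 1)) ⊗ ∑∞ (λ n → (- 1ℚ) ^ (n ∸ 1) ℚ.* recip n ^ (1 + p) ℚ.* H n ^ 2) (H²-convergent (1 + p))) N
    ℚ.- approx (ln2 ⊗ (ζ⋆ (bar (1 + p)) (bar 1) ⊝ ζ⋆ (bar (1 + p)) (plain 1))
    ⊕ fromℚ ½ ⊗ ζ 2 ⊗ (ζ (1 + p) ⊕ ζ̄ (1 + p))
    ⊕ fromℚ ½ ⊗ ζ⋆ (bar (1 + p)) (plain 2)
    ⊝ ∑ 2 p (λ j 2≤j j≤p →
    fromℚ (1ℚ ℚ.- (- 1ℚ) ^ (j ∸ 1))
    ⊗ ζ⋆ (bar j) (plain 1) {{n>1⇒nonTrivial 2≤j}}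
    ⊗ ζ (2 + p ∸ j) {{nonTrivial-2+p∸j j≤p}})
    ⊝ ∑ 2 (1 + p) (λ j 2≤j j≤1+p →
    ζ⋆ (plain j) (bar 1) {{n>1⇒nonTrivial 2≤j}}
    ⊗ ζ̄ (2 + p ∸ j) {{nonZero-2+p∸j j≤1+p}})
    ⊕ fromℚ (fromℕ (p + 2) ℚ.+ (- 1ℚ) ^ (p ∸ 1)) ⊗ ζ⋆ (bar (2 + p)) (plain 1)
    ⊝ ζ⋆ (plain (2 + p)) (bar 1)
    ⊝ ∑ 1 (p ∸ 1) (λ i 1≤i i≤p-1 →
    fromℚ ((- 1ℚ) ^ (i ∸ 1))
    ⊗ ζ (1 + p ∸ i) {{nonTrivial-1+p∸i i≤p-1}}
    ⊗ ζ̄ (2 + i))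
    ⊝ fromℚ (fromℕ (p + 1)) ⊗ ζ⋆ (bar (2 + p)) (bar 1)
    ⊕ ln2 ⊗ ζ⋆ (bar (1 + p)) (bar 1)) N
    ≡ Assembly.errors (p ∸ 1) N
difference (suc p) {{p≢0}} N = let v₁ = value (∑-Σ₁ (suc p) {{p≢0}} N); v₂ = value (∑-Σ₂ (suc p) {{p≢0}} N); v₃ = value (∑-Σ₃ (suc p) {{p≢0}} N) in trans
    (cong₂ ℚ._-_
      (cong₂ (λ a b → (+ 3 ℚ./ 2) ℚ.* a ℚ.+ - ((1ℚ ℚ.+ sgn p) ℚ.* b)) (A²-sum N) (B²-sum N))
      (cong₂ ℚ._+_ (cong₂ ℚ._+_ (cong₂ ℚ._+_ (cong₂ ℚ._+_ (cong₂ ℚ._+_ (cong₂ ℚ._+_ (cong₂ ℚ._+_ (cong₂ ℚ._+_ (cong₂ ℚ._+_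
        (cong₂ (λ c d → riemannSum N ℚ.* (c ℚ.+ - d)) (bar-bar₁ N (2 + p)) (bar-plain₁ N (2 + p)))
        (cong₂ (λ z s → ½ ℚ.* z ℚ.* s) (partialSum-ζ2 N) (cong₂ ℚ._+_ (partialSum-ζ (2 + p) N) (partialSum-ζ̄ (2 + p) N))))
        (cong (½ ℚ.*_) (bar-plain₂ N (2 + p))))
        (cong -_ v₁))
        (cong -_ (trans v₂ (∑₀-neg (Σ₂ N) (suc p)))))
        (cong₂ (λ c x → (c ℚ.+ sgn p) ℚ.* x) (p+2-cast N) (bar-plain₁ N (3 + p))))
        (cong -_ (plain-bar₁ N (3 + p))))
        (cong -_ (trans v₃ (∑₀-neg (Σ₃ N) p))))
        (cong₂ (λ c x → - (c ℚ.* x)) (p+1-cast N) (bar-bar₁ N (3 + p))))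
        (cong (riemannSum N ℚ.*_) (bar-bar₁ N (2 + p)))))
    (total N)
  where open Assembly p

theorem3p2 : ∀ (p : ℕ) .{{_ : NonZero p}} →
    fromℚ (+ 3 ℚ./ 2) ⊗ ∑∞ (λ n → (- 1ℚ) ^ (n ∸ 1) ℚ.* recip n ^ (1 + p) ℚ.* L 1 n ^ 2) (L²-convergent 1 (1 + p))
    ⊝ fromℚ (1ℚ ℚ.+ (- 1ℚ) ^ (p ∸ 1)) ⊗ ∑∞ (λ n → (- 1ℚ) ^ (n ∸ 1) ℚ.* recip n ^ (1 + p) ℚ.* H n ^ 2) (H²-convergent (1 + p))
    ≃
    ln2 ⊗ (ζ⋆ (bar (1 + p)) (bar 1) ⊝ ζ⋆ (bar (1 + p)) (plain 1))
    ⊕ fromℚ ½ ⊗ ζ 2 ⊗ (ζ (1 + p) ⊕ ζ̄ (1 + p))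
    ⊕ fromℚ ½ ⊗ ζ⋆ (bar (1 + p)) (plain 2)
    ⊝ ∑ 2 p (λ j 2≤j j≤p →
    fromℚ (1ℚ ℚ.- (- 1ℚ) ^ (j ∸ 1))
    ⊗ ζ⋆ (bar j) (plain 1) {{n>1⇒nonTrivial 2≤j}}
    ⊗ ζ (2 + p ∸ j) {{nonTrivial-2+p∸j j≤p}})
    ⊝ ∑ 2 (1 + p) (λ j 2≤j j≤1+p →
    ζ⋆ (plain j) (bar 1) {{n>1⇒nonTrivial 2≤j}}
    ⊗ ζ̄ (2 + p ∸ j) {{nonZero-2+p∸j j≤1+p}})
    ⊕ fromℚ (fromℕ (p + 2) ℚ.+ (- 1ℚ) ^ (p ∸ 1)) ⊗ ζ⋆ (bar (2 + p)) (plain 1)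
    ⊝ ζ⋆ (plain (2 + p)) (bar 1)
    ⊝ ∑ 1 (p ∸ 1) (λ i 1≤i i≤p-1 →
    fromℚ ((- 1ℚ) ^ (i ∸ 1))
    ⊗ ζ (1 + p ∸ i) {{nonTrivial-1+p∸i i≤p-1}}
    ⊗ ζ̄ (2 + i))
    ⊝ fromℚ (fromℕ (p + 1)) ⊗ ζ⋆ (bar (2 + p)) (bar 1)
    ⊕ ln2 ⊗ ζ⋆ (bar (1 + p)) (bar 1)
-- `≃` unfolds to `Null` of the difference of the approximants.
theorem3p2 p = let null = Null-cong (λ N → sym (difference p N)) (Assembly.errors-null (p ∸ 1)) in null
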